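{- (a) Let $K_1$ be a toroidal map of edge-symbol $(m,\ell;u,v)\in\{(3,3;6,6),(3,6;4,4),(4,4;3,6)\}$ which is $m_1$-edge orbital. Then for each positive integer $k_1\le m_1$ there exists a covering $\eta_{k_1}\colon M_{k_1}\to K_1$ where $M_{k_1}$ is a $k_1$-edge orbital toroidal map. (b) Let $K_2$ be a toroidal map of edge-symbol $(4,4;4,4)$ which is $m_2$-edge orbital. Then for each positive integer $k_2\le m_2$ there exists a covering $\eta_{k_2}\colon M_{k_2}\to K_2$ where $M_{k_2}$ is a $k_2$-edge orbital toroidal map.
   Context: A map is an embedding of a graph on a surface such that the closures of the components of the complement of the graph (the faces) are closed 2-discs, and any two distinct faces intersect in the empty set, a common vertex, or a common edge; a toroidal map is a map on the torus. An edge has edge-symbol $(m,\ell;u,v)$ if its end vertices have valences $u,v$ and its two incident faces have sizes $m,\ell$; a map "of edge-symbol $(m,\ell;u,v)$" is one all of whose edges have this edge-symbol. ${\rm Aut}(X)$ is the group of automorphisms of a map $X$ (bijections of the vertex set mapping cells to cells, with inverse doing the same). A map $X$ is $k$-edge orbital ($k$-orbital) if the edge set $E(X)$ splits into exactly $k$ orbits under ${\rm Aut}(X)$. A covering $\eta\colon M\to K$ of maps is a surjective map which is a topological covering map, preserves adjacency, and sends vertices, edges and faces of $M$ to vertices, edges and faces of $K$ respectively. -}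

module Defs where

open import Data.Fin.Base using (Fin)
open import Data.Fin.Properties using (_≟_)
open import Data.Fin.Permutation using (Permutation′; _⟨$⟩ʳ_; flip)
open import Data.List.Base using (length; filter; allFin)
open import Data.Nat.Base using (ℕ; _+_)
open import Data.Nat.GeneralisedArithmetic using (fold)
open import Data.Product using (∃; ∃!; _×_)
open import Data.Sum.Base using (_⊎_)
open import Function.Bundles using (_⇔_)
open import Relation.Binary.Construct.Closure.ReflexiveTransitive using (Star)
open import Relation.Binary.PropositionalEquality.Core using (_≡_; _≢_)
open import Relation.Nullary.Negation.Core using (¬_)

data Dim : Set where
  vertex edge face : Dim

-- Connected graphs cellularly embedded in closed oriented surfaces, encoded by
-- rotation systems.  A dart is an edge with a chosen direction; it belongs to
-- the vertex it leaves, to its underlying edge, and to the face on its left.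
-- α reverses a dart and σ rotates it clockwise about its vertex to the next
-- dart leaving that vertex.  The dart following d on the boundary of the face
-- to its left is then σ (α d).  The orientation only serves to present the
-- surface: automorphisms and coverings, defined below, need not respect it.
record RotationSystem : Set where
  field
    #darts : ℕ

  Dart : Set
  Dart = Fin #darts

  field
    nonempty     : Dart
    σ            : Permutation′ #darts
    α            : Dart → Dart
    α-involutive : ∀ d → α (α d) ≡ d
    α-fixfree    : ∀ d → α d ≢ d

  turn : Dim → Dart → Dart
  turn vertex d = σ ⟨$⟩ʳ d
  turn edge   d = α d
  turn face   d = σ ⟨$⟩ʳ (α d)

-- The cells of dimension i are the orbits of turn i on the darts; they are
-- numbered here, so that they form a finite type.
record CellularEmbedding : Set where
  field
    rotationSystem : RotationSystem

  open RotationSystem rotationSystem public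

  field
    #cells : Dim → ℕ

  Cell : Dim → Set
  Cell i = Fin (#cells i)

  field
    cell       : ∀ i → Dart → Cell i
    cell-onto  : ∀ i (x : Cell i) → ∃ λ d → cell i d ≡ x
    cell-orbit : ∀ i d d′ → cell i d ≡ cell i d′ ⇔ ∃ λ k → fold d (turn i) k ≡ d′

  Adjacent : Cell vertex → Cell vertex → Set
  Adjacent u v = ∃ λ d → cell vertex d ≡ u × cell vertex (α d) ≡ v

  field
    connected : ∀ u v → Star Adjacent u v

  -- For cells of different dimensions: one lies in the closure of the other.
  -- For cells of the same dimension: equality.
  Incident : ∀ {i j} → Cell i → Cell j → Set
  Incident {i} {j} x y = ∃ λ d → cell i d ≡ x × cell j d ≡ y

  Common : ∀ {i} → Cell face → Cell face → Cell i → Set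
  Common f g x = Incident x f × Incident x g

  MeetInNothing MeetInVertex MeetInEdge : Cell face → Cell face → Set
  MeetInNothing f g =
    ((v : Cell vertex) → ¬ Common f g v) × ((e : Cell edge) → ¬ Common f g e)
  MeetInVertex f g = ∃ λ (v : Cell vertex) →
    ((w : Cell vertex) → Common f g w ⇔ w ≡ v) × ((e : Cell edge) → ¬ Common f g e)
  MeetInEdge f g = ∃ λ (e : Cell edge) →
    ((w : Cell vertex) → Common f g w ⇔ Incident w e) ×
    ((e′ : Cell edge) → Common f g e′ ⇔ e′ ≡ e)

  -- The number of darts at x: the valence of a vertex, the size of a face.
  degree : ∀ i → Cell i → ℕ
  degree i x = length (filter (λ d → cell i d ≟ x) (allFin #darts))

record Map : Set where
  field
    embedding : CellularEmbedding

  open CellularEmbedding embedding public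

  field
    -- The closure of a face is a closed disc: its boundary walk repeats
    -- neither a vertex nor an edge.
    boundary-vertices : ∀ d d′ → cell face d ≡ cell face d′ →
                        cell vertex d ≡ cell vertex d′ → d ≡ d′
    boundary-edges    : ∀ d d′ → cell face d ≡ cell face d′ →
                        cell edge d ≡ cell edge d′ → d ≡ d′

    faces-meet : ∀ f g → f ≢ g →
                 MeetInNothing f g ⊎ MeetInVertex f g ⊎ MeetInEdge f g

open Map using (Cell)

-- Among the closed orientable surfaces, the torus is the one with V − E + F = 0.
Toroidal : Map → Set
Toroidal M = #cells vertex + #cells face ≡ #cells edge
  where open Map M

-- ⟨ m , ℓ ∣ u , v ⟩ is the edge-symbol (m,ℓ;u,v): first the sizes of the two
-- faces, then the valences of the two ends, each pair being unordered.
record EdgeSymbol : Set where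
  constructor ⟨_,_∣_,_⟩
  field
    m ℓ u v : ℕ

SamePair : ℕ → ℕ → ℕ → ℕ → Set
SamePair a b c d = (a ≡ c × b ≡ d) ⊎ (a ≡ d × b ≡ c)

-- The ends of the edge of a dart d are the vertices of d and α d, and its two
-- sides are the faces of d and α d.
HasEdgeSymbol : Map → EdgeSymbol → Set
HasEdgeSymbol M ⟨ m , ℓ ∣ u , v ⟩ = ∀ d →
  SamePair (degree face (cell face d)) (degree face (cell face (α d))) m ℓ ×
  SamePair (degree vertex (cell vertex d)) (degree vertex (cell vertex (α d))) u v
  where open Map M

module _ (M : Map) where
  open Map M hiding (Cell)

  VertexPerm : Set
  VertexPerm = Permutation′ (#cells vertex)

  -- π maps the vertex set of the cell x onto the vertex set of the cell y.
  Carries : VertexPerm → ∀ {i} → Cell M i → Cell M i → Set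
  Carries π x y = (v : Cell M vertex) → Incident v x ⇔ Incident (π ⟨$⟩ʳ v) y

  MapsCells : VertexPerm → Set
  MapsCells π = ∀ i (x : Cell M i) → ∃ λ (y : Cell M i) → Carries π x y

  IsAutomorphism : VertexPerm → Set
  IsAutomorphism π = MapsCells π × MapsCells (flip π)

  SameOrbit : Cell M edge → Cell M edge → Set
  SameOrbit e e′ = ∃ λ π → IsAutomorphism π × Carries π e e′

  -- The edges split into exactly k orbits: the orbits are numbered by Fin k.
  EdgeOrbital : ℕ → Set
  EdgeOrbital k = ∃ λ (orbit : Cell M edge → Fin k) →
    (∀ c → ∃ λ e → orbit e ≡ c) ×
    (∀ e e′ → orbit e ≡ orbit e′ ⇔ SameOrbit e e′)

-- Cellular coverings.  Since closed faces are discs, a dimension-preserving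
-- map of cells that respects incidence is realised by a topological covering
-- exactly when it is bijective on the cells incident to each given cell, that
-- is, on the links of the barycentric subdivision.
record Covering (M K : Map) : Set where
  private
    module M = Map M
    module K = Map K
  field
    η            : ∀ i → Cell M i → Cell K i
    η-onto       : ∀ i (y : Cell K i) → ∃ λ x → η i x ≡ y
    η-adjacent   : ∀ u v → M.Adjacent u v → K.Adjacent (η vertex u) (η vertex v)
    η-incident   : ∀ i j (x : Cell M i) (y : Cell M j) →
                   M.Incident x y → K.Incident (η i x) (η j y)
    η-local-bij  : ∀ i j (x : Cell M i) (z : Cell K j) → K.Incident (η i x) z →
                   ∃! _≡_ λ (y : Cell M j) → M.Incident x y × η j y ≡ z

{-# OPTIONS --safe #-}

-- A toroidal map K of one of these edge-symbols is the quotient of a doubly periodic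
-- tiling of the plane by a lattice L of translations: no element of the
-- fundamental group acts as a rotation, because a rotation fixes a vertex, an
-- edge or a face, whose valence or size would then be too small.  Translations
-- and half-turns normalise L, so the edge orbits of K are at most as many as the
-- directions of edges, which are two for (4,4;4,4) and three otherwise.
--
-- Let Λ be the lattice of all translations.  Then nΛ ⊆ L for some n > 0, and
-- the tiling modulo nΛ inherits all rotations, hence has a single edge orbit.
-- In the hexagonal cases let e and f be shortest vectors of Λ at an angle of
-- 120°.  Modulo the lattice spanned by n e and 2n f the tiling keeps half-turns
-- and a reflection, which leave at most two edge orbits; these differ, because
-- the straight walks (for (4,4;3,6), the strips of faces) in the direction of e
-- close up after n periods and the others do not.  For every other k ≤ m one
-- has k = m, and the identity of K serves.

module Submission where

open import Defs
open import Data.Fin.Base using (Fin; zero; suc; toℕ; fromℕ<; combine; remQuot; splitAt; join; _↑ˡ_; _↑ʳ_)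
open import Data.Fin.Patterns using (0F; 1F; 2F; 3F; 4F; 5F; 6F; 7F)
open import Data.Fin.Permutation
  using (permutation; _⟨$⟩ʳ_; _⟨$⟩ˡ_; flip; _∘ₚ_; inverseˡ; inverseʳ)
open import Data.Fin.Properties using (_≟_; toℕ-injective; toℕ<n; toℕ-fromℕ<; injective⇒≤; pigeonhole)
import Data.Fin.Properties as Fin
import Data.List.Base as List
open import Data.List.Base using (List; []; _∷_; filter; allFin; lookup)
open import Data.List.Membership.Propositional using (_∈_)
open import Data.List.Membership.Propositional.Properties using (∈-filter⁺; ∈-filter⁻; ∈-allFin; ∈-lookup)
import Data.List.Relation.Unary.All as All
open import Data.List.Relation.Unary.AllPairs using (_∷_)
open import Data.List.Relation.Unary.Any using (here; there; index)
open import Data.List.Relation.Unary.Any.Properties using (lookup-index)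
open import Data.List.Relation.Unary.Unique.Propositional using (Unique)
open import Data.List.Relation.Unary.Unique.Propositional.Properties using (allFin⁺; filter⁺)
open import Data.Nat.Base using (ℕ; zero; suc; _+_; _*_; _∸_; _⊔_; _≤_; _<_; z≤n; s≤s; z<s; s<s; NonZero; >-nonZero⁻¹)
open import Data.Nat.DivMod using (_%_; _/_; m≡m%n+[m/n]*n; m%n<n; m<n⇒m%n≡m)
open import Data.Nat.Divisibility using (_∣_; >⇒∤)
open import Data.Maybe.Base using (Maybe; just; nothing; maybe)
open import Data.Nat.GeneralisedArithmetic using (fold; fold-+)
import Data.Nat.Properties as ℕ
open import Data.Product using (∃; ∃!; ∃₂; _×_; _,_; proj₁; proj₂)
open import Data.Sum.Base using (_⊎_; inj₁; inj₂; [_,_]′)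
open import Data.Empty using (⊥)
open import Function.Base using (_∘_; id)
open import Function.Bundles using (_⇔_; mk⇔; module Equivalence)
open import Relation.Binary.Construct.Closure.ReflexiveTransitive using (Star; ε; _◅_; _◅◅_)
open import Relation.Binary.PropositionalEquality
  using (_≡_; _≢_; refl; sym; trans; cong; cong₂; subst; subst₂; module ≡-Reasoning)
open import Relation.Binary.Definitions using (tri<; tri≈; tri>)
open import Relation.Nullary using (¬_; Dec; yes; no; contradiction)
open Equivalence using (to; from)
open import Data.Integer.Base using (ℤ; 0ℤ; 1ℤ; -1ℤ; +_; -[1+_])
import Data.Integer.Base as ℤ
open import Data.Integer.Divisibility.Signed using (divides; ∣⇒∣ᵤ; ∣m+n∣n⇒∣m; ∣m∣n⇒∣m+n; ∣n⇒∣m*n; ∣-trans) renaming (_∣_ to _∣ℤ_)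
import Data.Integer.DivMod as ℤ
import Data.Integer.Properties as ℤ
open import Data.Integer.Tactic.RingSolver using (solve-∀)
open import Data.Product.Properties using (≡-dec)
open import Data.Vec.Base using ([]; _∷_)
import Data.Vec.Base as Vec
open import Relation.Nullary.Decidable using (True; toWitness; from-yes; ¬?; _×-dec_; _→-dec_)

-- Orbits of the turns and automorphisms of a map

-- Automorphisms are arbitrary permutations of the vertices, so exhibiting symmetries bounds the
-- number of edge orbits only from above. To keep two orbits apart one needs rigidity: faces are
-- discs with at least three sides that meet in at most a vertex or an edge, hence a permutation
-- that maps cells to cells acts on darts, and along every walk it stays direct or stays mirrored.
-- It carries a closed walk to a closed walk with the same word, read directly or mirrored, and this
-- is the invariant that tells directions apart.
--
-- The factor 2 in 2n f makes n periods in the other directions fail to close up. The lattice still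
-- admits the reflection that fixes e, because that reflection sends f to -e - f and 2n is a
-- multiple of n.
--
-- The tilings are tables on ℤ² × Fin q. Maps that respect translations are compared over the origin
-- only, so the laws of the tilings and of their symmetries become finite evaluations. The new tori
-- inherit the disc and intersection conditions from K along the covering, for every n.

fold-suc : {A : Set} (f : A → A) (x : A) (k : ℕ) → fold (f x) f k ≡ f (fold x f k)
fold-suc f x zero    = refl
fold-suc f x (suc k) = cong f (fold-suc f x k)

fold-hom : {A B : Set} {f : A → A} {g : B → B} (h : A → B) → (∀ x → h (f x) ≡ g (h x)) →
           ∀ x k → h (fold x f k) ≡ fold (h x) g k
fold-hom h h-hom x zero          = refl
fold-hom {g = g} h h-hom x (suc k) = trans (h-hom _) (cong g (fold-hom h h-hom x k))

fold-invariant : {A B : Set} {f : A → A} (h : A → B) → (∀ x → h (f x) ≡ h x) →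
                 ∀ x k → h (fold x f k) ≡ h x
fold-invariant h inv x zero    = refl
fold-invariant h inv x (suc k) = trans (inv _) (fold-invariant h inv x k)

fold-period : {A : Set} (f : A → A) {x : A} (n : ℕ) → fold x f n ≡ x → ∀ q → fold x f (q * n) ≡ x
fold-period f n per zero        = refl
fold-period f {x} n per (suc q) =
  trans (fold-+ x f n) (trans (cong (λ y → fold y f n) (fold-period f n per q)) per)

fold-% : {A : Set} (f : A → A) {x : A} (n : ℕ) .{{_ : NonZero n}} → fold x f n ≡ x →
         ∀ k → fold x f (k % n) ≡ fold x f k
fold-% f {x} n per k = sym (trans (cong (fold x f) (m≡m%n+[m/n]*n k n))
  (trans (fold-+ x f (k % n)) (cong (λ y → fold y f (k % n)) (fold-period f n per (k / n)))))

unique-lookup-injective : {A : Set} {xs : List A} → Unique xs →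
                          ∀ i j → lookup xs i ≡ lookup xs j → i ≡ j
unique-lookup-injective {xs = _ ∷ _}  _        zero    zero    _  = refl
unique-lookup-injective {xs = _ ∷ xs} (x∉ ∷ _) zero    (suc j) eq = contradiction eq (All.lookup x∉ (∈-lookup j))
unique-lookup-injective {xs = _ ∷ xs} (x∉ ∷ _) (suc i) zero    eq = contradiction (sym eq) (All.lookup x∉ (∈-lookup i))
unique-lookup-injective {xs = _ ∷ _}  (_ ∷ u)  (suc i) (suc j) eq = cong suc (unique-lookup-injective u i j eq)

least : {P : ℕ → Set} → (∀ n → Dec (P n)) → ∀ n → P n → ∃ λ k → P k × (∀ j → j < k → ¬ P j)
least {P} P? n Pn = search n 0 (λ _ ()) (subst P (sym (ℕ.+-identityʳ n)) Pn)
  where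
  search : ∀ fuel k → (∀ j → j < k → ¬ P j) → P (fuel + k) → ∃ λ k → P k × (∀ j → j < k → ¬ P j)
  search zero       k below Pk = k , Pk , below
  search (suc fuel) k below Pf with P? k
  ... | yes Pk = k , Pk , below
  ... | no ¬Pk = search fuel (suc k) below′ (subst P (sym (ℕ.+-suc fuel k)) Pf)
    where
    below′ : ∀ j → j < suc k → ¬ P j
    below′ j (s≤s j≤k) with ℕ.m≤n⇒m<n∨m≡n j≤k
    ... | inj₁ j<k  = below j j<k
    ... | inj₂ refl = ¬Pk

module Cells (X : CellularEmbedding) where
  open CellularEmbedding X public

  cell-fold : ∀ i d k → cell i (fold d (turn i) k) ≡ cell i d
  cell-fold i d k = sym (from (cell-orbit i d _) (k , refl))

  cell-turn : ∀ i d → cell i (turn i d) ≡ cell i d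
  cell-turn i d = cell-fold i d 1

  module _ (i : Dim) (d : Dart) where
    private
      orbit : ℕ → Dart
      orbit = fold d (turn i)

      deg : ℕ
      deg = degree i (cell i d)

      members : List Dart
      members = filter (λ d′ → cell i d′ ≟ cell i d) (allFin #darts)

      position : ∀ k → orbit k ∈ members
      position k = ∈-filter⁺ (λ d′ → cell i d′ ≟ cell i d) (∈-allFin _) (cell-fold i d k)

      returns : ∃ λ k → orbit (suc k) ≡ d
      returns = let k , eq = to (cell-orbit i (turn i d) d) (cell-turn i d)
                in k , trans (sym (fold-suc (turn i) d k)) eq

      minimal : ∃ λ p → orbit (suc p) ≡ d × (∀ j → j < p → orbit (suc j) ≢ d)
      minimal = least (λ k → orbit (suc k) ≟ d) (proj₁ returns) (proj₂ returns)

      period : ℕ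
      period = suc (proj₁ minimal)

      periodic : orbit period ≡ d
      periodic = proj₁ (proj₂ minimal)

      below-period : ∀ k → 0 < k → k < period → orbit k ≢ d
      below-period (suc k) _ (s≤s k<p) = proj₂ (proj₂ minimal) k k<p

      no-collision : ∀ j k → j < k → k < period → orbit j ≢ orbit k
      no-collision j k j<k k<p eq = below-period (period ∸ k + j) (ℕ.<-≤-trans (ℕ.m<n⇒0<n∸m k<p) (ℕ.m≤m+n _ j))
        (ℕ.<-≤-trans (ℕ.+-monoʳ-< (period ∸ k) j<k) (ℕ.≤-reflexive (ℕ.m∸n+n≡m (ℕ.<⇒≤ k<p))))
        (trans (fold-+ d (turn i) (period ∸ k)) (trans (cong (λ y → fold y (turn i) (period ∸ k)) eq)
          (trans (sym (fold-+ d (turn i) (period ∸ k)))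
            (trans (cong orbit (ℕ.m∸n+n≡m (ℕ.<⇒≤ k<p))) periodic))))

      orbit-injective : ∀ j k → j < period → k < period → orbit j ≡ orbit k → j ≡ k
      orbit-injective j k j<p k<p eq with ℕ.<-cmp j k
      ... | tri< j<k _ _ = contradiction eq (no-collision j k j<k k<p)
      ... | tri≈ _ j≡k _ = j≡k
      ... | tri> _ _ k<j = contradiction (sym eq) (no-collision k j k<j j<p)

      period≤deg : period ≤ deg
      period≤deg = injective⇒≤ {f = λ j → index (position (toℕ j))} λ {j} {k} eq →
        toℕ-injective (orbit-injective _ _ (toℕ<n j) (toℕ<n k)
          (trans (lookup-index (position (toℕ j)))
            (trans (cong (lookup members) eq) (sym (lookup-index (position (toℕ k)))))))

      exponent : (l : Fin deg) → ∃ λ k → orbit k ≡ lookup members l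
      exponent l = to (cell-orbit i d _)
        (sym (proj₂ (∈-filter⁻ (λ d′ → cell i d′ ≟ cell i d) {xs = allFin #darts} (∈-lookup l))))

      deg≤period : deg ≤ period
      deg≤period = injective⇒≤ {f = λ l → fromℕ< (m%n<n (proj₁ (exponent l)) period)} λ {l} {l′} eq →
        unique-lookup-injective (filter⁺ (λ d′ → cell i d′ ≟ cell i d) (allFin⁺ #darts)) l l′
          (trans (sym (reduce l)) (trans (cong orbit (trans (sym (toℕ-fromℕ< _))
            (trans (cong toℕ eq) (toℕ-fromℕ< _)))) (reduce l′)))
        where
        reduce : ∀ l → orbit (proj₁ (exponent l) % period) ≡ lookup members l
        reduce l = trans (fold-% (turn i) period periodic (proj₁ (exponent l))) (proj₂ (exponent l))

      period≡deg : period ≡ deg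
      period≡deg = ℕ.≤-antisym period≤deg deg≤period

    -- `degree` counts the darts of a cell in a list. It is the exact order of the turn: the darts
    -- of one minimal period inject into the list, and the entries of the list inject into the
    -- residues modulo that period.
    turn-degree : fold d (turn i) (degree i (cell i d)) ≡ d
    turn-degree = trans (cong orbit (sym period≡deg)) periodic

    turn-free : ∀ k → 0 < k → k < degree i (cell i d) → fold d (turn i) k ≢ d
    turn-free k 0<k k<deg = below-period k 0<k (ℕ.<-≤-trans k<deg deg≤period)

module Orbits (M : Map) where
  open Cells (Map.embedding M) public

  SameOrbit-sym : ∀ {e e′} → SameOrbit M e e′ → SameOrbit M e′ e
  SameOrbit-sym {e} {e′} (π , (forth , back) , carries) = flip π , (back , forth) , λ v →
    subst (λ w → Incident w e′ ⇔ Incident (π ⟨$⟩ˡ v) e) (inverseʳ π)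
      (mk⇔ (from (carries (π ⟨$⟩ˡ v))) (to (carries (π ⟨$⟩ˡ v))))

  private
    Carries-trans : ∀ (π ρ : VertexPerm M) {i} {x y z : Cell i} →
                    Carries M π x y → Carries M ρ y z → Carries M (π ∘ₚ ρ) x z
    Carries-trans π ρ f g v = mk⇔ (to (g _) ∘ to (f v)) (from (f v) ∘ from (g _))

  SameOrbit-trans : ∀ {e e′ e″} → SameOrbit M e e′ → SameOrbit M e′ e″ → SameOrbit M e e″
  SameOrbit-trans (π , (π⁺ , π⁻) , f) (ρ , (ρ⁺ , ρ⁻) , g) =
    π ∘ₚ ρ ,
    ((λ i x → let y , p = π⁺ i x ; z , q = ρ⁺ i y in z , Carries-trans π ρ p q) ,
     (λ i x → let y , p = ρ⁻ i x ; z , q = π⁻ i y in z , Carries-trans (flip ρ) (flip π) p q)) ,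
    Carries-trans π ρ f g

  -- An automorphism is a permutation of vertices alone; the edge and face components of `F` and `G`
  -- name the cells onto which the vertex sets are carried.
  module CellMaps (F G : ∀ i → Cell i → Cell i)
    (GF : ∀ i x → G i (F i x) ≡ x) (FG : ∀ i x → F i (G i x) ≡ x)
    (F-incident : ∀ {i} {v : Cell vertex} {x : Cell i} → Incident v x → Incident (F vertex v) (F i x))
    (G-incident : ∀ {i} {v : Cell vertex} {x : Cell i} → Incident v x → Incident (G vertex v) (G i x))
    where

    private
      π : VertexPerm M
      π = permutation (F vertex) (G vertex) (FG vertex) (GF vertex)

      move-incident : ∀ {i} {v w} {x y : Cell i} → v ≡ w → x ≡ y → Incident {vertex} v x → Incident w y
      move-incident refl refl inc = inc

      carries : ∀ {i} (x : Cell i) → Carries M π x (F i x)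
      carries {i} x v = mk⇔ F-incident λ inc → move-incident (GF vertex v) (GF i x) (G-incident inc)

      carries⁻ : ∀ {i} (x : Cell i) → Carries M (flip π) x (G i x)
      carries⁻ {i} x v = mk⇔ G-incident λ inc → move-incident (FG vertex v) (FG i x) (F-incident inc)

    edge-image : ∀ e → SameOrbit M e (F edge e)
    edge-image e = π , ((λ i x → F i x , carries x) , (λ i x → G i x , carries⁻ x)) , carries e

-- Doubly periodic tilings

ℤ² : Set
ℤ² = ℤ × ℤ

0̂ : ℤ²
0̂ = 0ℤ , 0ℤ

infixl 6 _⊕_
infix  8 ⊖_

_⊕_ : ℤ² → ℤ² → ℤ²
u ⊕ v = proj₁ u ℤ.+ proj₁ v , proj₂ u ℤ.+ proj₂ v

⊖_ : ℤ² → ℤ²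
⊖ u = ℤ.- proj₁ u , ℤ.- proj₂ u

infixr 7 _·_

_·_ : ℤ → ℤ² → ℤ²
k · u = k ℤ.* proj₁ u , k ℤ.* proj₂ u

⊕-assoc : ∀ u v w → (u ⊕ v) ⊕ w ≡ u ⊕ (v ⊕ w)
⊕-assoc (a , b) (c , d) (e , f) = cong₂ _,_ (ℤ.+-assoc a c e) (ℤ.+-assoc b d f)

⊕-comm : ∀ u v → u ⊕ v ≡ v ⊕ u
⊕-comm (a , b) (c , d) = cong₂ _,_ (ℤ.+-comm a c) (ℤ.+-comm b d)

⊕-identityʳ : ∀ u → u ⊕ 0̂ ≡ u
⊕-identityʳ (a , b) = cong₂ _,_ (ℤ.+-identityʳ a) (ℤ.+-identityʳ b)

⊕-identityˡ : ∀ u → 0̂ ⊕ u ≡ u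
⊕-identityˡ (a , b) = cong₂ _,_ (ℤ.+-identityˡ a) (ℤ.+-identityˡ b)

⊕-inverseʳ : ∀ u → u ⊕ ⊖ u ≡ 0̂
⊕-inverseʳ (a , b) = cong₂ _,_ (ℤ.+-inverseʳ a) (ℤ.+-inverseʳ b)

⊕-cancel : ∀ u v → u ⊕ (v ⊕ ⊖ u) ≡ v
⊕-cancel u v = trans (cong (u ⊕_) (⊕-comm v (⊖ u)))
  (trans (sym (⊕-assoc u (⊖ u) v)) (trans (cong (_⊕ v) (⊕-inverseʳ u)) (⊕-identityˡ v)))

ℤ-induction : (P : ℤ → Set) → P 0ℤ → (∀ z → P z → P (1ℤ ℤ.+ z)) → (∀ z → P (1ℤ ℤ.+ z) → P z) → ∀ z → P z
ℤ-induction P base up down (+ zero)      = base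
ℤ-induction P base up down (+ suc n)     = up (+ n) (ℤ-induction P base up down (+ n))
ℤ-induction P base up down -[1+ zero ]   = down -[1+ 0 ] base
ℤ-induction P base up down -[1+ suc n ]  = down -[1+ suc n ] (ℤ-induction P base up down -[1+ n ])

-- ℤ² × Fin q is the set of the elements of q kinds of a doubly periodic
-- structure, and a Step is a map of such sets that commutes with translations.
Step : ℕ → ℕ → Set
Step q r = Fin q → ℤ² × Fin r

move : ∀ {q r} → Step q r → ℤ² × Fin q → ℤ² × Fin r
move f (t , j) = t ⊕ proj₁ (f j) , proj₂ (f j)

shift : ∀ {q} → ℤ² → ℤ² × Fin q → ℤ² × Fin q
shift u (t , j) = u ⊕ t , j

-- `L` is the linear part: the identity for the maps inside a tiling, a matrix for its symmetries.
record Equivariant {q r} (L : ℤ² → ℤ²) (f : ℤ² × Fin q → ℤ² × Fin r) : Set where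
  constructor equivariant
  field commute : ∀ u x → f (shift u x) ≡ shift (L u) (f x)

open Equivariant

Natural : ∀ {q r} → (ℤ² × Fin q → ℤ² × Fin r) → Set
Natural = Equivariant id

id-natural : ∀ {q} → Natural {q} id
id-natural = equivariant λ _ _ → refl

move-natural : ∀ {q r} (f : Step q r) → Natural (move f)
move-natural f = equivariant λ { u (t , j) → cong (_, proj₂ (f j)) (⊕-assoc u t (proj₁ (f j))) }

infixr 9 _∘ᵉ_

_∘ᵉ_ : ∀ {q r s L N} {f : ℤ² × Fin r → ℤ² × Fin s} {g : ℤ² × Fin q → ℤ² × Fin r} →
       Equivariant L f → Equivariant N g → Equivariant (L ∘ N) (f ∘ g)
_∘ᵉ_ {f = f} ef eg = equivariant λ u x → trans (cong f (commute eg u x)) (commute ef _ _)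

fold-natural : ∀ {q} {f : ℤ² × Fin q → ℤ² × Fin q} → Natural f → ∀ k → Natural (λ x → fold x f k)
fold-natural {f = f} nf = λ k → equivariant (go k)
  where
  go : ∀ k u x → fold (shift u x) f k ≡ shift u (fold x f k)
  go zero    u x = refl
  go (suc k) u x = trans (cong f (go k u x)) (commute nf u _)

equivariant-at : ∀ {q r L} {f : ℤ² × Fin q → ℤ² × Fin r} → Equivariant L f →
                 ∀ t j → f (t , j) ≡ shift (L t) (f (0̂ , j))
equivariant-at {f = f} ef t j = trans (cong (λ u → f (u , j)) (sym (⊕-identityʳ t))) (commute ef t (0̂ , j))

-- The reduction behind all finite checks: translations spread an identity from the finitely many
-- elements over the origin to the whole plane.
equivariant-≗ : ∀ {q r L} {f g : ℤ² × Fin q → ℤ² × Fin r} → Equivariant L f → Equivariant L g →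
                (∀ j → f (0̂ , j) ≡ g (0̂ , j)) → ∀ x → f x ≡ g x
equivariant-≗ {L = L} ef eg eq (t , j) =
  trans (equivariant-at ef t j) (trans (cong (shift (L t)) (eq j)) (sym (equivariant-at eg t j)))

turnBy : ∀ {q} → Step q q → Step q q → Dim → ℤ² × Fin q → ℤ² × Fin q
turnBy rotate reverse vertex x = move rotate x
turnBy rotate reverse edge   x = move reverse x
turnBy rotate reverse face   x = move rotate (move reverse x)

along : {L A : Set} → (L → A → A) → List L → A → A
along f []      x = x
along f (i ∷ w) x = along f w (f i x)

record Tiling : Set where
  field
    q              : ℕ
    base           : Fin q
    rotate reverse : Step q q

  Plane : Set
  Plane = ℤ² × Fin q

  turn : Dim → Plane → Plane
  turn = turnBy rotate reverse

  follow : List Dim → Plane → Plane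
  follow = along turn

  field
    #types : Dim → ℕ
    type   : ∀ i → Fin q → Fin (#types i)
    rep    : ∀ i → Fin (#types i) → Fin q
    dist   : Dim → Fin q → ℕ
    -- `suc period` is a common multiple of 2, the valences and the face sizes, so that `period`
    -- turns undo one turn about a cell of any dimension.
    period : ℕ

  -- Walking dist i j steps around the i-cell of a dart of kind j leads to
  -- the representative dart of that cell.
  locate : ∀ i → Plane → ℤ² × Fin (#types i)
  locate i (t , j) = proj₁ (fold (t , j) (turn i) (dist i j)) , type i j

  field
    turn-order     : ∀ i j → fold (0̂ , j) (turn i) (suc period) ≡ (0̂ , j)
    reverse-twice  : ∀ j → turn edge (turn edge (0̂ , j)) ≡ (0̂ , j)
    -- These three laws compare kinds and not positions, so the darts in question stay distinct in
    -- every quotient that respects kinds.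
    reverse-moves  : ∀ j → proj₂ (reverse j) ≢ j
    face-moves     : ∀ j → proj₂ (turn face (0̂ , j)) ≢ j
    face-moves²    : ∀ j → proj₂ (turn face (turn face (0̂ , j))) ≢ j
    dist-≤         : ∀ i j → dist i j ≤ suc period
    dist-rep       : ∀ i j → proj₂ (fold (0̂ , j) (turn i) (dist i j)) ≡ rep i (type i j)
    locate-turn₀   : ∀ i j → locate i (turn i (0̂ , j)) ≡ locate i (0̂ , j)
    locate-rep₀    : ∀ i c → locate i (0̂ , rep i c) ≡ (0̂ , c)
    euler          : #types vertex + #types face ≡ #types edge
    -- Words that certify connectedness: every kind reaches `base`, and `base` reaches its copies
    -- one unit east and one unit north.
    toBase         : Fin q → List Dim
    toBase-base    : ∀ j → proj₂ (follow (toBase j) (0̂ , j)) ≡ base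
    east north     : List Dim
    east-step      : follow east  (0̂ , base) ≡ ((1ℤ , 0ℤ) , base)
    north-step     : follow north (0̂ , base) ≡ ((0ℤ , 1ℤ) , base)

module TilingProperties (𝒯 : Tiling) where
  open Tiling 𝒯 public

  turn-natural : ∀ i → Natural (turn i)
  turn-natural vertex = move-natural rotate
  turn-natural edge   = move-natural reverse
  turn-natural face   = move-natural rotate ∘ᵉ move-natural reverse

  turn^-natural : ∀ i k → Natural (λ x → fold x (turn i) k)
  turn^-natural i = fold-natural (turn-natural i)

  follow-natural : ∀ w → Natural (follow w)
  follow-natural []      = id-natural
  follow-natural (i ∷ w) = follow-natural w ∘ᵉ turn-natural i

  turn-period : ∀ i x → fold x (turn i) (suc period) ≡ x
  turn-period i = equivariant-≗ (turn^-natural i (suc period)) id-natural (turn-order i)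

  turn^-injective : ∀ i k x y → fold x (turn i) k ≡ fold y (turn i) k → x ≡ y
  turn^-injective i zero    x y eq = eq
  turn^-injective i (suc k) x y eq = turn^-injective i k x y (trans (sym (back (fold x (turn i) k)))
    (trans (cong (λ z → fold z (turn i) period) eq) (back (fold y (turn i) k))))
    where
    back : ∀ z → fold (turn i z) (turn i) period ≡ z
    back z = trans (fold-suc (turn i) z period) (turn-period i z)

  turn-edge² : ∀ x → turn edge (turn edge x) ≡ x
  turn-edge² = equivariant-≗ (turn-natural edge ∘ᵉ turn-natural edge) id-natural reverse-twice

  locate-natural : ∀ i → Natural (locate i)
  locate-natural i = equivariant λ { u (t , j) →
    cong (λ y → proj₁ y , type i j) (commute (turn^-natural i (dist i j)) u (t , j)) }

  locate-turn : ∀ i x → locate i (turn i x) ≡ locate i x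
  locate-turn i = equivariant-≗ (locate-natural i ∘ᵉ turn-natural i) (locate-natural i) (locate-turn₀ i)

  locate-rep : ∀ i t c → locate i (t , rep i c) ≡ (t , c)
  locate-rep i t c = trans (equivariant-at (locate-natural i) t (rep i c))
    (trans (cong (shift t) (locate-rep₀ i c)) (cong (_, c) (⊕-identityʳ t)))

  walk-rep : ∀ i t j → fold (t , j) (turn i) (dist i j) ≡
             (proj₁ (locate i (t , j)) , rep i (proj₂ (locate i (t , j))))
  walk-rep i t j = cong (proj₁ (fold (t , j) (turn i) (dist i j)) ,_)
    (trans (cong proj₂ (equivariant-at (turn^-natural i (dist i j)) t j)) (dist-rep i j))

  -- Both darts walk to the same representative of their cell. From there the turns that `y` still
  -- lacks for a full `suc period` lead on to `y`.
  locate-same : ∀ i x y → locate i x ≡ locate i y → ∃ λ k → fold x (turn i) k ≡ y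
  locate-same i x@(t , j) y@(t′ , j′) eq = (suc period ∸ dist i j′) + dist i j , (begin
    fold x (turn i) ((suc period ∸ dist i j′) + dist i j)
      ≡⟨ fold-+ x (turn i) (suc period ∸ dist i j′) ⟩
    fold (fold x (turn i) (dist i j)) (turn i) (suc period ∸ dist i j′)
      ≡⟨ cong (λ z → fold z (turn i) (suc period ∸ dist i j′)) meet ⟩
    fold (fold y (turn i) (dist i j′)) (turn i) (suc period ∸ dist i j′)
      ≡⟨ fold-+ y (turn i) (suc period ∸ dist i j′) ⟨
    fold y (turn i) ((suc period ∸ dist i j′) + dist i j′)
      ≡⟨ cong (fold y (turn i)) (ℕ.m∸n+n≡m (dist-≤ i j′)) ⟩
    fold y (turn i) (suc period)
      ≡⟨ turn-period i y ⟩
    y ∎)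
    where
    open ≡-Reasoning
    meet : fold x (turn i) (dist i j) ≡ fold y (turn i) (dist i j′)
    meet = trans (walk-rep i t j)
      (trans (cong (λ z → proj₁ z , rep i (proj₂ z)) eq) (sym (walk-rep i t′ j′)))

  infix 4 _⇝_
  _⇝_ : Plane → Plane → Set
  _⇝_ = Star (λ x y → ∃ λ i → turn i x ≡ y)

  ⇝-fold : ∀ i x k → x ⇝ fold x (turn i) k
  ⇝-fold i x zero    = ε
  ⇝-fold i x (suc k) = ⇝-fold i x k ◅◅ (i , refl) ◅ ε

  ⇝-sym : ∀ {x y} → x ⇝ y → y ⇝ x
  ⇝-sym ε = ε
  ⇝-sym {x} ((i , refl) ◅ p) = ⇝-sym p ◅◅ subst (turn i x ⇝_)
    (trans (fold-suc (turn i) x period) (turn-period i x)) (⇝-fold i (turn i x) period)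

  ⇝-follow : ∀ w x → x ⇝ follow w x
  ⇝-follow []      x = ε
  ⇝-follow (i ∷ w) x = (i , refl) ◅ ⇝-follow w (turn i x)

  private
    follow-at : ∀ w {j u j′} → follow w (0̂ , j) ≡ (u , j′) → ∀ t → (t , j) ⇝ (t ⊕ u , j′)
    follow-at w {j} eq t = subst ((t , j) ⇝_)
      (trans (equivariant-at (follow-natural w) t j) (cong (shift t) eq)) (⇝-follow w (t , j))

    east-at : ∀ x y → ((x , y) , base) ⇝ ((1ℤ ℤ.+ x , y) , base)
    east-at x y = subst (λ u → ((x , y) , base) ⇝ (u , base))
      (cong₂ _,_ (ℤ.+-comm x 1ℤ) (ℤ.+-identityʳ y)) (follow-at east east-step (x , y))

    north-at : ∀ x y → ((x , y) , base) ⇝ ((x , 1ℤ ℤ.+ y) , base)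
    north-at x y = subst (λ u → ((x , y) , base) ⇝ (u , base))
      (cong₂ _,_ (ℤ.+-identityʳ x) (ℤ.+-comm y 1ℤ)) (follow-at north north-step (x , y))

    west* : ∀ x y → ((x , y) , base) ⇝ ((0ℤ , y) , base)
    west* (+ zero)     y = ε
    west* (+ suc n)    y = ⇝-sym (east-at (+ n) y) ◅◅ west* (+ n) y
    west* -[1+ zero ]  y = east-at -[1+ 0 ] y
    west* -[1+ suc n ] y = east-at -[1+ suc n ] y ◅◅ west* -[1+ n ] y

    south* : ∀ x y → ((x , y) , base) ⇝ ((x , 0ℤ) , base)
    south* x (+ zero)     = ε
    south* x (+ suc n)    = ⇝-sym (north-at x (+ n)) ◅◅ south* x (+ n)
    south* x -[1+ zero ]  = north-at x -[1+ 0 ]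
    south* x -[1+ suc n ] = north-at x -[1+ suc n ] ◅◅ south* x -[1+ n ]

    to-origin : ∀ x → x ⇝ (0̂ , base)
    to-origin (t , j) =
      follow-at (toBase j) (cong (proj₁ (follow (toBase j) (0̂ , j)) ,_) (toBase-base j)) t
        ◅◅ west* _ _ ◅◅ south* 0ℤ _

  connected : ∀ x y → x ⇝ y
  connected x y = to-origin x ◅◅ ⇝-sym (to-origin y)

  ⇝-induction : (P : Plane → Set) → (∀ i x → P x → P (turn i x)) → ∀ {x y} → x ⇝ y → P x → P y
  ⇝-induction P closed ε                Px = Px
  ⇝-induction P closed ((i , refl) ◅ p) Px = ⇝-induction P closed p (closed i _ Px)

-- Developments of a map in the plane

-- p unrolls the torus: it is the covering of the darts of X by those of the
-- plane, and its kernel consists of translations.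
record Development (𝒯 : Tiling) (X : CellularEmbedding) : Set where
  private
    module T = Tiling 𝒯
    module X = CellularEmbedding X
  field
    p      : T.Plane → X.Dart
    p-σ    : ∀ x → p (T.turn vertex x) ≡ X.turn vertex (p x)
    p-α    : ∀ x → p (T.turn edge x) ≡ X.turn edge (p x)
    p-kind : ∀ x y → p x ≡ p y → proj₂ x ≡ proj₂ y

module DevelopmentProperties {𝒯 : Tiling} {X : CellularEmbedding} (𝒟 : Development 𝒯 X) where
  open Development 𝒟 public
  private
    module T = TilingProperties 𝒯
    module X = Cells X
  open T using (Plane)

  p-turn : ∀ i x → p (T.turn i x) ≡ X.turn i (p x)
  p-turn vertex x = p-σ x
  p-turn edge   x = p-α x
  p-turn face   x = trans (p-σ _) (cong (X.σ ⟨$⟩ʳ_) (p-α x))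

  p-fold : ∀ i x k → p (fold x (T.turn i) k) ≡ fold (p x) (X.turn i) k
  p-fold i = fold-hom p (p-turn i)

  -- The vertices all of whose darts are images include that of the origin and are closed under
  -- adjacency, so they exhaust the connected `X`.
  onto : ∀ d → ∃ λ x → p x ≡ d
  onto d = reached (X.connected (X.cell vertex (p origin)) (X.cell vertex d)) base-reached d refl
    where
    origin : Plane
    origin = 0̂ , T.base

    Reached : X.Cell vertex → Set
    Reached v = ∀ d → X.cell vertex d ≡ v → ∃ λ x → p x ≡ d

    around : ∀ x → Reached (X.cell vertex (p x))
    around x d eq = let k , turned = to (X.cell-orbit vertex (p x) d) (sym eq)
                    in fold x (T.turn vertex) k , trans (p-fold vertex x k) turned

    base-reached : Reached (X.cell vertex (p origin))
    base-reached = around origin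

    reached : ∀ {u v} → Star X.Adjacent u v → Reached u → Reached v
    reached ε                      r = r
    reached ((d , refl , refl) ◅ s) r with r d refl
    ... | x , refl = reached s (subst (λ d′ → Reached (X.cell vertex d′)) (p-α x) (around (T.turn edge x)))

  Period : ℤ² → Set
  Period u = ∀ x → p (shift u x) ≡ p x

  -- If a translation does not change the image of one dart, it changes none: `p` commutes with the
  -- turns, and the turns connect the plane.
  kernel : ∀ t t′ j → p (t , j) ≡ p (t′ , j) → Period (t ⊕ ⊖ t′)
  kernel t t′ j eq x = T.⇝-induction (λ x → p (shift δ x) ≡ p x) closed (T.connected (t′ , j) x)
    (trans (cong (λ u → p (u , j)) (trans (⊕-comm δ t′) (⊕-cancel t′ t))) eq)
    where
    δ : ℤ²
    δ = t ⊕ ⊖ t′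
    closed : ∀ i x → p (shift δ x) ≡ p x → p (shift δ (T.turn i x)) ≡ p (T.turn i x)
    closed i x eq = trans (cong p (sym (commute (T.turn-natural i) δ x)))
      (trans (p-turn i (shift δ x)) (trans (cong (X.turn i) eq) (sym (p-turn i x))))

  kernel⁻ : ∀ t t′ j → Period (t ⊕ ⊖ t′) → p (t , j) ≡ p (t′ , j)
  kernel⁻ t t′ j per = trans (cong (λ u → p (u , j)) (sym (trans (⊕-comm _ t′) (⊕-cancel t′ t)))) (per (t′ , j))

  cell-same : ∀ i x y → X.cell i (p x) ≡ X.cell i (p y) → ∃ λ k → p (fold x (T.turn i) k) ≡ p y
  cell-same i x y eq = let k , turned = to (X.cell-orbit i (p x) (p y)) eq in k , trans (p-fold i x k) turned

  cell-walk : ∀ i x k → X.cell i (p (fold x (T.turn i) k)) ≡ X.cell i (p x)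
  cell-walk i x k = trans (cong (X.cell i) (p-fold i x k)) (X.cell-fold i (p x) k)

-- A symmetry of the tiling, up to translations.  A reflection turns the face
-- on the left of a dart into the face on the right of the image of the dart,
-- so the dart that image gives as the image of a dart depends on the dimension
-- of the cell of interest; turning around a cell becomes turning back.
record Symmetry (𝒯 : Tiling) : Set where
  open Tiling 𝒯
  field
    a b c d : ℤ
    image   : Dim → Step q q

  linear : ℤ² → ℤ²
  linear (x , y) = a ℤ.* x ℤ.+ b ℤ.* y , c ℤ.* x ℤ.+ d ℤ.* y

  act : Dim → Plane → Plane
  act i (t , j) = linear t ⊕ proj₁ (image i j) , proj₂ (image i j)

  field
    -- 1 if orientation is preserved. For a reflection it is `period`, which amounts to one turn
    -- back.
    speed      : ℕ
    act-turn₀  : ∀ i j → act i (turn i (0̂ , j)) ≡ fold (act i (0̂ , j)) (turn i) speed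
    -- The darts that stand for the image in dimension `i` and at the vertex may differ, but they
    -- meet after `delay i` turns about the respective cells. The common dart witnesses that
    -- incidence is preserved.
    delay      : Dim → ℕ
    act-meet₀  : ∀ i j → fold (act i (0̂ , j)) (turn i) (delay i) ≡
                         fold (act vertex (0̂ , j)) (turn vertex) (delay i)

module SymmetryProperties {𝒯 : Tiling} (S : Symmetry 𝒯) where
  open Symmetry S public
  open TilingProperties 𝒯

  linear-⊕ : ∀ u v → linear (u ⊕ v) ≡ linear u ⊕ linear v
  linear-⊕ (x , y) (x′ , y′) = cong₂ _,_ (distribute a b x y x′ y′) (distribute c d x y x′ y′)
    where
    distribute : ∀ a b x y x′ y′ → a ℤ.* (x ℤ.+ x′) ℤ.+ b ℤ.* (y ℤ.+ y′) ≡
                 (a ℤ.* x ℤ.+ b ℤ.* y) ℤ.+ (a ℤ.* x′ ℤ.+ b ℤ.* y′)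
    distribute = solve-∀

  linear-⊖ : ∀ u → linear (⊖ u) ≡ ⊖ linear u
  linear-⊖ (x , y) = cong₂ _,_ (negate a b x y) (negate c d x y)
    where
    negate : ∀ a b x y → a ℤ.* (ℤ.- x) ℤ.+ b ℤ.* (ℤ.- y) ≡ ℤ.- (a ℤ.* x ℤ.+ b ℤ.* y)
    negate = solve-∀

  act-equivariant : ∀ i → Equivariant linear (act i)
  act-equivariant i = equivariant λ { u (t , j) → cong (_, proj₂ (image i j))
    (trans (cong (_⊕ proj₁ (image i j)) (linear-⊕ u t)) (⊕-assoc (linear u) (linear t) _)) }

  act-turn : ∀ i x → act i (turn i x) ≡ fold (act i x) (turn i) speed
  act-turn i = equivariant-≗ (act-equivariant i ∘ᵉ turn-natural i)
    (turn^-natural i speed ∘ᵉ act-equivariant i) (act-turn₀ i)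

  act-meet : ∀ i x → fold (act i x) (turn i) (delay i) ≡ fold (act vertex x) (turn vertex) (delay i)
  act-meet i = equivariant-≗ (turn^-natural i (delay i) ∘ᵉ act-equivariant i)
    (turn^-natural vertex (delay i) ∘ᵉ act-equivariant vertex) (act-meet₀ i)

record Inverse {𝒯 : Tiling} (S S′ : Symmetry 𝒯) : Set where
  private
    module S  = Symmetry S
    module S′ = Symmetry S′
  field
    linear-inverse : ∀ u → S′.linear (S.linear u) ≡ u
    act-inverse    : ∀ i j → S′.act i (S.act i (0̂ , j)) ≡ (0̂ , j)

module Descent {𝒯 : Tiling} {M : Map} (𝒟 : Development 𝒯 (Map.embedding M)) where
  open DevelopmentProperties 𝒟
  open TilingProperties 𝒯 using (Plane; q)
  private
    module T = TilingProperties 𝒯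
    module O = Orbits M
  open O using (Cell; cell; cell-onto; Incident)

  Descends : Symmetry 𝒯 → Set
  Descends S = ∀ u → Period u → Period (Symmetry.linear S u)

  private module Induced (S : Symmetry 𝒯) (descends : Descends S) (u : ℤ²) where
    open SymmetryProperties S

    g : Dim → Plane → Plane
    g i x = shift u (act i x)

    g-fold : ∀ i x → g i (T.turn i x) ≡ fold (g i x) (T.turn i) speed
    g-fold i x = trans (cong (shift u) (act-turn i x))
      (sym (commute (T.turn^-natural i speed) u (act i x)))

    g-meet : ∀ i x → fold (g i x) (T.turn i) (delay i) ≡ fold (g vertex x) (T.turn vertex) (delay i)
    g-meet i x = trans (commute (T.turn^-natural i (delay i)) u (act i x))
      (trans (cong (shift u) (act-meet i x))
        (sym (commute (T.turn^-natural vertex (delay i)) u (act vertex x))))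

    p-g : ∀ i x y → p x ≡ p y → p (g i x) ≡ p (g i y)
    p-g i (t , j) (t′ , j′) eq with p-kind _ _ eq
    ... | refl = kernel⁻ _ _ _ (subst Period eqn (descends _ (kernel t t′ j eq)))
      where
      cancel : ∀ u l l′ h → l ℤ.- l′ ≡ (u ℤ.+ (l ℤ.+ h)) ℤ.- (u ℤ.+ (l′ ℤ.+ h))
      cancel = solve-∀
      eqn : linear (t ⊕ ⊖ t′) ≡ (u ⊕ (linear t ⊕ proj₁ (image i j))) ⊕ ⊖ (u ⊕ (linear t′ ⊕ proj₁ (image i j)))
      eqn = trans (linear-⊕ t (⊖ t′)) (trans (cong (linear t ⊕_) (linear-⊖ t′))
        (cong₂ _,_ (cancel (proj₁ u) (proj₁ (linear t)) _ (proj₁ (proj₁ (image i j))))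
                   (cancel (proj₂ u) (proj₂ (linear t)) _ (proj₂ (proj₁ (image i j))))))

    -- One turn before `g` is `speed` turns after it, so the cell of the image does not depend on
    -- the dart chosen in the cell.
    cell-g : ∀ i x y → cell i (p x) ≡ cell i (p y) → cell i (p (g i x)) ≡ cell i (p (g i y))
    cell-g i x y eq with cell-same i x y eq
    ... | k , eq′ = trans (sym (fold-invariant (λ z → cell i (p (g i z))) step x k)) (cong (cell i) (p-g i _ _ eq′))
      where
      step : ∀ z → cell i (p (g i (T.turn i z))) ≡ cell i (p (g i z))
      step z = trans (cong (cell i ∘ p) (g-fold i z)) (cell-walk i (g i z) speed)

    pre : ∀ i → Cell i → Plane
    pre i c = proj₁ (onto (proj₁ (cell-onto i c)))

    cell-pre : ∀ i c → cell i (p (pre i c)) ≡ c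
    cell-pre i c = trans (cong (cell i) (proj₂ (onto _))) (proj₂ (cell-onto i c))

    F : ∀ i → Cell i → Cell i
    F i c = cell i (p (g i (pre i c)))

    F-cell : ∀ i x → F i (cell i (p x)) ≡ cell i (p (g i x))
    F-cell i x = cell-g i _ _ (cell-pre i (cell i (p x)))

    F-incident : ∀ {i} {v : Cell vertex} {c : Cell i} → Incident v c → Incident (F vertex v) (F i c)
    F-incident {i} (d , refl , refl) with onto d
    -- The dart where the two images meet lies in both image cells.
    ... | x , refl = p (fold (g i x) (T.turn i) (delay i)) ,
      trans (cong (cell vertex ∘ p) (g-meet i x)) (trans (cell-walk vertex _ (delay i)) (sym (F-cell vertex x))) ,
      trans (cell-walk i _ (delay i)) (sym (F-cell i x))

  module _ {S S′ : Symmetry 𝒯} (inv : Inverse S S′) (inv′ : Inverse S′ S)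
           (desc : Descends S) (desc′ : Descends S′) where
    private
      module S  = SymmetryProperties S
      module S′ = SymmetryProperties S′

    private module _ (u : ℤ²) where
      module F = Induced S desc u
      -- The inverse of `S` followed by the translation by `u` is `S′` followed by the translation
      -- by minus `S′.linear u`.
      module G = Induced S′ desc′ (⊖ S′.linear u)

      act-inverse : ∀ {A B : Symmetry 𝒯} → Inverse A B → ∀ i x → Symmetry.act B i (Symmetry.act A i x) ≡ x
      act-inverse {A} {B} AB i = equivariant-≗
        (SymmetryProperties.act-equivariant B i ∘ᵉ SymmetryProperties.act-equivariant A i)
        (equivariant λ v x → cong (λ w → shift w x) (sym (Inverse.linear-inverse AB v)))
        (Inverse.act-inverse AB i)

      shift-cancel : ∀ v w (x : Plane) → v ⊕ w ≡ 0̂ → shift v (shift w x) ≡ x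
      shift-cancel v w (t , j) eq = cong (_, j)
        (trans (sym (⊕-assoc v w t)) (trans (cong (_⊕ t) eq) (⊕-identityˡ t)))

      GF-plane : ∀ i x → G.g i (F.g i x) ≡ x
      GF-plane i x = trans (cong (shift (⊖ S′.linear u)) (commute (S′.act-equivariant i) u (S.act i x)))
        (trans (shift-cancel (⊖ S′.linear u) (S′.linear u) (S′.act i (S.act i x))
          (trans (⊕-comm (⊖ S′.linear u) (S′.linear u)) (⊕-inverseʳ (S′.linear u)))) (act-inverse inv i x))

      FG-plane : ∀ i x → F.g i (G.g i x) ≡ x
      FG-plane i x = trans (cong (shift u) (commute (S.act-equivariant i) (⊖ S′.linear u) (S′.act i x)))
        (trans (shift-cancel u (S.linear (⊖ S′.linear u)) (S.act i (S′.act i x)) (trans (cong (u ⊕_)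
          (trans (S.linear-⊖ (S′.linear u)) (cong ⊖_ (Inverse.linear-inverse inv′ u)))) (⊕-inverseʳ u))) (act-inverse inv′ i x))

      GF : ∀ i c → G.F i (F.F i c) ≡ c
      GF i c = trans (G.F-cell i _) (trans (cong (cell i ∘ p) (GF-plane i _)) (F.cell-pre i c))

      FG : ∀ i c → F.F i (G.F i c) ≡ c
      FG i c = trans (F.F-cell i _) (trans (cong (cell i ∘ p) (FG-plane i _)) (G.cell-pre i c))

    -- The free choice of `u` brings in the translations: the image edge can be placed anywhere in
    -- the plane.
    symmetric : ∀ u x → SameOrbit M (cell edge (p x)) (cell edge (p (shift u (S.act edge x))))
    symmetric u x = subst (SameOrbit M _) (F.F-cell u edge x)
      (O.CellMaps.edge-image (F.F u) (G.F u) (GF u) (FG u) (F.F-incident u) (G.F-incident u) _)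

-- Tilings of a torus

residue : ∀ m .{{_ : NonZero m}} → ℤ → Fin m
residue m z = fromℕ< (ℤ.n%ℕd<d z m)

residue-toℕ : ∀ m .{{_ : NonZero m}} (i : Fin m) → residue m (+ toℕ i) ≡ i
residue-toℕ m i = toℕ-injective (trans (toℕ-fromℕ< _) (m<n⇒m%n≡m (toℕ<n i)))

small-multiple : ∀ m r r′ → r < m → r′ < m → + m ∣ℤ (+ r ℤ.- + r′) → r ≡ r′
small-multiple m r r′ r<m r′<m m∣ = ℤ.+-injective (ℤ.i-j≡0⇒i≡j (+ r) (+ r′) (ℤ.∣i∣≡0⇒i≡0
  (vanish (ℕ.≤-<-trans abs-≤ (ℕ.⊔-pres-<m r<m r′<m)) (∣⇒∣ᵤ m∣))))
  where
  abs-≤ : ℤ.∣ + r ℤ.- + r′ ∣ ≤ r ⊔ r′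
  abs-≤ = ℕ.≤-trans (ℕ.≤-reflexive (cong ℤ.∣_∣ (ℤ.m-n≡m⊖n r r′))) (ℤ.∣m⊝n∣≤m⊔n r r′)
  vanish : ∀ {n} → n < m → m ∣ n → n ≡ 0
  vanish {zero}  _   _   = refl
  vanish {suc n} n<m m∣n = contradiction m∣n (>⇒∤ n<m)

residue-difference : ∀ m .{{_ : NonZero m}} z w →
                     z ℤ.- w ≡ (+ (z ℤ.%ℕ m) ℤ.- + (w ℤ.%ℕ m)) ℤ.+ (z ℤ./ℕ m ℤ.- w ℤ./ℕ m) ℤ.* + m
residue-difference m z w = trans (cong₂ ℤ._-_ (ℤ.a≡a%ℕn+[a/ℕn]*n z m) (ℤ.a≡a%ℕn+[a/ℕn]*n w m))
  (regroup (+ (z ℤ.%ℕ m)) (+ (w ℤ.%ℕ m)) (z ℤ./ℕ m) (w ℤ./ℕ m) (+ m))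
  where
  regroup : ∀ r r′ k k′ m → (r ℤ.+ k ℤ.* m) ℤ.- (r′ ℤ.+ k′ ℤ.* m) ≡ (r ℤ.- r′) ℤ.+ (k ℤ.- k′) ℤ.* m
  regroup = solve-∀

residue-cong : ∀ m .{{_ : NonZero m}} z w → + m ∣ℤ (z ℤ.- w) → residue m z ≡ residue m w
residue-cong m z w m∣ = toℕ-injective (trans (toℕ-fromℕ< _) (trans
  (small-multiple m _ _ (ℤ.n%ℕd<d z m) (ℤ.n%ℕd<d w m)
    (∣m+n∣n⇒∣m (subst (+ m ∣ℤ_) (residue-difference m z w) m∣) (divides (z ℤ./ℕ m ℤ.- w ℤ./ℕ m) refl)))
  (sym (toℕ-fromℕ< _))))

residue-injective : ∀ m .{{_ : NonZero m}} z w → residue m z ≡ residue m w → + m ∣ℤ (z ℤ.- w)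
residue-injective m z w eq = divides (z ℤ./ℕ m ℤ.- w ℤ./ℕ m) (trans (residue-difference m z w)
  (trans (cong (λ r → (r ℤ.- + (w ℤ.%ℕ m)) ℤ.+ (z ℤ./ℕ m ℤ.- w ℤ./ℕ m) ℤ.* + m) same)
    (trans (cong (ℤ._+ (z ℤ./ℕ m ℤ.- w ℤ./ℕ m) ℤ.* + m) (ℤ.+-inverseʳ (+ (w ℤ.%ℕ m)))) (ℤ.+-identityˡ _))))
  where
  same : + (z ℤ.%ℕ m) ≡ + (w ℤ.%ℕ m)
  same = cong +_ (trans (sym (toℕ-fromℕ< _)) (trans (cong toℕ eq) (toℕ-fromℕ< _)))

module Torus (𝒯 : Tiling) (m₁ m₂ : ℕ) {{m₁≢0 : NonZero m₁}} {{m₂≢0 : NonZero m₂}} where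
  private module T = TilingProperties 𝒯
  open T using (Plane; q; #types; locate; rep)

  Lattice : ℤ² → Set
  Lattice u = + m₁ ∣ℤ proj₁ u × + m₂ ∣ℤ proj₂ u

  abstract
    encode : ∀ {c} → ℤ² × Fin c → Fin (m₁ * m₂ * c)
    encode ((x , y) , j) = combine (combine (residue m₁ x) (residue m₂ y)) j

    decode : ∀ {c} → Fin (m₁ * m₂ * c) → ℤ² × Fin c
    decode {c} i = let k , j = remQuot {m₁ * m₂} c i ; a , b = remQuot {m₁} m₂ k
                   in (+ toℕ a , + toℕ b) , j

    encode-decode : ∀ {c} (i : Fin (m₁ * m₂ * c)) → encode (decode i) ≡ i
    encode-decode {c} i = trans
      (cong (λ k → combine k (proj₂ (remQuot {m₁ * m₂} c i)))
        (trans (cong₂ combine (residue-toℕ m₁ _) (residue-toℕ m₂ _))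
               (Fin.combine-remQuot {m₁} m₂ (proj₁ (remQuot {m₁ * m₂} c i)))))
      (Fin.combine-remQuot {m₁ * m₂} c i)

    encode-shift : ∀ {c u} → Lattice u → (x : ℤ² × Fin c) → encode (shift u x) ≡ encode x
    encode-shift {u = u} (d₁ , d₂) ((x , y) , j) = cong (λ k → combine k j)
      (cong₂ combine (residue-cong m₁ (proj₁ u ℤ.+ x) x (subst (+ m₁ ∣ℤ_) (cancel (proj₁ u) x) d₁))
                     (residue-cong m₂ (proj₂ u ℤ.+ y) y (subst (+ m₂ ∣ℤ_) (cancel (proj₂ u) y) d₂)))
      where
      cancel : ∀ u x → u ≡ (u ℤ.+ x) ℤ.- x
      cancel = solve-∀

    encode-kind : ∀ {c} (x y : ℤ² × Fin c) → encode x ≡ encode y → proj₂ x ≡ proj₂ y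
    encode-kind ((x , y) , j) ((x′ , y′) , j′) eq = Fin.combine-injectiveʳ
      (combine (residue m₁ x) (residue m₂ y)) j (combine (residue m₁ x′) (residue m₂ y′)) j′ eq

    encode-lattice : ∀ {c} (x y : ℤ² × Fin c) → encode x ≡ encode y → Lattice (proj₁ x ⊕ ⊖ proj₁ y)
    encode-lattice ((x , y) , j) ((x′ , y′) , j′) eq =
      residue-injective m₁ x x′ (Fin.combine-injectiveˡ (residue m₁ x) (residue m₂ y) (residue m₁ x′) (residue m₂ y′) eq′) ,
      residue-injective m₂ y y′ (Fin.combine-injectiveʳ (residue m₁ x) (residue m₂ y) (residue m₁ x′) (residue m₂ y′) eq′)
      where
      eq′ : combine (residue m₁ x) (residue m₂ y) ≡ combine (residue m₁ x′) (residue m₂ y′)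
      eq′ = Fin.combine-injectiveˡ (combine (residue m₁ x) (residue m₂ y)) j (combine (residue m₁ x′) (residue m₂ y′)) j′ eq

  encode-same : ∀ {c} (x y : ℤ² × Fin c) → encode x ≡ encode y → ∃ λ u → Lattice u × x ≡ shift u y
  encode-same (t , j) (t′ , j′) eq = t ⊕ ⊖ t′ , encode-lattice (t , j) (t′ , j′) eq ,
    cong₂ _,_ (trans (sym (⊕-cancel t′ t)) (⊕-comm t′ _)) (encode-kind (t , j) (t′ , j′) eq)

  lift : ∀ {c d} → (ℤ² × Fin c → ℤ² × Fin d) → Fin (m₁ * m₂ * c) → Fin (m₁ * m₂ * d)
  lift f i = encode (f (decode i))

  natural-cong : ∀ {c d} {f : ℤ² × Fin c → ℤ² × Fin d} → Natural f →
                 ∀ x y → encode x ≡ encode y → encode (f x) ≡ encode (f y)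
  natural-cong {f = f} nf x y eq = let u , lu , x≡ = encode-same x y eq in
    trans (cong encode (trans (cong f x≡) (commute nf u y))) (encode-shift lu (f y))

  lift-encode : ∀ {c d} {f : ℤ² × Fin c → ℤ² × Fin d} → Natural f → ∀ x → lift f (encode x) ≡ encode (f x)
  lift-encode nf x = natural-cong nf _ x (encode-decode (encode x))

  lift-inverse : ∀ {c} {f : ℤ² × Fin c → ℤ² × Fin c} (g : ℤ² × Fin c → ℤ² × Fin c) → Natural f →
                 (∀ x → f (g x) ≡ x) → ∀ i → lift f (lift g i) ≡ i
  lift-inverse g nf fg i = trans (lift-encode nf (g (decode i))) (trans (cong encode (fg (decode i))) (encode-decode i))

  rotationSystem : RotationSystem
  rotationSystem = record
    { #darts        = m₁ * m₂ * q
    ; nonempty      = encode (0̂ , T.base)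
    ; σ             = permutation (lift (T.turn vertex)) (lift (λ x → fold x (T.turn vertex) T.period))
                        (lift-inverse (λ x → fold x (T.turn vertex) T.period) (T.turn-natural vertex) (T.turn-period vertex))
                        (lift-inverse (T.turn vertex) (T.turn^-natural vertex T.period)
                          (λ x → trans (fold-suc (T.turn vertex) x T.period) (T.turn-period vertex x)))
    ; α             = lift (T.turn edge)
    ; α-involutive  = lift-inverse (T.turn edge) (T.turn-natural edge) T.turn-edge²
    ; α-fixfree     = λ d eq → T.reverse-moves (proj₂ (decode {q} d))
                        (encode-kind (T.turn edge (decode d)) (decode d) (trans eq (sym (encode-decode d))))
    }

  open RotationSystem rotationSystem using (Dart; turn)

  encode-turn : ∀ i x → encode (T.turn i x) ≡ turn i (encode x)
  encode-turn vertex x = sym (lift-encode (T.turn-natural vertex) x)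
  encode-turn edge   x = sym (lift-encode (T.turn-natural edge) x)
  encode-turn face   x = trans (encode-turn vertex (T.turn edge x)) (cong (lift (T.turn vertex)) (encode-turn edge x))

  cell : ∀ i → Dart → Fin (m₁ * m₂ * #types i)
  cell i = lift (locate i)

  cell-encode : ∀ i x → cell i (encode x) ≡ encode (locate i x)
  cell-encode i = lift-encode (T.locate-natural i)

  cell-turn : ∀ i d → cell i (turn i d) ≡ cell i d
  cell-turn i d = subst (λ d → cell i (turn i d) ≡ cell i d) (encode-decode d)
    (trans (cong (cell i) (sym (encode-turn i (decode d))))
      (trans (cell-encode i _) (trans (cong encode (T.locate-turn i (decode d))) (sym (cell-encode i (decode d))))))

  cell-orbit : ∀ i d d′ → cell i d ≡ cell i d′ ⇔ ∃ λ k → fold d (turn i) k ≡ d′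
  cell-orbit i d d′ = mk⇔ walk λ { (k , refl) → sym (fold-invariant (cell i) (cell-turn i) d k) }
    where
    walk : cell i d ≡ cell i d′ → ∃ λ k → fold d (turn i) k ≡ d′
    -- Equal cells of the torus give cells of the plane that differ by a lattice vector `u`; the
    -- walk is found in the plane and ends at the `u`-translate of `decode d′`.
    walk eq with encode-same (locate i (decode d)) (locate i (decode d′)) eq
    ... | u , lu , loc with T.locate-same i (decode d) (shift u (decode d′))
                             (trans loc (sym (commute (T.locate-natural i) u (decode d′))))
    ... | k , reached = k , (begin
      fold d (turn i) k                            ≡⟨ cong (λ d → fold d (turn i) k) (encode-decode d) ⟨
      fold (encode (decode d)) (turn i) k          ≡⟨ fold-hom encode (encode-turn i) (decode d) k ⟨
      encode (fold (decode d) (T.turn i) k)        ≡⟨ cong encode reached ⟩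
      encode (shift u (decode d′))                 ≡⟨ encode-shift lu (decode d′) ⟩
      encode (decode d′)                           ≡⟨ encode-decode d′ ⟩
      d′                                           ∎)
      where open ≡-Reasoning

  cell-onto : ∀ i c → ∃ λ d → cell i d ≡ c
  cell-onto i c = let t , j = decode c in encode (t , rep i j) ,
    trans (cell-encode i (t , rep i j)) (trans (cong encode (T.locate-rep i t j)) (encode-decode c))

  embedding : CellularEmbedding
  embedding = record
    { rotationSystem = rotationSystem
    ; #cells         = λ i → m₁ * m₂ * #types i
    ; cell           = cell
    ; cell-onto      = cell-onto
    ; cell-orbit     = cell-orbit
    ; connected      = connected
    }
    where
    Adjacent : (u v : Fin (m₁ * m₂ * #types vertex)) → Set
    Adjacent u v = ∃ λ d → cell vertex d ≡ u × cell vertex (lift (T.turn edge) d) ≡ v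

    connected : ∀ u v → Star Adjacent u v
    connected u v with cell-onto vertex u | cell-onto vertex v
    ... | d , refl | d′ , refl = subst (Star Adjacent (cell vertex d)) (cong (cell vertex) (encode-decode d′))
      (T.⇝-induction (λ x → Star Adjacent (cell vertex d) (cell vertex (encode x))) closed
        (T.connected (decode d) (decode d′))
        (subst (Star Adjacent (cell vertex d)) (sym (cong (cell vertex) (encode-decode d))) ε))
      where
      around : ∀ x → cell vertex (encode (T.turn vertex x)) ≡ cell vertex (encode x)
      around x = trans (cong (cell vertex) (encode-turn vertex x)) (cell-turn vertex (encode x))
      closed : ∀ i x → Star Adjacent (cell vertex d) (cell vertex (encode x)) →
               Star Adjacent (cell vertex d) (cell vertex (encode (T.turn i x)))
      closed vertex x p = subst (Star Adjacent (cell vertex d)) (sym (around x)) p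
      closed edge   x p = p ◅◅ (encode x , refl , cong (cell vertex) (sym (encode-turn edge x))) ◅ ε
      closed face   x p = subst (Star Adjacent (cell vertex d)) (sym (around (T.turn edge x))) (closed edge x p)

  development : Development 𝒯 embedding
  development = record
    { p      = encode
    ; p-σ    = encode-turn vertex
    ; p-α    = encode-turn edge
    ; p-kind = encode-kind
    }

  open DevelopmentProperties development using (Period)

  period⇒lattice : ∀ u → Period u → Lattice u
  period⇒lattice u per = subst Lattice (cong₂ _,_ (cancel _) (cancel _))
    (encode-lattice (shift u (0̂ , T.base)) (0̂ , T.base) (per (0̂ , T.base)))
    where
    cancel : ∀ z → z ℤ.+ 0ℤ ℤ.- 0ℤ ≡ z
    cancel = solve-∀

  lattice⇒period : ∀ u → Lattice u → Period u
  lattice⇒period u lu = encode-shift lu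

  -- Darts of one kind are equally many turns away from the representative of their cell, so within
  -- a cell the kind determines the dart. This makes the covering by the torus locally injective.
  cell-kind-injective : ∀ i x y → cell i (encode x) ≡ cell i (encode y) → proj₂ x ≡ proj₂ y → encode x ≡ encode y
  cell-kind-injective i (t , j) (t′ , .j) eq refl with encode-same (locate i (t , j)) (locate i (t′ , j))
    (trans (sym (cell-encode i (t , j))) (trans eq (cell-encode i (t′ , j))))
  ... | u , lu , loc = trans (cong encode x≡) (encode-shift lu (t′ , j))
    where
    k : ℕ
    k = T.dist i j
    x≡ : (t , j) ≡ shift u (t′ , j)
    x≡ = T.turn^-injective i k _ _ (trans (T.walk-rep i t j) (trans (cong (λ z → proj₁ z , rep i (proj₂ z)) loc)
      (trans (cong (shift u) (sym (T.walk-rep i t′ j))) (sym (commute (T.turn^-natural i k) u (t′ , j))))))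

  toroidal : #types vertex + #types face ≡ #types edge →
             m₁ * m₂ * #types vertex + m₁ * m₂ * #types face ≡ m₁ * m₂ * #types edge
  toroidal euler = trans (sym (ℕ.*-distribˡ-+ (m₁ * m₂) _ _)) (cong (m₁ * m₂ *_) euler)

-- Coverings

module EdgeDarts (X : CellularEmbedding) where
  open Cells X

  edge-darts : ∀ d d′ → cell edge d ≡ cell edge d′ → d′ ≡ d ⊎ d′ ≡ α d
  edge-darts d d′ eq with to (cell-orbit edge d d′) eq
  ... | k , refl = powers k
    where
    powers : ∀ k → fold d α k ≡ d ⊎ fold d α k ≡ α d
    powers zero = inj₁ refl
    powers (suc k) with powers k
    ... | inj₁ eq = inj₂ (cong α eq)
    ... | inj₂ eq = inj₁ (trans (cong α eq) (α-involutive d))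

  vertex-next : ∀ d → cell vertex (turn face d) ≡ cell vertex (α d)
  vertex-next d = cell-turn vertex (α d)

  vertex-edge-face : ∀ {v e f} → Incident {vertex} {edge} v e → Incident {edge} {face} e f → Incident {vertex} {face} v f
  vertex-edge-face (a , refl , ae) (b , be , refl) with edge-darts b a (trans be (sym ae))
  ... | inj₁ refl = b , refl , refl
  ... | inj₂ refl = turn face b , vertex-next b , cell-turn face b

  incident? : ∀ {i j} (x : Cell i) (y : Cell j) → Dec (Incident x y)
  incident? x y = Fin.any? λ d → (cell _ d ≟ x) ×-dec (cell _ d ≟ y)

module Flags (K : Map) (moves : ∀ d → Map.turn K face d ≢ d) where
  open Map K using (boundary-vertices; boundary-edges) public
  open EdgeDarts (Map.embedding K) public
  open Cells (Map.embedding K) public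

  -- The ends of a loop coincide, so `d` and its successor on the face would leave the same vertex
  -- of that face, hence be equal.
  loopless : ∀ d → cell vertex d ≢ cell vertex (α d)
  loopless d eq = moves d (boundary-vertices _ _ (cell-turn face d) (trans (vertex-next d) (sym eq)))

  -- A dart is a flag of the oriented map. The disc conditions settle the pairs that contain the
  -- face, looplessness the pair of vertex and edge.
  flag-unique : ∀ {i j} → i ≢ j → ∀ d d′ → cell i d ≡ cell i d′ → cell j d ≡ cell j d′ → d ≡ d′
  flag-unique {vertex} {vertex} i≢j d d′ p q = contradiction refl i≢j
  flag-unique {edge}   {edge}   i≢j d d′ p q = contradiction refl i≢j
  flag-unique {face}   {face}   i≢j d d′ p q = contradiction refl i≢j
  flag-unique {vertex} {face}   i≢j d d′ p q = boundary-vertices d d′ q p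
  flag-unique {face}   {vertex} i≢j d d′ p q = boundary-vertices d d′ p q
  flag-unique {edge}   {face}   i≢j d d′ p q = boundary-edges d d′ q p
  flag-unique {face}   {edge}   i≢j d d′ p q = boundary-edges d d′ p q
  flag-unique {vertex} {edge}   i≢j d d′ p q with edge-darts d d′ q
  ... | inj₁ eq   = sym eq
  ... | inj₂ refl = contradiction p (loopless d)
  flag-unique {edge}   {vertex} i≢j d d′ p q = flag-unique {vertex} {edge} (λ ()) d d′ q p

_≟ᵈ_ : (i j : Dim) → Dec (i ≡ j)
vertex ≟ᵈ vertex = yes refl
vertex ≟ᵈ edge   = no λ ()
vertex ≟ᵈ face   = no λ ()
edge   ≟ᵈ vertex = no λ ()
edge   ≟ᵈ edge   = yes refl
edge   ≟ᵈ face   = no λ ()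
face   ≟ᵈ vertex = no λ ()
face   ≟ᵈ edge   = no λ ()
face   ≟ᵈ face   = yes refl

-- Since `q` is injective on the darts of each cell, the disc conditions and the intersection
-- pattern of faces are pulled back from `K`. No lower bound on the size of `X` enters, even if it
-- has several faces over one face of `K`.
module Lifting (X : CellularEmbedding) (K : Map) (moves : ∀ d → Map.turn K face d ≢ d)
  (q : CellularEmbedding.Dart X → Map.Dart K)
  (q-turn : ∀ i d → q (CellularEmbedding.turn X i d) ≡ Map.turn K i (q d))
  (q-onto : ∀ e → ∃ λ d → q d ≡ e)
  (q-injective : ∀ i d d′ → CellularEmbedding.cell X i d ≡ CellularEmbedding.cell X i d′ → q d ≡ q d′ → d ≡ d′)
  where

  private
    module K where
      open Map K public
      open Flags K moves public using (edge-darts; vertex-next; flag-unique; cell-turn; cell-fold)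
  open Cells X
  open EdgeDarts X

  q-cell : ∀ i d d′ → cell i d ≡ cell i d′ → K.cell i (q d) ≡ K.cell i (q d′)
  q-cell i d d′ eq with to (cell-orbit i d d′) eq
  ... | k , refl = from (K.cell-orbit i _ _) (k , sym (fold-hom q (q-turn i) d k))

  q-lift : ∀ i d e → K.cell i (q d) ≡ K.cell i e → ∃ λ d′ → cell i d′ ≡ cell i d × q d′ ≡ e
  q-lift i d e eq with to (K.cell-orbit i _ _) eq
  ... | k , turned = fold d (turn i) k , cell-fold i d k , trans (fold-hom q (q-turn i) d k) turned

  η : ∀ i → Cell i → K.Cell i
  η i x = K.cell i (q (proj₁ (cell-onto i x)))

  η-cell : ∀ i d → η i (cell i d) ≡ K.cell i (q d)
  η-cell i d = q-cell i _ d (proj₂ (cell-onto i (cell i d)))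

  η-incident : ∀ i j (x : Cell i) (y : Cell j) → Incident x y → K.Incident (η i x) (η j y)
  η-incident i j _ _ (d , refl , refl) = q d , sym (η-cell i d) , sym (η-cell j d)

  -- Local injectivity at the common cell `y`: the dart of `K` below is determined by its cells of
  -- dimensions `i` and `j`, and only one dart of `y` lies over it.
  cells-meet : ∀ {i j} → i ≢ j → ∀ {x x′ : Cell i} {y y′ : Cell j} → Incident x y → Incident x′ y′ →
               η i x ≡ η i x′ → η j y ≡ η j y′ → y ≡ y′ → x ≡ x′
  cells-meet {i} {j} i≢j (a , refl , refl) (b , refl , bj) ηx ηy y≡y′ =
    cong (cell i) (q-injective j a b (trans y≡y′ (sym bj)) (K.flag-unique i≢j (q a) (q b)
      (trans (sym (η-cell i a)) (trans ηx (η-cell i b)))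
      (trans (sym (η-cell j a)) (trans ηy (trans (cong (η j) (sym bj)) (η-cell j b))))))

  -- Incidence lifts inside a face: the end of the edge on `f` that lies over the image of `w` must
  -- be `w`, because no vertex of `K` occurs twice on the boundary of a face.
  vertex-on-edge : ∀ {w e f} → Incident {vertex} {face} w f → Incident {edge} {face} e f →
                   K.Incident (η vertex w) (η edge e) → Incident w e
  vertex-on-edge {e = e} (a , refl , refl) (b , refl , bf) (x , xw , xe)
    with K.edge-darts (q b) x (trans (sym (η-cell edge b)) (sym xe))
  ... | inj₁ refl = b , cong (cell vertex) b≡a , refl
    where
    b≡a : b ≡ a
    b≡a = q-injective face b a bf (K.boundary-vertices _ _ (q-cell face b a bf) (trans xw (η-cell vertex a)))
  ... | inj₂ refl = α b , trans (sym (vertex-next b)) (cong (cell vertex) φb≡a) , cell-turn edge b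
    where
    same-face : cell face (turn face b) ≡ cell face a
    same-face = trans (cell-turn face b) bf
    φb≡a : turn face b ≡ a
    φb≡a = q-injective face _ a same-face (K.boundary-vertices _ _ (q-cell face _ a same-face)
      (trans (cong (K.cell vertex) (q-turn face b)) (trans (K.vertex-next (q b)) (trans xw (η-cell vertex a)))))

  common-image : ∀ {i} f g (x : Cell i) → Common f g x → K.Common (η face f) (η face g) (η i x)
  common-image f g x (xf , xg) = η-incident _ _ _ _ xf , η-incident _ _ _ _ xg

  edge-over : ∀ f e → K.Incident e (η face f) → ∃ λ e′ → Incident {edge} {face} e′ f × η edge e′ ≡ e
  edge-over f e (b , be , bf) with cell-onto face f
  ... | d , refl with q-lift face d b (sym bf)
  ... | d′ , face≡ , refl = cell edge d′ , (d′ , refl , face≡) , trans (η-cell edge d′) be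

  common? : ∀ {i} f g (x : Cell i) → Dec (Common f g x)
  common? f g x = incident? x f ×-dec incident? x g

  faces-meet : ∀ f g → f ≢ g → MeetInNothing f g ⊎ MeetInVertex f g ⊎ MeetInEdge f g
  faces-meet f g f≢g with η face f ≟ η face g
  -- Different faces over one face are disjoint: at a common cell the covering would not be
  -- injective.
  ... | yes ηf≡ηg = inj₁ (apart (λ ()) , apart (λ ()))
    where
    apart : ∀ {i} → face ≢ i → ∀ (x : Cell i) → ¬ Common f g x
    apart f≢i x ((a , ax , af) , (b , bx , bg)) =
      f≢g (cells-meet f≢i (a , af , ax) (b , bg , bx) ηf≡ηg refl refl)
  ... | no ηf≢ηg with K.faces-meet (η face f) (η face g) ηf≢ηg
  ...   | inj₁ (no-v , no-e) =
          inj₁ ((λ v c → no-v _ (common-image f g v c)) , (λ e c → no-e _ (common-image f g e c)))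
  ...   | inj₂ (inj₁ (v , only-v , no-e)) with Fin.any? (λ w → common? {vertex} f g w)
  ...     | no none = inj₁ ((λ w c → none (w , c)) , (λ e c → no-e _ (common-image f g e c)))
  ...     | yes (w , cw) = inj₂ (inj₁ (w ,
              (λ w′ → mk⇔ (λ c → cells-meet (λ ()) (proj₁ c) (proj₁ cw)
                  (trans (to (only-v _) (common-image f g w′ c)) (sym (to (only-v _) (common-image f g w cw)))) refl refl)
                (λ { refl → cw })) ,
              (λ e c → no-e _ (common-image f g e c))))
  faces-meet f g f≢g | no ηf≢ηg | inj₂ (inj₂ (ē , on-ē , only-ē)) with Fin.any? (λ e → common? {edge} f g e)
  ...     | yes (e , ce) = inj₂ (inj₂ (e ,
              (λ w → mk⇔ (λ c → vertex-on-edge (proj₁ c) (proj₁ ce)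
                  (subst (K.Incident (η vertex w)) (sym (over ce)) (to (on-ē _) (common-image f g w c))))
                (λ we → vertex-edge-face we (proj₁ ce) , vertex-edge-face we (proj₂ ce))) ,
              (λ e′ → mk⇔ (λ c → cells-meet (λ ()) (proj₁ c) (proj₁ ce) (trans (over c) (sym (over ce))) refl refl)
                (λ { refl → ce }))))
    where
    over : ∀ {e} → Common f g e → η edge e ≡ ē
    over {e} c = to (only-ē _) (common-image f g e c)
  -- The common edge of the images lifts to an edge of `f` and to an edge of `g`. A common vertex of
  -- `f` and `g` would lie on both lifts and force them to coincide, contrary to `none`.
  ...     | no none with edge-over f ē (proj₁ (from (only-ē ē) refl)) | edge-over g ē (proj₂ (from (only-ē ē) refl))
  ...       | e , ef , refl | e′ , e′g , ηe′ = inj₁ (no-vertex , λ e c → none (e , c))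
    where
    no-vertex : ∀ w → ¬ Common f g w
    no-vertex w c = none (e , ef , subst (λ e → Incident e g) (sym e≡e′) e′g)
      where
      on-e : K.Incident (η vertex w) (η edge e)
      on-e = to (on-ē _) (common-image f g w c)
      swap : ∀ {x y} → Incident {vertex} {edge} x y → Incident {edge} {vertex} y x
      swap (d , dx , dy) = d , dy , dx
      e≡e′ : e ≡ e′
      e≡e′ = cells-meet (λ ()) (swap (vertex-on-edge (proj₁ c) ef on-e))
        (swap (vertex-on-edge (proj₂ c) e′g (subst (K.Incident _) (sym ηe′) on-e))) (sym ηe′) refl refl

  map : Map
  map = record
    { embedding         = X
    ; boundary-vertices = λ d d′ f v → q-injective face d d′ f
                            (K.boundary-vertices _ _ (q-cell face d d′ f) (q-cell vertex d d′ v))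
    ; boundary-edges    = λ d d′ f e → q-injective face d d′ f
                            (K.boundary-edges _ _ (q-cell face d d′ f) (q-cell edge d d′ e))
    ; faces-meet        = faces-meet
    }

  covering : Covering map K
  covering = record
    { η           = η
    ; η-onto      = λ i y → let e , ey = K.cell-onto i y ; d , de = q-onto e in
                      cell i d , trans (η-cell i d) (trans (cong (K.cell i) de) ey)
    ; η-adjacent  = λ { _ _ (d , refl , refl) → q d , sym (η-cell vertex d) ,
                        trans (cong (K.cell vertex) (sym (q-turn edge d))) (sym (η-cell vertex (α d))) }
    ; η-incident  = η-incident
    ; η-local-bij = η-local-bij
    }
    where
    η-local-bij : ∀ i j (x : Cell i) (z : K.Cell j) → K.Incident (η i x) z →
                  ∃! _≡_ λ (y : Cell j) → Incident x y × η j y ≡ z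
    η-local-bij i j x z (e , ex , refl) with cell-onto i x
    ... | d , refl with q-lift i d e (sym ex)
    ... | d′ , cell≡ , refl = cell j d′ , ((d′ , cell≡ , refl) , η-cell j d′) , unique
      where
      unique : ∀ {y} → Incident (cell i d) y × η j y ≡ K.cell j (q d′) → cell j d′ ≡ y
      unique {y} ((b , bx , by) , ηy) with i ≟ᵈ j
      ... | yes refl = trans cell≡ (trans (sym bx) by)
      ... | no i≢j   = trans (cong (cell j) (q-injective i d′ b (trans cell≡ (sym bx))
              (K.flag-unique i≢j (q d′) (q b) (q-cell i d′ b (trans cell≡ (sym bx)))
                (trans (sym ηy) (trans (cong (η j) (sym by)) (η-cell j b)))))) by

covering-id : (K : Map) → Covering K K
covering-id K = record
  { η           = λ _ x → x
  ; η-onto      = λ _ y → y , refl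
  ; η-adjacent  = λ _ _ a → a
  ; η-incident  = λ _ _ _ _ inc → inc
  ; η-local-bij = λ _ _ _ z inc → z , (inc , refl) , λ { (_ , refl) → refl }
  }

-- Rigidity of automorphisms

data Orientation : Set where
  direct mirrored : Orientation

opposite : Orientation → Orientation
opposite direct = mirrored
opposite mirrored = direct

module Reversal (X : CellularEmbedding) where
  open Cells X

  φ⁻¹ : Dart → Dart
  φ⁻¹ d = α (σ ⟨$⟩ˡ d)

  φ⁻¹-φ : ∀ d → φ⁻¹ (turn face d) ≡ d
  φ⁻¹-φ d = trans (cong α (inverseˡ σ)) (α-involutive d)

  -- A mirrored image is the reversed dart, taken so that its left face is the image of the left
  -- face. Steps along a face then become steps back, while `σ`, being the face turn after `α`,
  -- becomes `φ⁻¹` after `α` and not the inverse of `σ`.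
  turnˢ : Orientation → Dim → Dart → Dart
  turnˢ direct i      d = turn i d
  turnˢ mirrored vertex d = φ⁻¹ (α d)
  turnˢ mirrored edge   d = α d
  turnˢ mirrored face   d = φ⁻¹ d

module Rigidity (M : Map) (moves : ∀ d → Map.turn M face d ≢ d)
  (moves² : ∀ d → Map.turn M face (Map.turn M face d) ≢ d) where
  open Flags M moves
  open Reversal (Map.embedding M)
  open Map M using (faces-meet)

  private
    φ : Dart → Dart
    φ = turn face

    φ-injective : ∀ {d d′} → φ d ≡ φ d′ → d ≡ d′
    φ-injective {d} {d′} eq = trans (sym (φ⁻¹-φ d)) (trans (cong φ⁻¹ eq) (φ⁻¹-φ d′))

    ends : ∀ {v} d → Incident {vertex} {edge} v (cell edge d) → v ≡ cell vertex d ⊎ v ≡ cell vertex (α d)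
    ends d (x , refl , eq) with edge-darts d x (sym eq)
    ... | inj₁ refl = inj₁ refl
    ... | inj₂ refl = inj₂ refl

    head : ∀ d → Incident {vertex} {face} (cell vertex (α d)) (cell face d)
    head d = φ d , vertex-next d , cell-turn face d

  -- A third face `f` would share both ends of `d` with the left face, so the two would meet in an
  -- edge with these ends. On the left face that edge is the one of `d`, or else the face is a
  -- digon.
  edge-in-face : ∀ d f → Incident {vertex} {face} (cell vertex d) f → Incident {vertex} {face} (cell vertex (α d)) f →
                 f ≡ cell face d ⊎ f ≡ cell face (α d)
  edge-in-face d f tail-f head-f with f ≟ cell face d
  ... | yes eq = inj₁ eq
  ... | no f≢ with faces-meet (cell face d) f (f≢ ∘ sym)
  ...   | inj₁ (no-v , _) = contradiction ((d , refl , refl) , tail-f) (no-v _)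
  ...   | inj₂ (inj₁ (v , only-v , _)) = contradiction
          (trans (to (only-v _) ((d , refl , refl) , tail-f)) (sym (to (only-v _) (head d , head-f)))) (loopless d)
  ...   | inj₂ (inj₂ (e , on-e , only-e)) with proj₁ (from (only-e e) refl)
  ...     | x , refl , fx with ends x (to (on-e _) ((d , refl , refl) , tail-f)) | ends x (to (on-e _) (head d , head-f))
  ...       | inj₂ tail | inj₁ hd = contradiction
              (trans (cong φ (sym φx≡d)) φd≡x) (moves² x)
    where
    φx≡d : d ≡ φ x
    φx≡d = boundary-vertices _ _ (trans (sym fx) (sym (cell-turn face x))) (trans tail (sym (vertex-next x)))
    φd≡x : φ d ≡ x
    φd≡x = boundary-vertices _ _ (trans (cell-turn face d) (sym fx)) (trans (vertex-next d) hd)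
  ...       | inj₁ tail | inj₁ hd = contradiction (trans tail (sym hd)) (loopless d)
  ...       | inj₂ tail | inj₂ hd = contradiction (trans tail (sym hd)) (loopless d)
  ...       | inj₁ tail | inj₂ hd with boundary-vertices d x (sym fx) tail
  ...         | refl with proj₂ (from (only-e _) refl)
  ...           | y , edge-y , face-y with edge-darts d y (sym edge-y)
  ...             | inj₁ refl = contradiction (sym face-y) f≢
  ...             | inj₂ refl = inj₂ (sym face-y)

  -- Three consecutive vertices of `f` are distinct, too many for a common vertex or for the two
  -- ends of a common edge.
  same-vertices : ∀ f g → (∀ v → Incident {vertex} {face} v f → Incident {vertex} {face} v g) → f ≡ g
  same-vertices f g sub with f ≟ g
  ... | yes eq = eq
  ... | no f≢g with cell-onto face f
  ...   | a , refl with faces-meet (cell face a) g f≢g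
  ...     | inj₁ (no-v , _) = contradiction ((a , refl , refl) , sub _ (a , refl , refl)) (no-v _)
  ...     | inj₂ (inj₁ (v , only-v , _)) = contradiction
            (trans (to (only-v _) ((a , refl , refl) , sub _ (a , refl , refl)))
              (sym (to (only-v _) (head a , sub _ (head a))))) (loopless a)
  ...     | inj₂ (inj₂ (e , on-e , _)) with cell-onto edge e
  ...       | x , refl = contradiction
              (crowded (end-of a refl) (end-of (φ a) φa) (end-of (φ (φ a)) (trans (cell-turn face (φ a)) φa)))
              λ { (inj₁ eq)        → moves a (sym (boundary-vertices _ _ (sym φa) eq))
                ; (inj₂ (inj₁ eq)) → moves (φ a) (sym (boundary-vertices _ _ (sym (cell-turn face (φ a))) eq))
                ; (inj₂ (inj₂ eq)) → moves² a (sym (boundary-vertices _ _ (sym (trans (cell-turn face (φ a)) φa)) eq)) }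
    where
    φa : cell face (φ a) ≡ cell face a
    φa = cell-turn face a
    end-of : ∀ b → cell face b ≡ cell face a → cell vertex b ≡ cell vertex x ⊎ cell vertex b ≡ cell vertex (α x)
    end-of b eq = ends x (to (on-e _) ((b , refl , eq) , sub _ (b , refl , eq)))
    crowded : ∀ {A : Set} {p q r x y : A} → p ≡ x ⊎ p ≡ y → q ≡ x ⊎ q ≡ y → r ≡ x ⊎ r ≡ y → p ≡ q ⊎ q ≡ r ⊎ p ≡ r
    crowded (inj₁ refl) (inj₁ refl) _           = inj₁ refl
    crowded (inj₁ refl) (inj₂ refl) (inj₁ refl) = inj₂ (inj₂ refl)
    crowded (inj₁ refl) (inj₂ refl) (inj₂ refl) = inj₂ (inj₁ refl)
    crowded (inj₂ refl) (inj₁ refl) (inj₁ refl) = inj₂ (inj₁ refl)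
    crowded (inj₂ refl) (inj₁ refl) (inj₂ refl) = inj₂ (inj₂ refl)
    crowded (inj₂ refl) (inj₂ refl) _           = inj₁ refl

  module Transport (π : VertexPerm M) (maps : MapsCells M π) where

    private
      π-injective : ∀ {v w} → π ⟨$⟩ʳ v ≡ π ⟨$⟩ʳ w → v ≡ w
      π-injective eq = trans (sym (inverseˡ π)) (trans (cong (π ⟨$⟩ˡ_) eq) (inverseˡ π))

    end : Orientation → Dart → Cell vertex
    end direct d = cell vertex d
    end mirrored d = cell vertex (α d)

    -- π carries the left face of d to the left face of d′, and it carries d to d′
    -- if it is direct, but the reverse of d to d′ if it is mirrored.
    record Image (s : Orientation) (d d′ : Dart) : Set where
      field
        tail-image : cell vertex d′ ≡ π ⟨$⟩ʳ end s d
        head-image : cell vertex (α d′) ≡ π ⟨$⟩ʳ end (opposite s) d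
        left-image : Carries M π (cell face d) (cell face d′)
    open Image

    carries-unique : ∀ {f g y} → Carries M π f y → Carries M π {face} g y → f ≡ g
    carries-unique cf cg = same-vertices _ _ λ v inc → from (cg v) (to (cf v) inc)

    carries-unique′ : ∀ {f y z} → Carries M π f y → Carries M π {face} f z → y ≡ z
    carries-unique′ {f} {y} {z} cy cz = same-vertices _ _ λ v inc → subst (λ w → Incident w z) (inverseʳ π)
      (to (cz (π ⟨$⟩ˡ v)) (from (cy (π ⟨$⟩ˡ v)) (subst (λ w → Incident w y) (sym (inverseʳ π)) inc)))

    image-unique : ∀ {s d d′ d″} → Image s d d′ → Image s d d″ → d′ ≡ d″
    image-unique I J = boundary-vertices _ _ (carries-unique′ (left-image I) (left-image J))
      (trans (tail-image I) (sym (tail-image J)))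

    -- The image face contains both ends of `e`, hence lies beside `e` by `edge-in-face`. So `e` has
    -- a dart with this face on its left, and the orientation records which of its ends is the image
    -- of the tail of `d`.
    image-dart : ∀ d e f → Carries M π (cell edge d) e → Carries M π (cell face d) f →
                 ∃₂ λ s d′ → cell edge d′ ≡ e × cell face d′ ≡ f × Image s d d′
    image-dart d e f ce cf with cell-onto edge e
    ... | x , refl = orient (preimage (x , refl , refl)) (preimage (α x , refl , cell-turn edge x))
      where
      preimage : ∀ {v} → Incident {vertex} {edge} v (cell edge x) → v ≡ π ⟨$⟩ʳ cell vertex d ⊎ v ≡ π ⟨$⟩ʳ cell vertex (α d)
      preimage {v} inc with ends d (from (ce (π ⟨$⟩ˡ v)) (subst (λ w → Incident w (cell edge x)) (sym (inverseʳ π)) inc))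
      ... | inj₁ eq = inj₁ (trans (sym (inverseʳ π)) (cong (π ⟨$⟩ʳ_) eq))
      ... | inj₂ eq = inj₂ (trans (sym (inverseʳ π)) (cong (π ⟨$⟩ʳ_) eq))

      on-f : ∀ {v w} → Incident {vertex} {face} v (cell face d) → w ≡ π ⟨$⟩ʳ v → Incident {vertex} {face} w f
      on-f inc refl = to (cf _) inc

      αα : cell vertex (α (α x)) ≡ cell vertex x
      αα = cong (cell vertex) (α-involutive x)

      Result : Set
      Result = ∃₂ λ s d′ → cell edge d′ ≡ cell edge x × cell face d′ ≡ f × Image s d d′

      left : ∀ {d′} → f ≡ cell face d′ → Carries M π (cell face d) (cell face d′)
      left eq = subst (Carries M π (cell face d)) eq cf

      orient : cell vertex x ≡ π ⟨$⟩ʳ cell vertex d ⊎ cell vertex x ≡ π ⟨$⟩ʳ cell vertex (α d) →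
               cell vertex (α x) ≡ π ⟨$⟩ʳ cell vertex d ⊎ cell vertex (α x) ≡ π ⟨$⟩ʳ cell vertex (α d) → Result
      orient (inj₁ p) (inj₁ q) = contradiction (trans p (sym q)) (loopless x)
      orient (inj₂ p) (inj₂ q) = contradiction (trans p (sym q)) (loopless x)
      orient (inj₁ p) (inj₂ q) with edge-in-face x f (on-f (d , refl , refl) p) (on-f (head d) q)
      ... | inj₁ eq = direct , x , refl , sym eq , record { tail-image = p ; head-image = q ; left-image = left eq }
      ... | inj₂ eq = mirrored , α x , cell-turn edge x , sym eq ,
                      record { tail-image = q ; head-image = trans αα p ; left-image = left eq }
      orient (inj₂ p) (inj₁ q) with edge-in-face x f (on-f (head d) p) (on-f (d , refl , refl) q)
      ... | inj₁ eq = mirrored , x , refl , sym eq , record { tail-image = p ; head-image = q ; left-image = left eq }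
      ... | inj₂ eq = direct , α x , cell-turn edge x , sym eq ,
                      record { tail-image = q ; head-image = trans αα p ; left-image = left eq }

    private
      next : ∀ d d′ → Carries M π (cell face d) (cell face d′) → ∃₂ λ s d″ → cell face d″ ≡ cell face d′ × Image s (φ d) d″
      next d d′ left with maps edge (cell edge (φ d))
      ... | e , ce with image-dart (φ d) e (cell face d′) ce
                          (subst (λ f → Carries M π f (cell face d′)) (sym (cell-turn face d)) left)
      ... | s , d″ , _ , fd″ , I = s , d″ , fd″ , I

      back-and-forth : ∀ d → cell vertex (α (φ d)) ≢ cell vertex d
      back-and-forth d eq = moves² d (boundary-vertices _ _
        (trans (cell-turn face (φ d)) (cell-turn face d)) (trans (vertex-next (φ d)) eq))

    -- The images of consecutive darts lie on one face and share the image of the common vertex. If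
    -- the orientation changed between them they would be the same dart, and the face of `d` would
    -- be a digon.
    image-φ : ∀ s {d d′} → Image s d d′ → Image s (φ d) (turnˢ s face d′)
    image-φ direct {d} {d′} I with next d d′ (left-image I)
    ... | direct , d″ , fd″ , J = subst (Image direct (φ d)) (boundary-vertices _ _ (trans fd″ (sym (cell-turn face d′)))
            (trans (tail-image J) (trans (cong (π ⟨$⟩ʳ_) (vertex-next d)) (trans (sym (head-image I)) (sym (vertex-next d′)))))) J
    ... | mirrored , d″ , fd″ , J = contradiction (π-injective (trans (sym (tail-image J))
            (trans (cong (cell vertex) d″≡d′) (tail-image I)))) (back-and-forth d)
      where
      d″≡d′ : d″ ≡ d′
      d″≡d′ = φ-injective (boundary-vertices _ _ (trans (cell-turn face d″) (trans fd″ (sym (cell-turn face d′))))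
        (trans (vertex-next d″) (trans (head-image J) (trans (cong (π ⟨$⟩ʳ_) (vertex-next d))
          (trans (sym (head-image I)) (sym (vertex-next d′)))))))
    image-φ mirrored {d} {d′} I with next d d′ (left-image I)
    ... | mirrored , d″ , fd″ , J = subst (Image mirrored (φ d)) (trans (sym (φ⁻¹-φ d″)) (cong φ⁻¹
            (boundary-vertices (φ d″) d′ (trans (cell-turn face d″) fd″)
            (trans (vertex-next d″) (trans (head-image J) (trans (cong (π ⟨$⟩ʳ_) (vertex-next d)) (sym (tail-image I)))))))) J
    ... | direct , d″ , fd″ , J = contradiction (π-injective (trans (sym (head-image J))
            (trans (cong (cell vertex ∘ α) d″≡d′) (head-image I)))) (back-and-forth d)
      where
      d″≡d′ : d″ ≡ d′
      d″≡d′ = boundary-vertices _ _ fd″ (trans (tail-image J) (trans (cong (π ⟨$⟩ʳ_) (vertex-next d)) (sym (tail-image I))))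

    private
      end-α : ∀ s d → end s (α d) ≡ end (opposite s) d
      end-α direct d = refl
      end-α mirrored d = cong (cell vertex) (α-involutive d)

      opposite² : ∀ s → opposite (opposite s) ≡ s
      opposite² direct = refl
      opposite² mirrored = refl

      -- The image of the right face contains both ends of `d′`, so it is one of the two faces
      -- there. It is not the left one, since faces with the same image are equal and a disc does
      -- not have `d` on both sides.
      other-left : ∀ s {d d′} → Image s d d′ → ∀ y → Carries M π (cell face (α d)) y → y ≡ cell face (α d′)
      other-left s {d} {d′} I y c with edge-in-face d′ y (on-y s (tail-image I)) (on-y (opposite s) (head-image I))
        where
        on-α : ∀ s → Incident {vertex} {face} (end s d) (cell face (α d))
        on-α direct = subst (λ x → Incident (cell vertex x) (cell face (α d))) (α-involutive d) (head (α d))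
        on-α mirrored = α d , refl , refl
        on-y : ∀ s {w} → w ≡ π ⟨$⟩ʳ end s d → Incident {vertex} {face} w y
        on-y s refl = to (c _) (on-α s)
      ... | inj₂ eq = eq
      ... | inj₁ refl = contradiction
              (boundary-edges _ _ (carries-unique c (left-image I)) (cell-turn edge d)) (α-fixfree d)

    image-α : ∀ s {d d′} → Image s d d′ → Image s (α d) (α d′)
    image-α s {d} {d′} I = record
      { tail-image = trans (head-image I) (cong (π ⟨$⟩ʳ_) (sym (end-α s d)))
      ; head-image = trans (cong (cell vertex) (α-involutive d′)) (trans (tail-image I)
          (cong (π ⟨$⟩ʳ_) (sym (trans (end-α (opposite s) d) (cong (λ s → end s d) (opposite² s))))))
      ; left-image = let y , c = maps face (cell face (α d)) in
          subst (Carries M π (cell face (α d))) (other-left s I y c) c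
      }

    image-turn : ∀ s i {d d′} → Image s d d′ → Image s (turn i d) (turnˢ s i d′)
    image-turn s edge {d} {d′} I = subst (Image s (α d)) (turn-edge s) (image-α s I)
      where
      turn-edge : ∀ s → α d′ ≡ turnˢ s edge d′
      turn-edge direct = refl
      turn-edge mirrored = refl
    image-turn s face I = image-φ s I
    image-turn s vertex {d} {d′} I = subst (λ x → Image s x (turnˢ s vertex d′)) (cong (σ ⟨$⟩ʳ_) (α-involutive d))
      (subst (Image s (φ (α d))) (turn-vertex s) (image-φ s (image-α s I)))
      where
      turn-vertex : ∀ s → turnˢ s face (α d′) ≡ turnˢ s vertex d′
      turn-vertex direct = cong (σ ⟨$⟩ʳ_) (α-involutive d′)
      turn-vertex mirrored = refl

    image-along : ∀ s w {d d′} → Image s d d′ → Image s (along turn w d) (along (turnˢ s) w d′)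
    image-along s []      I = I
    image-along s (i ∷ w) I = image-along s w (image-turn s i I)

    image-fold : ∀ s w k {d d′} → Image s d d′ → Image s (fold d (along turn w) k) (fold d′ (along (turnˢ s) w) k)
    image-fold s w zero    I = I
    image-fold s w (suc k) I = image-along s w (image-fold s w k I)

  -- The image of a dart is unique once the orientation is fixed, so the image of a walk that
  -- returns to `d` returns to the image of `d`. The edge `e` has two darts and the automorphism two
  -- orientations; the conclusion commits to none of them.
  closed-walk-transfer : ∀ {d e} w k → SameOrbit M (cell edge d) e → fold d (along turn w) k ≡ d →
                         ∃₂ λ s d′ → cell edge d′ ≡ e × fold d′ (along (turnˢ s) w) k ≡ d′
  closed-walk-transfer {d} {e} w k (π , (maps , _) , ce) closed
    with maps face (cell face d)
  ... | f , cf with Transport.image-dart π maps d e f ce cf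
  ... | s , d′ , de , _ , I = s , d′ , de ,
    Transport.image-unique π maps
      (subst (λ x → Transport.Image π maps s x (fold d′ (along (turnˢ s) w) k)) closed
        (Transport.image-fold π maps s w k I)) I

-- Orbits of edges

module PlaneReversal (𝒯 : Tiling) where
  open TilingProperties 𝒯

  -- The counterpart of `Reversal.turnˢ` in the plane, where `period` face turns serve as the
  -- inverse of one.
  turnˢ : Orientation → Dim → Plane → Plane
  turnˢ direct   i      x = turn i x
  turnˢ mirrored vertex x = fold (turn edge x) (turn face) period
  turnˢ mirrored edge   x = turn edge x
  turnˢ mirrored face   x = fold x (turn face) period

  turnˢ-natural : ∀ s i → Natural (turnˢ s i)
  turnˢ-natural direct   i      = turn-natural i
  turnˢ-natural mirrored vertex = turn^-natural face period ∘ᵉ turn-natural edge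
  turnˢ-natural mirrored edge   = turn-natural edge
  turnˢ-natural mirrored face   = turn^-natural face period

  walk : Orientation → List Dim → Plane → Plane
  walk s = along (turnˢ s)

  walk-natural : ∀ s w → Natural (walk s w)
  walk-natural s []      = id-natural
  walk-natural s (i ∷ w) = walk-natural s w ∘ᵉ turnˢ-natural s i

  -- A word that restores the kind `j` translates all darts of that kind by one vector, so its
  -- repetitions add up.
  walk-fold : ∀ s w {j} → proj₂ (walk s w (0̂ , j)) ≡ j → ∀ t k →
              fold (t , j) (walk s w) k ≡ shift (+ k · proj₁ (walk s w (0̂ , j))) (t , j)
  walk-fold s w {j} kind t zero = cong (_, j) (sym (⊕-identityˡ t))
  walk-fold s w {j} kind t (suc k) = trans (cong (walk s w) (walk-fold s w kind t k))
    (trans (commute (walk-natural s w) (+ k · v) (t , j))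
      (trans (cong (shift (+ k · v)) (equivariant-at (walk-natural s w) t j))
        (cong₂ _,_ (cong₂ _,_ (regroup (+ k) (proj₁ v) (proj₁ t)) (regroup (+ k) (proj₂ v) (proj₂ t))) kind)))
    where
    v : ℤ²
    v = proj₁ (walk s w (0̂ , j))
    regroup : ∀ k v t → k ℤ.* v ℤ.+ (t ℤ.+ v) ≡ (1ℤ ℤ.+ k) ℤ.* v ℤ.+ t
    regroup = solve-∀

module DevelopmentReversal {𝒯 : Tiling} {X : CellularEmbedding} (𝒟 : Development 𝒯 X) where
  open DevelopmentProperties 𝒟
  private
    module T = TilingProperties 𝒯
    module X where
      open Cells X public
      open Reversal X public
  open PlaneReversal 𝒯

  p-moves : ∀ f → Natural f → (∀ j → proj₂ (f (0̂ , j)) ≢ j) → ∀ x → p (f x) ≢ p x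
  p-moves f nf moves (t , j) eq =
    moves j (trans (sym (cong proj₂ (equivariant-at nf t j))) (p-kind _ _ eq))

  face-moves : ∀ d → X.turn face d ≢ d
  face-moves d eq with onto d
  ... | x , refl = p-moves (T.turn face) (T.turn-natural face) T.face-moves x (trans (p-turn face x) eq)

  face-moves² : ∀ d → X.turn face (X.turn face d) ≢ d
  face-moves² d eq with onto d
  ... | x , refl = p-moves (T.turn face ∘ T.turn face) (T.turn-natural face ∘ᵉ T.turn-natural face) T.face-moves² x
          (trans (p-turn face _) (trans (cong (X.turn face) (p-turn face x)) eq))

  p-φ⁻¹ : ∀ x → p (fold x (T.turn face) T.period) ≡ X.φ⁻¹ (p x)
  p-φ⁻¹ x = trans (sym (X.φ⁻¹-φ _)) (cong X.φ⁻¹ (trans (sym (p-turn face _)) (cong p (T.turn-period face x))))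

  p-turnˢ : ∀ s i x → p (turnˢ s i x) ≡ X.turnˢ s i (p x)
  p-turnˢ direct   i      x = p-turn i x
  p-turnˢ mirrored vertex x = trans (p-φ⁻¹ (T.turn edge x)) (cong X.φ⁻¹ (p-turn edge x))
  p-turnˢ mirrored edge   x = p-turn edge x
  p-turnˢ mirrored face   x = p-φ⁻¹ x

  p-walk : ∀ s w x → p (walk s w x) ≡ along (X.turnˢ s) w (p x)
  p-walk s []      x = refl
  p-walk s (i ∷ w) x = trans (p-walk s w (turnˢ s i x)) (cong (along (X.turnˢ s) w) (p-turnˢ s i x))

  p-walks : ∀ s w k x → p (fold x (walk s w) k) ≡ fold (p x) (along (X.turnˢ s) w) k
  p-walks s w k x = fold-hom p (p-walk s w) x k

module Periods {𝒯 : Tiling} {X : CellularEmbedding} (𝒟 : Development 𝒯 X) where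
  open DevelopmentProperties 𝒟
  private
    module T = TilingProperties 𝒯
    module X = CellularEmbedding X

  period-0 : Period 0̂
  period-0 (t , j) = cong (λ u → p (u , j)) (⊕-identityˡ t)

  period-⊕ : ∀ u v → Period u → Period v → Period (u ⊕ v)
  period-⊕ u v pu pv (t , j) = trans (cong (λ w → p (w , j)) (⊕-assoc u v t)) (trans (pu _) (pv _))

  period-⊖ : ∀ u → Period u → Period (⊖ u)
  period-⊖ u pu (t , j) = trans (sym (pu _)) (cong (λ w → p (w , j))
    (trans (sym (⊕-assoc u (⊖ u) t)) (trans (cong (_⊕ t) (⊕-inverseʳ u)) (⊕-identityˡ t))))

  period-· : ∀ u → Period u → ∀ k → Period (k · u)
  period-· u pu = ℤ-induction (λ k → Period (k · u)) period-0
    (λ k pk → subst Period (cong₂ _,_ (up k (proj₁ u)) (up k (proj₂ u))) (period-⊕ u (k · u) pu pk))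
    (λ k pk → subst Period (cong₂ _,_ (down k (proj₁ u)) (down k (proj₂ u)))
      (period-⊕ ((1ℤ ℤ.+ k) · u) (⊖ u) pk (period-⊖ u pu)))
    where
    up : ∀ k x → x ℤ.+ k ℤ.* x ≡ (1ℤ ℤ.+ k) ℤ.* x
    up = solve-∀
    down : ∀ k x → (1ℤ ℤ.+ k) ℤ.* x ℤ.- x ≡ k ℤ.* x
    down = solve-∀

  -- Among more multiples of `u` than `X` has darts, two give the same dart; their difference is a
  -- period.
  recurrence : ∀ u → ∃ λ n → 0 < n × Period (+ n · u)
  recurrence u with pigeonhole {m = X.#darts} (ℕ.n<1+n _) (λ k → p (+ toℕ k · u , T.base))
  ... | i , j , i<j , eq = toℕ j ∸ toℕ i , ℕ.m<n⇒0<n∸m i<j ,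
    subst Period (cong₂ _,_ (difference (proj₁ u)) (difference (proj₂ u))) (kernel (+ toℕ j · u) (+ toℕ i · u) T.base (sym eq))
    where
    difference : ∀ x → + toℕ j ℤ.* x ℤ.- + toℕ i ℤ.* x ≡ + (toℕ j ∸ toℕ i) ℤ.* x
    difference x = trans (factor (+ toℕ j) (+ toℕ i) x)
      (cong (ℤ._* x) (trans (ℤ.m-n≡m⊖n (toℕ j) (toℕ i)) (ℤ.⊖-≥ (ℕ.<⇒≤ i<j))))
      where
      factor : ∀ a b x → a ℤ.* x ℤ.- b ℤ.* x ≡ (a ℤ.- b) ℤ.* x
      factor = solve-∀

  common-period : ∃ λ n → 0 < n × (∀ a b → Period (a ℤ.* + n , b ℤ.* + n))
  common-period with recurrence (1ℤ , 0ℤ) | recurrence (0ℤ , 1ℤ)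
  ... | suc k , _ , pk | suc l , _ , pl = suc k * suc l , z<s , λ a b →
    subst Period (cong₂ _,_ (trans (eq₁ a b (+ suc k) (+ suc l)) (cong (a ℤ.*_) (sym (ℤ.pos-* (suc k) (suc l)))))
                            (trans (eq₂ a b (+ suc k) (+ suc l)) (cong (b ℤ.*_) (sym (ℤ.pos-* (suc k) (suc l))))))
      (period-⊕ ((a ℤ.* + suc l) · + suc k · (1ℤ , 0ℤ)) ((b ℤ.* + suc k) · + suc l · (0ℤ , 1ℤ))
        (period-· _ pk (a ℤ.* + suc l)) (period-· _ pl (b ℤ.* + suc k)))
    where
    eq₁ : ∀ a b k l → (a ℤ.* l) ℤ.* (k ℤ.* 1ℤ) ℤ.+ (b ℤ.* k) ℤ.* (l ℤ.* 0ℤ) ≡ a ℤ.* (k ℤ.* l)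
    eq₁ = solve-∀
    eq₂ : ∀ a b k l → (a ℤ.* l) ℤ.* (k ℤ.* 0ℤ) ℤ.+ (b ℤ.* k) ℤ.* (l ℤ.* 1ℤ) ≡ b ℤ.* (k ℤ.* l)
    eq₂ = solve-∀

-- The lattice of the torus lies in the lattice of periods of `K`, so `p` factors through the torus;
-- the factor `q` is the covering on darts.
module TorusCover (𝒯 : Tiling) (K : Map) (𝒟 : Development 𝒯 (Map.embedding K))
  (m₁ m₂ : ℕ) {{m₁≢0 : NonZero m₁}} {{m₂≢0 : NonZero m₂}}
  (periodic : ∀ u → Torus.Lattice 𝒯 m₁ m₂ u → DevelopmentProperties.Period 𝒟 u) where

  module 𝒳 = Torus 𝒯 m₁ m₂
  private
    module D = DevelopmentProperties 𝒟
    module K = Map K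
    open CellularEmbedding 𝒳.embedding using (Dart; turn; cell)

    same-image : ∀ x y → 𝒳.encode x ≡ 𝒳.encode y → D.p x ≡ D.p y
    same-image (t , j) (t′ , j′) eq with 𝒳.encode-kind (t , j) (t′ , j′) eq
    ... | refl = D.kernel⁻ t t′ j (periodic _ (𝒳.encode-lattice (t , j) (t′ , j) eq))

    q : Dart → K.Dart
    q d = D.p (𝒳.decode d)

    q-encode : ∀ x → q (𝒳.encode x) ≡ D.p x
    q-encode x = same-image _ x (𝒳.encode-decode (𝒳.encode x))

    q-turn : ∀ i d → q (turn i d) ≡ K.turn i (q d)
    q-turn i d = trans (cong (q ∘ turn i) (sym (𝒳.encode-decode d)))
      (trans (cong q (sym (𝒳.encode-turn i (𝒳.decode d)))) (trans (q-encode _) (D.p-turn i (𝒳.decode d))))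

    q-onto : ∀ e → ∃ λ d → q d ≡ e
    q-onto e = let x , eq = D.onto e in 𝒳.encode x , trans (q-encode x) eq

    q-injective : ∀ i d d′ → cell i d ≡ cell i d′ → q d ≡ q d′ → d ≡ d′
    q-injective i d d′ same qd = trans (sym (𝒳.encode-decode d)) (trans
      (𝒳.cell-kind-injective i (𝒳.decode d) (𝒳.decode d′)
        (trans (cong (cell i) (𝒳.encode-decode d)) (trans same (cong (cell i) (sym (𝒳.encode-decode d′)))))
        (D.p-kind _ _ qd))
      (𝒳.encode-decode d′))

    module L = Lifting 𝒳.embedding K (DevelopmentReversal.face-moves 𝒟) q q-turn q-onto q-injective

  map : Map
  map = L.map

  covering : Covering map K
  covering = L.covering

  toroidal : Toroidal map
  toroidal = 𝒳.toroidal (Tiling.euler 𝒯)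

-- Among the moves of a dart, nothing stands for its reversal.
record EdgeClasses (𝒯 : Tiling) (k : ℕ) : Set where
  open Tiling 𝒯
  field
    #generators        : ℕ
    generator inverse  : Fin #generators → Symmetry 𝒯
    inverse-after      : ∀ s → Inverse (generator s) (inverse s)
    inverse-before     : ∀ s → Inverse (inverse s) (generator s)
    generator₀         : Fin #generators
    class              : Fin q → Fin k
    representative     : Fin k → Fin q
    class-rep          : ∀ c → class (representative c) ≡ c
    class-reverse      : ∀ j → class (proj₂ (reverse j)) ≡ class j
    moves              : Fin q → List (Maybe (Fin #generators))

  travel : List (Maybe (Fin #generators)) → Fin q → Fin q
  travel = along (maybe (λ s j → proj₂ (Symmetry.image (generator s) edge j)) (λ j → proj₂ (reverse j)))

  field
    moves-rep : ∀ j → travel (moves j) j ≡ representative (class j)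

module EdgeOrbits {𝒯 : Tiling} {k : ℕ} (𝒞 : EdgeClasses 𝒯 k) (M : Map) (𝒟 : Development 𝒯 (Map.embedding M))
  (descends  : ∀ s → Descent.Descends {M = M} 𝒟 (EdgeClasses.generator 𝒞 s))
  (descends⁻ : ∀ s → Descent.Descends {M = M} 𝒟 (EdgeClasses.inverse 𝒞 s)) where
  open EdgeClasses 𝒞
  open DevelopmentProperties 𝒟
  private
    module T = TilingProperties 𝒯
    module D = Descent {M = M} 𝒟
  open Orbits M
  open EdgeDarts (Map.embedding M) using (edge-darts)

  -- The quantification over both positions builds the translations into the relation, which leaves
  -- only kinds to compare.
  Linked : Fin T.q → Fin T.q → Set
  Linked i j = ∀ t t′ → SameOrbit M (cell edge (p (t , i))) (cell edge (p (t′ , j)))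

  linked-sym : ∀ {i j} → Linked i j → Linked j i
  linked-sym l t t′ = SameOrbit-sym (l t′ t)

  linked-trans : ∀ {i j k} → Linked i j → Linked j k → Linked i k
  linked-trans l l′ t t′ = SameOrbit-trans (l t 0̂) (l′ 0̂ t′)

  linked-generator : ∀ s j → Linked j (proj₂ (Symmetry.image (generator s) edge j))
  linked-generator s j t t′ = subst (λ u → SameOrbit M (cell edge (p (t , j))) (cell edge (p (u , _))))
    (trans (⊕-comm _ image) (⊕-cancel image t′))
    (D.symmetric (inverse-after s) (inverse-before s) (descends s) (descends⁻ s) (t′ ⊕ ⊖ image) (t , j))
    where
    image : ℤ²
    image = proj₁ (Symmetry.act (generator s) edge (t , j))

  -- More than reflexivity: all translates of an edge share its orbit. The free position in
  -- `linked-generator` gives this on applying a generator and returning.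
  linked-refl : ∀ j → Linked j j
  linked-refl j = linked-trans (linked-generator generator₀ j) (linked-sym (linked-generator generator₀ j))

  linked-reverse : ∀ j → Linked j (proj₂ (T.reverse j))
  linked-reverse j t t′ = subst (λ e → SameOrbit M (cell edge (p (t , j))) e) same-edge (linked-refl j t (t′ ⊕ ⊖ v))
    where
    v : ℤ²
    v = proj₁ (T.reverse j)
    same-edge : cell edge (p (t′ ⊕ ⊖ v , j)) ≡ cell edge (p (t′ , proj₂ (T.reverse j)))
    same-edge = trans (sym (cell-turn edge _)) (trans (cong (cell edge) (sym (p-turn edge (t′ ⊕ ⊖ v , j))))
      (cong (λ u → cell edge (p (u , proj₂ (T.reverse j)))) (trans (⊕-comm _ v) (⊕-cancel v t′))))

  linked-travel : ∀ w j → Linked j (travel w j)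
  linked-travel []            j = linked-refl j
  linked-travel (just s ∷ w)  j = linked-trans (linked-generator s j) (linked-travel w _)
  linked-travel (nothing ∷ w) j = linked-trans (linked-reverse j) (linked-travel w _)

  linked-class : ∀ i j → class i ≡ class j → Linked i j
  linked-class i j eq = linked-trans (linked-travel (moves i) i) (subst (λ r → Linked r j)
    (trans (moves-rep j) (trans (cong representative (sym eq)) (sym (moves-rep i)))) (linked-sym (linked-travel (moves j) j)))

  pre : Cell edge → T.Plane
  pre e = proj₁ (onto (proj₁ (cell-onto edge e)))

  pre-cell : ∀ e → cell edge (p (pre e)) ≡ e
  pre-cell e = trans (cong (cell edge) (proj₂ (onto _))) (proj₂ (cell-onto edge e))

  edge-class : Cell edge → Fin k
  edge-class e = class (proj₂ (pre e))

  class-edge : ∀ x y → cell edge (p x) ≡ cell edge (p y) → class (proj₂ x) ≡ class (proj₂ y)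
  class-edge x y eq with edge-darts (p y) (p x) (sym eq)
  ... | inj₁ same = cong class (p-kind _ _ same)
  ... | inj₂ turned = trans (cong class (p-kind x (T.turn edge y) (trans turned (sym (p-turn edge y))))) (class-reverse _)

  same-class : ∀ e e′ → edge-class e ≡ edge-class e′ → SameOrbit M e e′
  same-class e e′ eq = subst₂ (SameOrbit M) (pre-cell e) (pre-cell e′) (linked-class _ _ eq (proj₁ (pre e)) (proj₁ (pre e′)))

  -- Edges of one class share an orbit, so edges chosen from different orbits have different
  -- classes.
  orbits-≤ : ∀ {m} → EdgeOrbital M m → m ≤ k
  orbits-≤ (orbit , onto-orbit , orbit-iff) = injective⇒≤ {f = λ c → edge-class (proj₁ (onto-orbit c))} λ {c} {c′} eq →
    trans (sym (proj₂ (onto-orbit c))) (trans (from (orbit-iff _ _) (same-class _ _ eq)) (proj₂ (onto-orbit c′)))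

  orbital : (∀ x y → SameOrbit M (cell edge (p x)) (cell edge (p y)) → class (proj₂ x) ≡ class (proj₂ y)) → EdgeOrbital M k
  orbital separate = edge-class ,
    (λ c → let x = 0̂ , representative c in cell edge (p x) ,
       trans (class-edge (pre (cell edge (p x))) x (pre-cell _)) (class-rep c)) ,
    (λ e e′ → mk⇔ (same-class e e′) λ so →
       separate (pre e) (pre e′) (subst₂ (SameOrbit M) (sym (pre-cell e)) (sym (pre-cell e′)) so))

-- The walk at class 0 is the one that gets transported, hence read directly; its image at an edge
-- of class 1 may be mirrored, so the displacement there is controlled in both orientations.
record Separation {𝒯 : Tiling} (𝒞 : EdgeClasses 𝒯 2) : Set where
  open Tiling 𝒯
  open EdgeClasses 𝒞
  open PlaneReversal 𝒯 using (walk)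
  field
    word      : List Dim
    word-kind : ∀ s j → proj₂ (walk s word (0̂ , j)) ≡ j
    along-0   : ∀ j → class j ≡ zero → proj₂ (proj₁ (walk direct word (0̂ , j))) ≡ 0ℤ
    across-1  : ∀ s j → class j ≡ suc zero → ℤ.∣ proj₂ (proj₁ (walk s word (0̂ , j))) ∣ ≡ 1

-- On the torus ℤ² / (nℤ × 2nℤ) a walk along n times the word closes up exactly
-- when it is horizontal.
module Separated {𝒯 : Tiling} {𝒞 : EdgeClasses 𝒯 2} (𝒮 : Separation 𝒞)
  (K : Map) (𝒟 : Development 𝒯 (Map.embedding K)) (n : ℕ) {{n≢0 : NonZero n}} {{2n≢0 : NonZero (2 * n)}}
  (periodic : ∀ u → Torus.Lattice 𝒯 n (2 * n) u → DevelopmentProperties.Period 𝒟 u) where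
  open Separation 𝒮
  open EdgeClasses 𝒞
  open TorusCover 𝒯 K 𝒟 n (2 * n) periodic
  private
    module T = TilingProperties 𝒯
    module D = DevelopmentProperties 𝒳.development
    module R = DevelopmentReversal 𝒳.development
  open PlaneReversal 𝒯 using (walk; walk-fold)
  open Cells 𝒳.embedding using (cell)
  open EdgeDarts 𝒳.embedding using (edge-darts)
  open Reversal 𝒳.embedding using (turnˢ)
  open Rigidity map R.face-moves R.face-moves² using (closed-walk-transfer)

  private
    disp : Orientation → Fin T.q → ℤ²
    disp s j = proj₁ (walk s word (0̂ , j))

    closed-horizontal : ∀ t j → class j ≡ zero → 𝒳.encode (fold (t , j) (walk direct word) n) ≡ 𝒳.encode (t , j)
    closed-horizontal t j horizontal = trans (cong 𝒳.encode (walk-fold direct word (word-kind direct j) t n))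
      (𝒳.encode-shift (divides (proj₁ (disp direct j)) (ℤ.*-comm (+ n) _) ,
                       divides 0ℤ (trans (cong (+ n ℤ.*_) (along-0 j horizontal)) (ℤ.*-zeroʳ (+ n)))) (t , j))

    open-across : ∀ s t j → class j ≡ suc zero → 𝒳.encode (fold (t , j) (walk s word) n) ≢ 𝒳.encode (t , j)
    -- The vertical displacement of the whole walk is `n` in absolute value, which `2 * n` does not
    -- divide.
    open-across s t j across closed = >⇒∤ (ℕ.m<m+n n (ℕ.<-≤-trans (>-nonZero⁻¹ n) (ℕ.m≤m+n n 0)))
      (subst (2 * n ∣_) (trans (ℤ.abs-* (+ n) (proj₂ (disp s j)))
        (trans (cong (n *_) (across-1 s j across)) (ℕ.*-identityʳ n))) (∣⇒∣ᵤ divisible))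
      where
      divisible : + (2 * n) ∣ℤ (+ n ℤ.* proj₂ (disp s j))
      divisible = proj₂ (𝒳.period⇒lattice v (subst D.Period (cong₂ _,_ (cancel (proj₁ v) (proj₁ t)) (cancel (proj₂ v) (proj₂ t)))
        (D.kernel (v ⊕ t) t j (trans (sym (cong 𝒳.encode (walk-fold s word (word-kind s j) t n))) closed))))
        where
        v : ℤ²
        v = + n · disp s j
        cancel : ∀ x t → x ℤ.+ t ℤ.- t ≡ x
        cancel = solve-∀

    same-edge-class : ∀ x y → cell edge (𝒳.encode x) ≡ cell edge (𝒳.encode y) → class (proj₂ x) ≡ class (proj₂ y)
    same-edge-class x y eq = [ (λ same → cong class (𝒳.encode-kind x y same)) ,
      (λ turned → trans (cong class (𝒳.encode-kind x (T.turn edge y) (trans turned (sym (𝒳.encode-turn edge y)))))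
                        (class-reverse (proj₂ y))) ]′
      (edge-darts (𝒳.encode y) (𝒳.encode x) (sym eq))

    crossing : ∀ x s d → cell edge d ≡ cell edge (𝒳.encode x) → class (proj₂ x) ≡ suc zero →
               fold d (along (turnˢ s) word) n ≢ d
    crossing x s d eq across closed = open-across s (proj₁ y) (proj₂ y)
      (trans (same-edge-class y x (trans (cong (cell edge) y≡d) eq)) across)
      (trans (R.p-walks s word n y) (trans (cong (λ d → fold d (along (turnˢ s) word) n) y≡d) (trans closed (sym y≡d))))
      where
      y : T.Plane
      y = 𝒳.decode d
      y≡d : 𝒳.encode y ≡ d
      y≡d = 𝒳.encode-decode d

    not-mixed : ∀ x y → SameOrbit map (cell edge (𝒳.encode x)) (cell edge (𝒳.encode y)) →
                class (proj₂ x) ≡ zero → class (proj₂ y) ≢ suc zero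
    not-mixed x y so horizontal across =
      let s , d , de , closed = closed-walk-transfer word n so
            (trans (sym (R.p-walks direct word n x)) (closed-horizontal (proj₁ x) (proj₂ x) horizontal))
      in crossing y s d de across closed

    decide : (c c′ : Fin 2) → (c ≡ zero → c′ ≢ suc zero) → (c′ ≡ zero → c ≢ suc zero) → c ≡ c′
    decide zero       zero       _ _ = refl
    decide zero       (suc zero) f _ = contradiction refl (f refl)
    decide (suc zero) zero       _ g = contradiction refl (g refl)
    decide (suc zero) (suc zero) _ _ = refl

  separate : ∀ x y → SameOrbit map (cell edge (𝒳.encode x)) (cell edge (𝒳.encode y)) → class (proj₂ x) ≡ class (proj₂ y)
  separate x y so = decide _ _ (not-mixed x y so) (not-mixed y x (Orbits.SameOrbit-sym map so))

-- The translations of a map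

module ℤ²Orbit {D : Set} (X X⁻ Y Y⁻ : D → D)
  (XX⁻ : ∀ d → X (X⁻ d) ≡ d) (X⁻X : ∀ d → X⁻ (X d) ≡ d) (YY⁻ : ∀ d → Y (Y⁻ d) ≡ d)
  (XY : ∀ d → X (Y d) ≡ Y (X d)) (d₀ : D) where

  private
    power : (f f⁻ : D → D) → ℤ → D → D
    power f f⁻ (+ n)    d = fold d f n
    power f f⁻ -[1+ n ] d = fold d f⁻ (suc n)

    power-suc : ∀ {f f⁻} → (∀ d → f (f⁻ d) ≡ d) → ∀ z d → power f f⁻ (1ℤ ℤ.+ z) d ≡ f (power f f⁻ z d)
    power-suc ff⁻ (+ n)        d = refl
    power-suc ff⁻ -[1+ zero ]  d = sym (ff⁻ d)
    power-suc ff⁻ -[1+ suc n ] d = sym (ff⁻ _)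

    X⁻Y : ∀ d → Y (X⁻ d) ≡ X⁻ (Y d)
    X⁻Y d = trans (sym (X⁻X _)) (cong X⁻ (trans (XY _) (cong Y (XX⁻ d))))

    Y-power : ∀ z d → Y (power X X⁻ z d) ≡ power X X⁻ z (Y d)
    Y-power (+ n)    d = fold-hom Y (λ d → sym (XY d)) d n
    Y-power -[1+ n ] d = fold-hom {f = X⁻} {g = X⁻} Y X⁻Y d (suc n)

  orbit : ℤ² → D
  orbit (a , b) = power X X⁻ a (power Y Y⁻ b d₀)

  orbit-X : ∀ t → orbit (t ⊕ (1ℤ , 0ℤ)) ≡ X (orbit t)
  orbit-X (a , b) = trans (cong orbit (cong₂ _,_ (ℤ.+-comm a 1ℤ) (ℤ.+-identityʳ b))) (power-suc XX⁻ a _)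

  orbit-Y : ∀ t → orbit (t ⊕ (0ℤ , 1ℤ)) ≡ Y (orbit t)
  orbit-Y (a , b) = trans (cong orbit (cong₂ _,_ (ℤ.+-identityʳ a) (ℤ.+-comm b 1ℤ)))
    (trans (cong (power X X⁻ a) (power-suc YY⁻ b d₀)) (sym (Y-power a _)))

-- `U` moves a dart by a vector that depends on its kind. Applied to a coincidence of darts of kinds
-- `i` and `j`, it therefore moves the two positions along different vectors.
module Slide {D : Set} {n : ℕ} (p : ℤ² × Fin n → D) (u : Fin n → ℤ²) (U U⁻ : D → D)
  (U⁻U : ∀ d → U⁻ (U d) ≡ d) (p-U : ∀ t j → p (t ⊕ u j , j) ≡ U (p (t , j))) where

  slide : ∀ {t t′ i j} → p (t , i) ≡ p (t′ , j) → ∀ k → p (t ⊕ k · u i , i) ≡ p (t′ ⊕ k · u j , j)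
  slide {t} {t′} {i} {j} eq = ℤ-induction _
    (trans (cong (λ t → p (t , i)) (⊕-identityʳ t)) (trans eq (cong (λ t → p (t , j)) (sym (⊕-identityʳ t′)))))
    (λ k eq → trans (more t k) (trans (cong U eq) (sym (more t′ k))))
    (λ k eq → trans (sym (U⁻U _)) (trans (cong U⁻ (trans (sym (more t k)) (trans eq (more t′ k)))) (U⁻U _)))
    where
    more : ∀ t k {j} → p (t ⊕ (1ℤ ℤ.+ k) · u j , j) ≡ U (p (t ⊕ k · u j , j))
    more t k {j} = trans (cong (λ t → p (t , j)) (cong₂ _,_ (regroup (proj₁ t) k _) (regroup (proj₂ t) k _))) (p-U _ j)
      where
      regroup : ∀ t k u → t ℤ.+ (1ℤ ℤ.+ k) ℤ.* u ≡ (t ℤ.+ k ℤ.* u) ℤ.+ u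
      regroup = solve-∀

division : ∀ z m .{{_ : NonZero m}} → ∃₂ λ r q → r < m × z ≡ + r ℤ.+ q ℤ.* + m
division z m = z ℤ.%ℕ m , z ℤ./ℕ m , ℤ.n%ℕd<d z m , ℤ.a≡a%ℕn+[a/ℕn]*n z m

difference-eq : ∀ a c z → c ℤ.- a ≡ z → c ≡ z ℤ.+ a
difference-eq a c z eq = trans (restore a c) (cong (ℤ._+ a) eq)
  where
  restore : ∀ a c → c ≡ (c ℤ.- a) ℤ.+ a
  restore = solve-∀

-- The orientation-preserving symmetries of the regular tiling {3,6}: R turns
-- about a vertex, Q about a face and R ∘ Q about an edge.
record HexAction (D : Set) : Set where
  field
    R Q     : D → D
    R⁶      : ∀ d → R (R (R (R (R (R d))))) ≡ d
    Q³      : ∀ d → Q (Q (Q d)) ≡ d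
    RQ²     : ∀ d → R (Q (R (Q d))) ≡ d
    R²-free : ∀ d → R (R d) ≢ d
    R³-free : ∀ d → R (R (R d)) ≢ d
    Q-free  : ∀ d → Q d ≢ d
    RQ-free : ∀ d → R (Q d) ≢ d

next₆ : Fin 6 → Fin 6
next₆ 0F = 1F
next₆ 1F = 2F
next₆ 2F = 3F
next₆ 3F = 4F
next₆ 4F = 5F
next₆ 5F = 0F

-- The six shortest vectors of the triangular lattice, in a basis of two of
-- them at an angle of 120°.
e₆ : Fin 6 → ℤ²
e₆ 0F = 1ℤ , 0ℤ
e₆ 1F = 1ℤ , 1ℤ
e₆ 2F = 0ℤ , 1ℤ
e₆ 3F = -1ℤ , 0ℤ
e₆ 4F = -1ℤ , -1ℤ
e₆ 5F = 0ℤ , -1ℤ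

module HexTranslations {D : Set} (𝒜 : HexAction D) where
  open HexAction 𝒜

  private
    -- This and the next two rewrite a product with two factors `Q` into one with fewer. They follow
    -- from the presentation by R⁶, Q³ and (RQ)², with powers in place of inverses.
    QRQ : ∀ d → Q (R (Q d)) ≡ R (R (R (R (R d))))
    QRQ d = trans (sym (R⁶ _)) (cong (R ∘ R ∘ R ∘ R ∘ R) (RQ² d))

    QQ : ∀ d → Q (Q d) ≡ R (Q (R d))
    QQ d = trans (sym (RQ² _)) (cong (R ∘ Q ∘ R) (Q³ d))

    QRRQ : ∀ d → Q (R (R (Q d))) ≡ R (R (R (R (R (Q (R (R (R (R (R d))))))))))
    QRRQ d = sym (begin
      (R ∘ R ∘ R ∘ R ∘ R) (Q d′)                        ≡⟨ cong (R ∘ R ∘ R ∘ R ∘ R ∘ Q) (Q³ d′) ⟨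
      (R ∘ R ∘ R ∘ R ∘ R) (Q (Q (Q (Q d′))))            ≡⟨ cong (R ∘ R ∘ R ∘ R ∘ R) (QQ _) ⟩
      (R ∘ R ∘ R ∘ R ∘ R ∘ R) (Q (R (Q (Q d′))))        ≡⟨ R⁶ _ ⟩
      Q (R (Q (Q d′)))                                  ≡⟨ cong (Q ∘ R) (QQ d′) ⟩
      Q (R (R (Q (R d′))))                              ≡⟨ cong (Q ∘ R ∘ R ∘ Q) (R⁶ d) ⟩
      Q (R (R (Q d)))                                   ∎)
      where
      open ≡-Reasoning
      d′ : D
      d′ = R (R (R (R (R d))))

  -- E j translates by e₆ j the darts of kind 0.
  E : Fin 6 → D → D
  E 0F d = R (R (R (R (Q d))))
  E 1F d = R (R (R (Q (R d))))
  E 2F d = R (R (Q (R (R d))))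
  E 3F d = R (Q (R (R (R d))))
  E 4F d = Q (R (R (R (R d))))
  E 5F d = R (R (R (R (R (Q (R (R (R (R (R d))))))))))

  E₀E₃ : ∀ d → E 0F (E 3F d) ≡ d
  E₀E₃ d = trans (cong (R ∘ R ∘ R ∘ R) (QRQ _)) (trans (R⁶ _) (R⁶ d))

  E₃E₀ : ∀ d → E 3F (E 0F d) ≡ d
  E₃E₀ d = trans (cong (R ∘ Q ∘ R) (R⁶ _)) (RQ² d)

  E₂E₅ : ∀ d → E 2F (E 5F d) ≡ d
  E₂E₅ d = trans (cong (R ∘ R ∘ Q ∘ R) (R⁶ _)) (trans (cong (R ∘ R) (QRQ _)) (trans (R⁶ _) (R⁶ d)))

  E₅E₂ : ∀ d → E 5F (E 2F d) ≡ d
  E₅E₂ d = trans (cong (R ∘ R ∘ R ∘ R ∘ R ∘ Q ∘ R) (R⁶ _)) (trans (cong (R ∘ R ∘ R ∘ R ∘ R) (QRQ _)) (trans (R⁶ _) (R⁶ d)))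

  E₄E₁ : ∀ d → E 4F (E 1F d) ≡ d
  E₄E₁ d = trans (cong (Q ∘ R) (R⁶ _)) (trans (QRQ _) (R⁶ d))

  E₀E₂ : ∀ d → E 0F (E 2F d) ≡ E 1F d
  E₀E₂ d = trans (cong (R ∘ R ∘ R ∘ R) (QRRQ _)) (trans (R⁶ _) (cong (R ∘ R ∘ R ∘ Q ∘ R) (R⁶ d)))

  E₂E₀ : ∀ d → E 2F (E 0F d) ≡ E 1F d
  E₂E₀ d = trans (cong (R ∘ R ∘ Q) (R⁶ _)) (cong (R ∘ R) (QQ d))

module HexDevelopment {D : Set} (𝒜 : HexAction D) (d₀ : D) where
  open HexAction 𝒜
  open HexTranslations 𝒜

  private
    open ℤ²Orbit (E 0F) (E 3F) (E 2F) (E 5F) E₀E₃ E₃E₀ E₂E₅ (λ d → trans (E₀E₂ d) (sym (E₂E₀ d))) d₀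

    ⊕-back : ∀ t u v → v ⊕ u ≡ 0̂ → t ≡ t ⊕ v ⊕ u
    ⊕-back t u v eq = sym (trans (⊕-assoc t v u) (trans (cong (t ⊕_) eq) (⊕-identityʳ t)))

    E-orbit : ∀ j t → orbit (t ⊕ e₆ j) ≡ E j (orbit t)
    E-orbit 0F t = orbit-X t
    E-orbit 1F t = trans (cong orbit (sym (⊕-assoc t (e₆ 2F) (e₆ 0F))))
      (trans (orbit-X (t ⊕ e₆ 2F)) (trans (cong (E 0F) (orbit-Y t)) (E₀E₂ (orbit t))))
    E-orbit 2F t = orbit-Y t
    E-orbit 3F t = trans (sym (E₃E₀ _)) (cong (E 3F)
      (trans (sym (E-orbit 0F (t ⊕ e₆ 3F))) (cong orbit (sym (⊕-back t (e₆ 0F) (e₆ 3F) refl)))))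
    E-orbit 4F t = trans (sym (E₄E₁ _)) (cong (E 4F)
      (trans (sym (E-orbit 1F (t ⊕ e₆ 4F))) (cong orbit (sym (⊕-back t (e₆ 1F) (e₆ 4F) refl)))))
    E-orbit 5F t = trans (sym (E₅E₂ _)) (cong (E 5F)
      (trans (sym (E-orbit 2F (t ⊕ e₆ 5F))) (cong orbit (sym (⊕-back t (e₆ 2F) (e₆ 5F) refl)))))

  abstract
    p : ℤ² × Fin 6 → D
    p (t , j) = fold (orbit t) R (toℕ j)

    p-R : ∀ t j → p (t , next₆ j) ≡ R (p (t , j))
    p-R t 0F = refl
    p-R t 1F = refl
    p-R t 2F = refl
    p-R t 3F = refl
    p-R t 4F = refl
    p-R t 5F = sym (R⁶ (orbit t))

    -- `E j` is `Q` preceded by `j` and followed by 4 - j turns `R`, modulo 6. Hence `Q` after `j`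
    -- turns equals `E j` followed by j + 2 turns.
    p-Q : ∀ t j → p (t ⊕ e₆ j , next₆ (next₆ j)) ≡ Q (p (t , j))
    p-Q t 0F = trans (cong (R ∘ R) (E-orbit 0F t)) (R⁶ _)
    p-Q t 1F = trans (cong (R ∘ R ∘ R) (E-orbit 1F t)) (R⁶ _)
    p-Q t 2F = trans (cong (R ∘ R ∘ R ∘ R) (E-orbit 2F t)) (R⁶ _)
    p-Q t 3F = trans (cong (R ∘ R ∘ R ∘ R ∘ R) (E-orbit 3F t)) (R⁶ _)
    p-Q t 4F = E-orbit 4F t
    p-Q t 5F = trans (cong R (E-orbit 5F t)) (R⁶ _)

module HexKernel {D : Set} (𝒜 : HexAction D) (p : ℤ² × Fin 6 → D)
  (p-R : ∀ t j → p (t , next₆ j) ≡ HexAction.R 𝒜 (p (t , j)))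
  (p-Q : ∀ t j → p (t ⊕ e₆ j , next₆ (next₆ j)) ≡ HexAction.Q 𝒜 (p (t , j))) where
  open HexAction 𝒜
  open HexTranslations 𝒜

  private
    next⁶ : ∀ j → next₆ (next₆ (next₆ (next₆ (next₆ (next₆ j))))) ≡ j
    next⁶ = from-yes (Fin.all? λ j → next₆ (next₆ (next₆ (next₆ (next₆ (next₆ j))))) ≟ j)

    p-R² : ∀ t j → p (t , next₆ (next₆ j)) ≡ R (R (p (t , j)))
    p-R² t j = trans (p-R t _) (cong R (p-R t j))

    p-R⁴ : ∀ t j → p (t , next₆ (next₆ (next₆ (next₆ j)))) ≡ R (R (R (R (p (t , j)))))
    p-R⁴ t j = trans (p-R² t _) (cong (R ∘ R) (p-R² t j))

    p-RQ : ∀ t j → p (t ⊕ e₆ j , next₆ (next₆ (next₆ j))) ≡ R (Q (p (t , j)))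
    p-RQ t j = trans (p-R (t ⊕ e₆ j) _) (cong R (p-Q t j))

    p-E₀ : ∀ t j → p (t ⊕ e₆ j , j) ≡ E 0F (p (t , j))
    p-E₀ t j = trans (cong (λ k → p (t ⊕ e₆ j , k)) (sym (next⁶ j)))
      (trans (p-R⁴ (t ⊕ e₆ j) _) (cong (R ∘ R ∘ R ∘ R) (p-Q t j)))

    p-E₂ : ∀ t j → p (t ⊕ e₆ (next₆ (next₆ j)) , j) ≡ E 2F (p (t , j))
    p-E₂ t j = trans (cong (λ k → p (t ⊕ e₆ (next₆ (next₆ j)) , k)) (sym (next⁶ j)))
      (trans (p-R² (t ⊕ e₆ (next₆ (next₆ j))) _) (cong (R ∘ R) (trans (p-Q t (next₆ (next₆ j))) (cong Q (p-R² t j)))))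

    module S₀ = Slide p e₆ (E 0F) (E 3F) E₃E₀ p-E₀
    module S₂ = Slide p (e₆ ∘ next₆ ∘ next₆) (E 2F) (E 5F) E₅E₂ p-E₂

    -- A coincidence p (t , 0F) ≡ p (t′ , j) is a rotation with a fixed point:
    -- its centre can be slid to a vertex, an edge or a face at a dart p (c , 0F).
    centre : ∀ {t t′ j} → p (t , 0F) ≡ p (t′ , j) → ∀ x y w →
             t ⊕ (x , y) ⊕ w ≡ t′ ⊕ x · e₆ j ⊕ y · e₆ (next₆ (next₆ j)) →
             ∃ λ c → p (c , 0F) ≡ p (c ⊕ w , j)
    centre {t} {t′} {j} eq x y w w≡ = c , trans (cong (λ c → p (c , 0F)) c≡)
      (trans (S₂.slide (S₀.slide eq x) y) (cong (λ c → p (c , j)) (sym w≡)))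
      where
      c : ℤ²
      c = t ⊕ (x , y)
      c≡ : c ≡ t ⊕ x · e₆ 0F ⊕ y · e₆ 2F
      c≡ = cong₂ _,_ (eq₁ (proj₁ t) x y) (eq₂ (proj₂ t) x y)
        where
        eq₁ : ∀ t x y → t ℤ.+ x ≡ t ℤ.+ x ℤ.* 1ℤ ℤ.+ y ℤ.* 0ℤ
        eq₁ = solve-∀
        eq₂ : ∀ t x y → t ℤ.+ y ≡ t ℤ.+ x ℤ.* 0ℤ ℤ.+ y ℤ.* 1ℤ
        eq₂ = solve-∀

    fixed-R : ∀ {c} → p (c , 0F) ≢ p (c ⊕ 0̂ , 1F)
    fixed-R {c} eq = R²-free _ (trans (cong R (sym fixed)) (sym fixed))
      where
      fixed : p (c , 0F) ≡ R (p (c , 0F))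
      fixed = trans eq (trans (cong (λ c → p (c , 1F)) (⊕-identityʳ c)) (p-R c 0F))

    fixed-R² : ∀ {c} → p (c , 0F) ≢ p (c ⊕ 0̂ , 2F)
    fixed-R² {c} eq = R²-free _ (sym (trans eq (trans (cong (λ c → p (c , 2F)) (⊕-identityʳ c)) (p-R² c 0F))))

    fixed-R³ : ∀ {c} → p (c , 0F) ≢ p (c ⊕ 0̂ , 3F)
    fixed-R³ {c} eq = R³-free _ (sym (trans eq (trans (cong (λ c → p (c , 3F)) (⊕-identityʳ c))
      (trans (p-R c 2F) (cong R (p-R² c 0F))))))

    turn-R : ∀ {c c′ i j} → p (c , i) ≡ p (c′ , j) → p (c , next₆ i) ≡ p (c′ , next₆ j)
    turn-R eq = trans (p-R _ _) (trans (cong R eq) (sym (p-R _ _)))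

    fixed-Q : ∀ j {c} → p (c , j) ≢ p (c ⊕ e₆ j , next₆ (next₆ j))
    fixed-Q j {c} eq = Q-free _ (sym (trans eq (p-Q c j)))

    fixed-RQ : ∀ j {c} → p (c , j) ≢ p (c ⊕ e₆ j , next₆ (next₆ (next₆ j)))
    fixed-RQ j {c} eq = RQ-free _ (sym (trans eq (p-RQ c j)))

    -- For the rotation ρ by 60° the map 1 - ρ is invertible over the integers, so the centre is
    -- always a vertex.
    p-0≢1 : ∀ t t′ → p (t , 0F) ≢ p (t′ , 1F)
    p-0≢1 (a , b) (c , d) eq = fixed-R (proj₂ (centre eq ((c ℤ.- a) ℤ.- (d ℤ.- b)) (c ℤ.- a) 0̂
      (cong₂ _,_ (eq₁ a b c d) (eq₂ a b c d))))
      where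
      eq₁ : ∀ a b c d → a ℤ.+ ((c ℤ.- a) ℤ.- (d ℤ.- b)) ℤ.+ 0ℤ ≡
            c ℤ.+ ((c ℤ.- a) ℤ.- (d ℤ.- b)) ℤ.* 1ℤ ℤ.+ (c ℤ.- a) ℤ.* -1ℤ
      eq₁ = solve-∀
      eq₂ : ∀ a b c d → b ℤ.+ (c ℤ.- a) ℤ.+ 0ℤ ≡
            d ℤ.+ ((c ℤ.- a) ℤ.- (d ℤ.- b)) ℤ.* 1ℤ ℤ.+ (c ℤ.- a) ℤ.* 0ℤ
      eq₂ = solve-∀

    -- For 120° the map 1 - ρ has determinant 3, and the sum of the coordinates modulo 3 tells the
    -- cosets of its image apart: the centre is a vertex or a face of one of the two kinds.
    p-0≢2 : ∀ t t′ → p (t , 0F) ≢ p (t′ , 2F)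
    p-0≢2 (a , b) (c , d) eq with division (d ℤ.- b ℤ.+ (c ℤ.- a)) 3
    ... | r , y , r<3 , sum = by-residue r r<3 sum
      where
      at : ∀ w₁ w₂ → d ℤ.- b ℤ.+ (c ℤ.- a) ≡ (w₁ ℤ.+ w₂) ℤ.+ y ℤ.* + 3 → ∃ λ c → p (c , 0F) ≡ p (c ⊕ (w₁ , w₂) , 2F)
      at w₁ w₂ sum = centre eq ((c ℤ.- a) ℤ.- y ℤ.- w₁) y (w₁ , w₂) (cong₂ _,_ (eq₁ a c y w₁)
        (trans (eq₂ a b c y w₁ w₂) (cong (λ d → d ℤ.+ ((c ℤ.- a) ℤ.- y ℤ.- w₁) ℤ.* 1ℤ ℤ.+ y ℤ.* -1ℤ) (sym d≡))))
        where
        d≡ : d ≡ ((w₁ ℤ.+ w₂) ℤ.+ y ℤ.* + 3 ℤ.- (c ℤ.- a)) ℤ.+ b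
        d≡ = difference-eq b d _ (trans (cancel (d ℤ.- b) (c ℤ.- a)) (cong (ℤ._- (c ℤ.- a)) sum))
          where
          cancel : ∀ x y → x ≡ x ℤ.+ y ℤ.- y
          cancel = solve-∀
        eq₁ : ∀ a c y w → a ℤ.+ ((c ℤ.- a) ℤ.- y ℤ.- w) ℤ.+ w ≡ c ℤ.+ ((c ℤ.- a) ℤ.- y ℤ.- w) ℤ.* 0ℤ ℤ.+ y ℤ.* -1ℤ
        eq₁ = solve-∀
        eq₂ : ∀ a b c y w₁ w₂ → b ℤ.+ y ℤ.+ w₂ ≡
              (((w₁ ℤ.+ w₂) ℤ.+ y ℤ.* + 3 ℤ.- (c ℤ.- a)) ℤ.+ b) ℤ.+ ((c ℤ.- a) ℤ.- y ℤ.- w₁) ℤ.* 1ℤ ℤ.+ y ℤ.* -1ℤ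
        eq₂ = solve-∀
      by-residue : ∀ r → r < 3 → d ℤ.- b ℤ.+ (c ℤ.- a) ≡ + r ℤ.+ y ℤ.* + 3 → ⊥
      by-residue 0 _ sum = fixed-R² (proj₂ (at 0ℤ 0ℤ sum))
      by-residue 1 _ sum = fixed-Q 0F (proj₂ (at 1ℤ 0ℤ sum))
      by-residue 2 _ sum = fixed-Q 1F (turn-R (proj₂ (at 1ℤ 1ℤ sum)))
      by-residue (suc (suc (suc _))) (s≤s (s≤s (s≤s ())))

    -- For the half-turn 1 - ρ is multiplication by 2. Of its four cosets one gives a vertex as
    -- centre, the others the edges of the three directions.
    p-0≢3 : ∀ t t′ → p (t , 0F) ≢ p (t′ , 3F)
    p-0≢3 (a , b) (c , d) eq with division (c ℤ.- a) 2 | division (d ℤ.- b) 2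
    ... | r , x , r<2 , c-a | r′ , y , r′<2 , d-b = by-residue r r′ r<2 r′<2 c-a d-b
      where
      at : ∀ w₁ w₂ → c ℤ.- a ≡ w₁ ℤ.+ x ℤ.* + 2 → d ℤ.- b ≡ w₂ ℤ.+ y ℤ.* + 2 → ∃ λ c → p (c , 0F) ≡ p (c ⊕ (w₁ , w₂) , 3F)
      at w₁ w₂ c-a d-b = centre eq x y (w₁ , w₂) (cong₂ _,_
        (trans (eq₁ a x y w₁) (cong (λ c → c ℤ.+ x ℤ.* -1ℤ ℤ.+ y ℤ.* 0ℤ) (sym (difference-eq a c _ c-a))))
        (trans (eq₂ b x y w₂) (cong (λ d → d ℤ.+ x ℤ.* 0ℤ ℤ.+ y ℤ.* -1ℤ) (sym (difference-eq b d _ d-b)))))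
        where
        eq₁ : ∀ a x y w → a ℤ.+ x ℤ.+ w ≡ ((w ℤ.+ x ℤ.* + 2) ℤ.+ a) ℤ.+ x ℤ.* -1ℤ ℤ.+ y ℤ.* 0ℤ
        eq₁ = solve-∀
        eq₂ : ∀ b x y w → b ℤ.+ y ℤ.+ w ≡ ((w ℤ.+ y ℤ.* + 2) ℤ.+ b) ℤ.+ x ℤ.* 0ℤ ℤ.+ y ℤ.* -1ℤ
        eq₂ = solve-∀
      by-residue : ∀ r r′ → r < 2 → r′ < 2 → c ℤ.- a ≡ + r ℤ.+ x ℤ.* + 2 → d ℤ.- b ≡ + r′ ℤ.+ y ℤ.* + 2 → ⊥
      by-residue 0 0 _ _ c-a d-b = fixed-R³ (proj₂ (at 0ℤ 0ℤ c-a d-b))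
      by-residue 1 0 _ _ c-a d-b = fixed-RQ 0F (proj₂ (at 1ℤ 0ℤ c-a d-b))
      by-residue 1 1 _ _ c-a d-b = fixed-RQ 1F (turn-R (proj₂ (at 1ℤ 1ℤ c-a d-b)))
      by-residue 0 1 _ _ c-a d-b = fixed-RQ 2F (turn-R (turn-R (proj₂ (at 0ℤ 1ℤ c-a d-b))))
      by-residue (suc (suc _)) _ (s≤s (s≤s ()))
      by-residue _ (suc (suc _)) _ (s≤s (s≤s ()))

    p-0 : ∀ t t′ j → p (t , 0F) ≡ p (t′ , j) → j ≡ 0F
    p-0 t t′ 0F eq = refl
    p-0 t t′ 1F eq = contradiction eq (p-0≢1 t t′)
    p-0 t t′ 2F eq = contradiction eq (p-0≢2 t t′)
    p-0 t t′ 3F eq = contradiction eq (p-0≢3 t t′)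
    -- Turning on until `j` becomes 0 and reading the coincidence backwards replaces the rotation by
    -- its inverse.
    p-0 t t′ 4F eq = contradiction (sym (turn-R (turn-R eq))) (p-0≢2 t′ t)
    p-0 t t′ 5F eq = contradiction (sym (turn-R eq)) (p-0≢1 t′ t)

    turn-Rs : ∀ k {c c′ i j} → p (c , i) ≡ p (c′ , j) → p (c , fold i next₆ k) ≡ p (c′ , fold j next₆ k)
    turn-Rs zero    eq = eq
    turn-Rs (suc k) eq = turn-R (turn-Rs k eq)

  p-kind : ∀ x y → p x ≡ p y → proj₂ x ≡ proj₂ y
  p-kind (t , i) (t′ , j) eq = rotate-back i j (p-0 t t′ (fold j next₆ k)
    (trans (cong (λ k → p (t , k)) (sym (to-0 i))) (turn-Rs k eq)))
    where
    k : ℕ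
    k = 6 ∸ toℕ i
    to-0 : ∀ i → fold i next₆ (6 ∸ toℕ i) ≡ 0F
    to-0 = from-yes (Fin.all? λ i → fold i next₆ (6 ∸ toℕ i) ≟ 0F)
    rotate-back : ∀ i j → fold j next₆ (6 ∸ toℕ i) ≡ 0F → i ≡ j
    rotate-back = from-yes (Fin.all? λ i → Fin.all? λ j → (fold j next₆ (6 ∸ toℕ i) ≟ 0F) →-dec (i ≟ j))

-- The orientation-preserving symmetries of the regular tiling {4,4}: R turns
-- about a vertex, Q about a face and R ∘ Q about an edge.
record SquareAction (D : Set) : Set where
  field
    R Q     : D → D
    R⁴      : ∀ d → R (R (R (R d))) ≡ d
    Q⁴      : ∀ d → Q (Q (Q (Q d))) ≡ d
    RQ²     : ∀ d → R (Q (R (Q d))) ≡ d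
    R²-free : ∀ d → R (R d) ≢ d
    Q²-free : ∀ d → Q (Q d) ≢ d
    RQ-free : ∀ d → R (Q d) ≢ d

next₄ : Fin 4 → Fin 4
next₄ 0F = 1F
next₄ 1F = 2F
next₄ 2F = 3F
next₄ 3F = 0F

e₄ : Fin 4 → ℤ²
e₄ 0F = 1ℤ , 0ℤ
e₄ 1F = 0ℤ , 1ℤ
e₄ 2F = -1ℤ , 0ℤ
e₄ 3F = 0ℤ , -1ℤ

module SquareTranslations {D : Set} (𝒜 : SquareAction D) where
  open SquareAction 𝒜

  private
    QRQ : ∀ d → Q (R (Q d)) ≡ R (R (R d))
    QRQ d = trans (sym (R⁴ _)) (cong (R ∘ R ∘ R) (RQ² d))

    RQR : ∀ d → R (Q (R d)) ≡ Q (Q (Q d))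
    RQR d = trans (cong (R ∘ Q ∘ R) (sym (Q⁴ d))) (RQ² _)

  -- E j translates by e₄ j the darts of kind 0.
  E : Fin 4 → D → D
  E 0F d = R (R (R (Q d)))
  E 1F d = R (R (Q (R d)))
  E 2F d = R (Q (R (R d)))
  E 3F d = Q (R (R (R d)))

  E₀E₂ : ∀ d → E 0F (E 2F d) ≡ d
  E₀E₂ d = trans (cong (R ∘ R ∘ R) (QRQ _)) (trans (R⁴ _) (R⁴ d))

  E₂E₀ : ∀ d → E 2F (E 0F d) ≡ d
  E₂E₀ d = trans (cong (R ∘ Q ∘ R) (R⁴ _)) (RQ² d)

  E₁E₃ : ∀ d → E 1F (E 3F d) ≡ d
  E₁E₃ d = trans (cong (R ∘ R) (QRQ _)) (trans (R⁴ _) (R⁴ d))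

  E₃E₁ : ∀ d → E 3F (E 1F d) ≡ d
  E₃E₁ d = trans (cong (Q ∘ R) (R⁴ _)) (trans (QRQ _) (R⁴ d))

  -- Both sides equal `R (R (Q (Q d)))`, a half-turn about a face followed by one about a vertex.
  E₀E₁ : ∀ d → E 0F (E 1F d) ≡ E 1F (E 0F d)
  E₀E₁ d = trans (cong (R ∘ R) (begin
    R (Q (R (R (Q (R d)))))   ≡⟨ RQR _ ⟩
    Q (Q (Q (R (Q (R d)))))   ≡⟨ cong (Q ∘ Q ∘ Q) (RQR d) ⟩
    Q (Q (Q (Q (Q (Q d)))))   ≡⟨ Q⁴ _ ⟩
    Q (Q d)                   ∎)) (cong (R ∘ R ∘ Q) (sym (R⁴ (Q d))))
    where open ≡-Reasoning

module SquareDevelopment {D : Set} (𝒜 : SquareAction D) (d₀ : D) where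
  open SquareAction 𝒜
  open SquareTranslations 𝒜

  private
    open ℤ²Orbit (E 0F) (E 2F) (E 1F) (E 3F) E₀E₂ E₂E₀ E₁E₃ E₀E₁ d₀

    ⊕-back : ∀ t u v → v ⊕ u ≡ 0̂ → t ≡ t ⊕ v ⊕ u
    ⊕-back t u v eq = sym (trans (⊕-assoc t v u) (trans (cong (t ⊕_) eq) (⊕-identityʳ t)))

    E-orbit : ∀ j t → orbit (t ⊕ e₄ j) ≡ E j (orbit t)
    E-orbit 0F t = orbit-X t
    E-orbit 1F t = orbit-Y t
    E-orbit 2F t = trans (sym (E₂E₀ _)) (cong (E 2F)
      (trans (sym (E-orbit 0F (t ⊕ e₄ 2F))) (cong orbit (sym (⊕-back t (e₄ 0F) (e₄ 2F) refl)))))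
    E-orbit 3F t = trans (sym (E₃E₁ _)) (cong (E 3F)
      (trans (sym (E-orbit 1F (t ⊕ e₄ 3F))) (cong orbit (sym (⊕-back t (e₄ 1F) (e₄ 3F) refl)))))

  abstract
    p : ℤ² × Fin 4 → D
    p (t , j) = fold (orbit t) R (toℕ j)

    p-R : ∀ t j → p (t , next₄ j) ≡ R (p (t , j))
    p-R t 0F = refl
    p-R t 1F = refl
    p-R t 2F = refl
    p-R t 3F = sym (R⁴ (orbit t))

    p-Q : ∀ t j → p (t ⊕ e₄ j , next₄ j) ≡ Q (p (t , j))
    p-Q t 0F = trans (cong R (E-orbit 0F t)) (R⁴ _)
    p-Q t 1F = trans (cong (R ∘ R) (E-orbit 1F t)) (R⁴ _)
    p-Q t 2F = trans (cong (R ∘ R ∘ R) (E-orbit 2F t)) (R⁴ _)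
    p-Q t 3F = E-orbit 3F t

module SquareKernel {D : Set} (𝒜 : SquareAction D) (p : ℤ² × Fin 4 → D)
  (p-R : ∀ t j → p (t , next₄ j) ≡ SquareAction.R 𝒜 (p (t , j)))
  (p-Q : ∀ t j → p (t ⊕ e₄ j , next₄ j) ≡ SquareAction.Q 𝒜 (p (t , j))) where
  open SquareAction 𝒜
  open SquareTranslations 𝒜

  private
    next⁴ : ∀ j → next₄ (next₄ (next₄ (next₄ j))) ≡ j
    next⁴ = from-yes (Fin.all? λ j → next₄ (next₄ (next₄ (next₄ j))) ≟ j)

    p-R² : ∀ t j → p (t , next₄ (next₄ j)) ≡ R (R (p (t , j)))
    p-R² t j = trans (p-R t _) (cong R (p-R t j))

    p-RQ : ∀ t j → p (t ⊕ e₄ j , next₄ (next₄ j)) ≡ R (Q (p (t , j)))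
    p-RQ t j = trans (p-R (t ⊕ e₄ j) _) (cong R (p-Q t j))

    p-E₀ : ∀ t j → p (t ⊕ e₄ j , j) ≡ E 0F (p (t , j))
    p-E₀ t j = trans (cong (λ k → p (t ⊕ e₄ j , k)) (sym (next⁴ j)))
      (trans (p-R² (t ⊕ e₄ j) _) (cong (R ∘ R) (p-RQ t j)))

    p-E₁ : ∀ t j → p (t ⊕ e₄ (next₄ j) , j) ≡ E 1F (p (t , j))
    p-E₁ t j = trans (cong (λ k → p (t ⊕ e₄ (next₄ j) , k)) (sym (next⁴ j)))
      (trans (p-R (t ⊕ e₄ (next₄ j)) _) (cong R (trans (p-RQ t (next₄ j)) (cong (R ∘ Q) (p-R t j)))))

    module S₀ = Slide p e₄ (E 0F) (E 2F) E₂E₀ p-E₀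
    module S₁ = Slide p (e₄ ∘ next₄) (E 1F) (E 3F) E₃E₁ p-E₁

    centre : ∀ {t t′ j} → p (t , 0F) ≡ p (t′ , j) → ∀ x y w →
             t ⊕ (x , y) ⊕ w ≡ t′ ⊕ x · e₄ j ⊕ y · e₄ (next₄ j) →
             ∃ λ c → p (c , 0F) ≡ p (c ⊕ w , j)
    centre {t} {t′} {j} eq x y w w≡ = c , trans (cong (λ c → p (c , 0F)) c≡)
      (trans (S₁.slide (S₀.slide eq x) y) (cong (λ c → p (c , j)) (sym w≡)))
      where
      c : ℤ²
      c = t ⊕ (x , y)
      c≡ : c ≡ t ⊕ x · e₄ 0F ⊕ y · e₄ 1F
      c≡ = cong₂ _,_ (eq₁ (proj₁ t) x y) (eq₂ (proj₂ t) x y)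
        where
        eq₁ : ∀ t x y → t ℤ.+ x ≡ t ℤ.+ x ℤ.* 1ℤ ℤ.+ y ℤ.* 0ℤ
        eq₁ = solve-∀
        eq₂ : ∀ t x y → t ℤ.+ y ≡ t ℤ.+ x ℤ.* 0ℤ ℤ.+ y ℤ.* 1ℤ
        eq₂ = solve-∀

    fixed-R : ∀ {c} → p (c , 0F) ≢ p (c ⊕ 0̂ , 1F)
    fixed-R {c} eq = R²-free _ (trans (cong R (sym fixed)) (sym fixed))
      where
      fixed : p (c , 0F) ≡ R (p (c , 0F))
      fixed = trans eq (trans (cong (λ c → p (c , 1F)) (⊕-identityʳ c)) (p-R c 0F))

    fixed-R² : ∀ {c} → p (c , 0F) ≢ p (c ⊕ 0̂ , 2F)
    fixed-R² {c} eq = R²-free _ (sym (trans eq (trans (cong (λ c → p (c , 2F)) (⊕-identityʳ c)) (p-R² c 0F))))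

    fixed-Q : ∀ {c} → p (c , 0F) ≢ p (c ⊕ e₄ 0F , 1F)
    fixed-Q {c} eq = Q²-free _ (trans (cong Q (sym fixed)) (sym fixed))
      where
      fixed : p (c , 0F) ≡ Q (p (c , 0F))
      fixed = trans eq (p-Q c 0F)

    fixed-Q² : ∀ {c} → p (c , 0F) ≢ p (c ⊕ (e₄ 0F ⊕ e₄ 1F) , 2F)
    fixed-Q² {c} eq = Q²-free _ (sym (trans eq (trans (cong (λ c → p (c , 2F)) (sym (⊕-assoc c (e₄ 0F) (e₄ 1F))))
      (trans (p-Q (c ⊕ e₄ 0F) 1F) (cong Q (p-Q c 0F))))))

    fixed-RQ : ∀ j {c} → p (c , j) ≢ p (c ⊕ e₄ j , next₄ (next₄ j))
    fixed-RQ j {c} eq = RQ-free _ (sym (trans eq (p-RQ c j)))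

    turn-R : ∀ {c c′ i j} → p (c , i) ≡ p (c′ , j) → p (c , next₄ i) ≡ p (c′ , next₄ j)
    turn-R eq = trans (p-R _ _) (trans (cong R eq) (sym (p-R _ _)))

    -- For the quarter-turn ρ the map 1 - ρ has determinant 2, and the parity of the sum of the
    -- coordinates decides between a vertex and a face as centre.
    p-0≢1 : ∀ t t′ → p (t , 0F) ≢ p (t′ , 1F)
    p-0≢1 (a , b) (c , d) eq with division (d ℤ.- b ℤ.+ (c ℤ.- a)) 2
    ... | r , y , r<2 , sum = by-residue r r<2 sum
      where
      at : ∀ w → d ℤ.- b ℤ.+ (c ℤ.- a) ≡ w ℤ.+ y ℤ.* + 2 → ∃ λ c → p (c , 0F) ≡ p (c ⊕ (w , 0ℤ) , 1F)
      at w sum = centre eq ((c ℤ.- a) ℤ.- y ℤ.- w) y (w , 0ℤ) (cong₂ _,_ (eq₁ a c y w)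
        (trans (eq₂ a b c y w) (cong (λ d → d ℤ.+ ((c ℤ.- a) ℤ.- y ℤ.- w) ℤ.* 1ℤ ℤ.+ y ℤ.* 0ℤ) (sym d≡))))
        where
        d≡ : d ≡ (w ℤ.+ y ℤ.* + 2 ℤ.- (c ℤ.- a)) ℤ.+ b
        d≡ = difference-eq b d _ (trans (cancel (d ℤ.- b) (c ℤ.- a)) (cong (ℤ._- (c ℤ.- a)) sum))
          where
          cancel : ∀ x y → x ≡ x ℤ.+ y ℤ.- y
          cancel = solve-∀
        eq₁ : ∀ a c y w → a ℤ.+ ((c ℤ.- a) ℤ.- y ℤ.- w) ℤ.+ w ≡ c ℤ.+ ((c ℤ.- a) ℤ.- y ℤ.- w) ℤ.* 0ℤ ℤ.+ y ℤ.* -1ℤ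
        eq₁ = solve-∀
        eq₂ : ∀ a b c y w → b ℤ.+ y ℤ.+ 0ℤ ≡
              ((w ℤ.+ y ℤ.* + 2 ℤ.- (c ℤ.- a)) ℤ.+ b) ℤ.+ ((c ℤ.- a) ℤ.- y ℤ.- w) ℤ.* 1ℤ ℤ.+ y ℤ.* 0ℤ
        eq₂ = solve-∀
      by-residue : ∀ r → r < 2 → d ℤ.- b ℤ.+ (c ℤ.- a) ≡ + r ℤ.+ y ℤ.* + 2 → ⊥
      by-residue 0 _ sum = fixed-R (proj₂ (at 0ℤ sum))
      by-residue 1 _ sum = fixed-Q (proj₂ (at 1ℤ sum))
      by-residue (suc (suc _)) (s≤s (s≤s ()))

    -- The four cosets of twice the lattice correspond to a vertex, the edges of the two directions
    -- and a face as centre of the half-turn.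
    p-0≢2 : ∀ t t′ → p (t , 0F) ≢ p (t′ , 2F)
    p-0≢2 (a , b) (c , d) eq with division (c ℤ.- a) 2 | division (d ℤ.- b) 2
    ... | r , x , r<2 , c-a | r′ , y , r′<2 , d-b = by-residue r r′ r<2 r′<2 c-a d-b
      where
      at : ∀ w₁ w₂ → c ℤ.- a ≡ w₁ ℤ.+ x ℤ.* + 2 → d ℤ.- b ≡ w₂ ℤ.+ y ℤ.* + 2 → ∃ λ c → p (c , 0F) ≡ p (c ⊕ (w₁ , w₂) , 2F)
      at w₁ w₂ c-a d-b = centre eq x y (w₁ , w₂) (cong₂ _,_
        (trans (eq₁ a x y w₁) (cong (λ c → c ℤ.+ x ℤ.* -1ℤ ℤ.+ y ℤ.* 0ℤ) (sym (difference-eq a c _ c-a))))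
        (trans (eq₂ b x y w₂) (cong (λ d → d ℤ.+ x ℤ.* 0ℤ ℤ.+ y ℤ.* -1ℤ) (sym (difference-eq b d _ d-b)))))
        where
        eq₁ : ∀ a x y w → a ℤ.+ x ℤ.+ w ≡ ((w ℤ.+ x ℤ.* + 2) ℤ.+ a) ℤ.+ x ℤ.* -1ℤ ℤ.+ y ℤ.* 0ℤ
        eq₁ = solve-∀
        eq₂ : ∀ b x y w → b ℤ.+ y ℤ.+ w ≡ ((w ℤ.+ y ℤ.* + 2) ℤ.+ b) ℤ.+ x ℤ.* 0ℤ ℤ.+ y ℤ.* -1ℤ
        eq₂ = solve-∀
      by-residue : ∀ r r′ → r < 2 → r′ < 2 → c ℤ.- a ≡ + r ℤ.+ x ℤ.* + 2 → d ℤ.- b ≡ + r′ ℤ.+ y ℤ.* + 2 → ⊥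
      by-residue 0 0 _ _ c-a d-b = fixed-R² (proj₂ (at 0ℤ 0ℤ c-a d-b))
      by-residue 1 0 _ _ c-a d-b = fixed-RQ 0F (proj₂ (at 1ℤ 0ℤ c-a d-b))
      by-residue 0 1 _ _ c-a d-b = fixed-RQ 1F (turn-R (proj₂ (at 0ℤ 1ℤ c-a d-b)))
      by-residue 1 1 _ _ c-a d-b = fixed-Q² (proj₂ (at 1ℤ 1ℤ c-a d-b))
      by-residue (suc (suc _)) _ (s≤s (s≤s ()))
      by-residue _ (suc (suc _)) _ (s≤s (s≤s ()))

    p-0 : ∀ t t′ j → p (t , 0F) ≡ p (t′ , j) → j ≡ 0F
    p-0 t t′ 0F eq = refl
    p-0 t t′ 1F eq = contradiction eq (p-0≢1 t t′)
    p-0 t t′ 2F eq = contradiction eq (p-0≢2 t t′)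
    p-0 t t′ 3F eq = contradiction (sym (turn-R eq)) (p-0≢1 t′ t)

    turn-Rs : ∀ k {c c′ i j} → p (c , i) ≡ p (c′ , j) → p (c , fold i next₄ k) ≡ p (c′ , fold j next₄ k)
    turn-Rs zero    eq = eq
    turn-Rs (suc k) eq = turn-R (turn-Rs k eq)

  p-kind : ∀ x y → p x ≡ p y → proj₂ x ≡ proj₂ y
  p-kind (t , i) (t′ , j) eq = rotate-back i j (p-0 t t′ (fold j next₄ k)
    (trans (cong (λ k → p (t , k)) (sym (to-0 i))) (turn-Rs k eq)))
    where
    k : ℕ
    k = 4 ∸ toℕ i
    to-0 : ∀ i → fold i next₄ (4 ∸ toℕ i) ≡ 0F
    to-0 = from-yes (Fin.all? λ i → fold i next₄ (4 ∸ toℕ i) ≟ 0F)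
    rotate-back : ∀ i j → fold j next₄ (4 ∸ toℕ i) ≡ 0F → i ≡ j
    rotate-back = from-yes (Fin.all? λ i → Fin.all? λ j → (fold j next₄ (4 ∸ toℕ i) ≟ 0F) →-dec (i ≟ j))

-- The four tilings

byDim : {A : Dim → Set} → A vertex → A edge → A face → ∀ i → A i
byDim v e f vertex = v
byDim v e f edge   = e
byDim v e f face   = f

allDim? : {P : Dim → Set} → (∀ i → Dec (P i)) → Dec (∀ i → P i)
allDim? P? with P? vertex | P? edge | P? face
... | yes v | yes e | yes f = yes (byDim v e f)
... | no ¬v | _     | _     = no λ all → ¬v (all vertex)
... | yes _ | no ¬e | _     = no λ all → ¬e (all edge)
... | yes _ | yes _ | no ¬f = no λ all → ¬f (all face)

infix 4 _≟ᵖ_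
_≟ᵖ_ : ∀ {q} (x y : ℤ² × Fin q) → Dec (x ≡ y)
_≟ᵖ_ = ≡-dec (≡-dec ℤ._≟_ ℤ._≟_) _≟_

-- The data of a tiling without its laws, which concern finitely many kinds over the origin and are
-- settled by evaluating `valid?`.
record TilingTables : Set where
  field
    q              : ℕ
    base           : Fin q
    rotate reverse : Step q q
    #types         : Dim → ℕ
    type           : ∀ i → Fin q → Fin (#types i)
    rep            : ∀ i → Fin (#types i) → Fin q
    dist           : Dim → Fin q → ℕ
    period         : ℕ
    toBase         : Fin q → List Dim
    east north     : List Dim

  turn : Dim → ℤ² × Fin q → ℤ² × Fin q
  turn = turnBy rotate reverse

  locate : ∀ i → ℤ² × Fin q → ℤ² × Fin (#types i)
  locate i (t , j) = proj₁ (fold (t , j) (turn i) (dist i j)) , type i j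

  valid? : Dec (
    ((∀ i j → fold (0̂ , j) (turn i) (suc period) ≡ (0̂ , j)) ×
     (∀ j → turn edge (turn edge (0̂ , j)) ≡ (0̂ , j)) ×
     (∀ j → proj₂ (reverse j) ≢ j) ×
     (∀ j → proj₂ (turn face (0̂ , j)) ≢ j) ×
     (∀ j → proj₂ (turn face (turn face (0̂ , j))) ≢ j)) ×
    ((∀ i j → dist i j ≤ suc period) ×
     (∀ i j → proj₂ (fold (0̂ , j) (turn i) (dist i j)) ≡ rep i (type i j)) ×
     (∀ i j → locate i (turn i (0̂ , j)) ≡ locate i (0̂ , j)) ×
     (∀ i c → locate i (0̂ , rep i c) ≡ (0̂ , c))) ×
    (#types vertex + #types face ≡ #types edge) ×
    ((∀ j → proj₂ (along turn (toBase j) (0̂ , j)) ≡ base) ×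
     along turn east  (0̂ , base) ≡ ((1ℤ , 0ℤ) , base) ×
     along turn north (0̂ , base) ≡ ((0ℤ , 1ℤ) , base)))
  valid? =
    ((allDim? λ i → Fin.all? λ j → fold (0̂ , j) (turn i) (suc period) ≟ᵖ (0̂ , j)) ×-dec
     (Fin.all? λ j → turn edge (turn edge (0̂ , j)) ≟ᵖ (0̂ , j)) ×-dec
     (Fin.all? λ j → ¬? (proj₂ (reverse j) ≟ j)) ×-dec
     (Fin.all? λ j → ¬? (proj₂ (turn face (0̂ , j)) ≟ j)) ×-dec
     (Fin.all? λ j → ¬? (proj₂ (turn face (turn face (0̂ , j))) ≟ j))) ×-dec
    ((allDim? λ i → Fin.all? λ j → dist i j ℕ.≤? suc period) ×-dec
     (allDim? λ i → Fin.all? λ j → proj₂ (fold (0̂ , j) (turn i) (dist i j)) ≟ rep i (type i j)) ×-dec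
     (allDim? λ i → Fin.all? λ j → locate i (turn i (0̂ , j)) ≟ᵖ locate i (0̂ , j)) ×-dec
     (allDim? λ i → Fin.all? λ c → locate i (0̂ , rep i c) ≟ᵖ (0̂ , c))) ×-dec
    (#types vertex + #types face ℕ.≟ #types edge) ×-dec
    ((Fin.all? λ j → proj₂ (along turn (toBase j) (0̂ , j)) ≟ base) ×-dec
     (along turn east  (0̂ , base) ≟ᵖ ((1ℤ , 0ℤ) , base)) ×-dec
     (along turn north (0̂ , base) ≟ᵖ ((0ℤ , 1ℤ) , base)))

mkTiling : (T : TilingTables) → {True (TilingTables.valid? T)} → Tiling
mkTiling T {valid} =
  let (order , twice , moves , fmoves , fmoves²) , (bound , drep , lturn , lrep) , eu , (toB , ea , no′) = toWitness valid
  in record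
    { TilingTables T
    ; turn-order = order ; reverse-twice = twice ; reverse-moves = moves
    ; face-moves = fmoves ; face-moves² = fmoves² ; dist-≤ = bound ; dist-rep = drep
    ; locate-turn₀ = lturn ; locate-rep₀ = lrep ; euler = eu
    ; toBase-base = toB ; east-step = ea ; north-step = no′
    }

mkSymmetry : (𝒯 : Tiling) → let open Tiling 𝒯 in
           (a b c d : ℤ) (image : Dim → Step q q) (speed : ℕ) (delay : Dim → ℕ) →
           let act : Dim → Plane → Plane
               act i (t , j) = (a ℤ.* proj₁ t ℤ.+ b ℤ.* proj₂ t , c ℤ.* proj₁ t ℤ.+ d ℤ.* proj₂ t) ⊕ proj₁ (image i j) ,
                               proj₂ (image i j)
           in
           {True (allDim? λ i → Fin.all? λ j → act i (turn i (0̂ , j)) ≟ᵖ fold (act i (0̂ , j)) (turn i) speed)} →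
           {True (allDim? λ i → Fin.all? λ j → fold (act i (0̂ , j)) (turn i) (delay i) ≟ᵖ
                                             fold (act vertex (0̂ , j)) (turn vertex) (delay i))} →
           Symmetry 𝒯
mkSymmetry 𝒯 a b c d image speed delay {turns} {meets} = record
  { a = a ; b = b ; c = c ; d = d ; image = image
  ; speed = speed ; act-turn₀ = toWitness turns
  ; delay = delay ; act-meet₀ = toWitness meets
  }

mkInverse : {𝒯 : Tiling} (S S′ : Symmetry 𝒯) →
          let module S  = Symmetry S
              module S′ = Symmetry S′
          in
          {True (≡-dec ℤ._≟_ ℤ._≟_ (S′.linear (S.a , S.c)) (1ℤ , 0ℤ))} →
          {True (≡-dec ℤ._≟_ ℤ._≟_ (S′.linear (S.b , S.d)) (0ℤ , 1ℤ))} →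
          {True (allDim? λ i → Fin.all? λ j → S′.act i (S.act i (0̂ , j)) ≟ᵖ (0̂ , j))} →
          Inverse S S′
mkInverse S S′ {col₁} {col₂} {acts} = record
  { linear-inverse = λ { (x , y) → trans (columns x y)
      (trans (cong₂ (λ u v → x · u ⊕ y · v) (toWitness col₁) (toWitness col₂)) (unit x y)) }
  ; act-inverse    = toWitness acts
  }
  where
  module S  = Symmetry S
  module S′ = Symmetry S′
  columns : ∀ x y → S′.linear (S.linear (x , y)) ≡ x · S′.linear (S.a , S.c) ⊕ y · S′.linear (S.b , S.d)
  columns x y = cong₂ _,_ (expand S′.a S′.b S.a S.b S.c S.d x y) (expand S′.c S′.d S.a S.b S.c S.d x y)
    where
    expand : ∀ p q a b c d x y → p ℤ.* (a ℤ.* x ℤ.+ b ℤ.* y) ℤ.+ q ℤ.* (c ℤ.* x ℤ.+ d ℤ.* y) ≡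
             x ℤ.* (p ℤ.* a ℤ.+ q ℤ.* c) ℤ.+ y ℤ.* (p ℤ.* b ℤ.+ q ℤ.* d)
    expand = solve-∀
  unit : ∀ x y → x · (1ℤ , 0ℤ) ⊕ y · (0ℤ , 1ℤ) ≡ (x , y)
  unit x y = cong₂ _,_ (eq₁ x y) (eq₂ x y)
    where
    eq₁ : ∀ x y → x ℤ.* 1ℤ ℤ.+ y ℤ.* 0ℤ ≡ x
    eq₁ = solve-∀
    eq₂ : ∀ x y → x ℤ.* 0ℤ ℤ.+ y ℤ.* 1ℤ ≡ y
    eq₂ = solve-∀

mkEdgeClasses : {𝒯 : Tiling} (k : ℕ) → let open Tiling 𝒯 in
  {r : ℕ} (generator inv : Fin (suc r) → Symmetry 𝒯) →
  (∀ s → Inverse (generator s) (inv s)) → (∀ s → Inverse (inv s) (generator s)) →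
  (class : Fin q → Fin k) (representative : Fin k → Fin q) (moves : Fin q → List (Maybe (Fin (suc r)))) →
  {True (Fin.all? λ c → class (representative c) ≟ c)} →
  {True (Fin.all? λ j → class (proj₂ (reverse j)) ≟ class j)} →
  {True (Fin.all? λ j → along (maybe (λ s j → proj₂ (Symmetry.image (generator s) edge j)) (λ j → proj₂ (reverse j))) (moves j) j
                        ≟ representative (class j))} →
  EdgeClasses 𝒯 k
mkEdgeClasses k generator inv after before class representative moves {cr} {cv} {mr} = record
  { generator = generator ; inverse = inv ; inverse-after = after ; inverse-before = before
  ; generator₀ = zero ; class = class ; representative = representative
  ; class-rep = toWitness cr ; class-reverse = toWitness cv ; moves = moves ; moves-rep = toWitness mr
  }

mkSeparation : {𝒯 : Tiling} (𝒞 : EdgeClasses 𝒯 2) (word : List Dim) →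
  let open EdgeClasses 𝒞
      open PlaneReversal 𝒯
  in
  {True (Fin.all? λ j → proj₂ (walk direct word (0̂ , j)) ≟ j)} →
  {True (Fin.all? λ j → proj₂ (walk mirrored word (0̂ , j)) ≟ j)} →
  {True (Fin.all? λ j → (class j ≟ zero) →-dec (proj₂ (proj₁ (walk direct word (0̂ , j))) ℤ.≟ 0ℤ))} →
  {True (Fin.all? λ j → (class j ≟ suc zero) →-dec (ℤ.∣ proj₂ (proj₁ (walk direct word (0̂ , j))) ∣ ℕ.≟ 1))} →
  {True (Fin.all? λ j → (class j ≟ suc zero) →-dec (ℤ.∣ proj₂ (proj₁ (walk mirrored word (0̂ , j))) ∣ ℕ.≟ 1))} →
  Separation 𝒞
mkSeparation 𝒞 word {k₁} {k₂} {z} {a₁} {a₂} = record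
  { word      = word
  ; word-kind = λ { direct → toWitness k₁ ; mirrored → toWitness k₂ }
  ; along-0   = toWitness z
  ; across-1  = λ { direct → toWitness a₁ ; mirrored → toWitness a₂ }
  }

still : ∀ {q r} → (Fin q → Fin r) → Step q r
still f j = 0̂ , f j

never upsideDown : Dim → ℕ
never _ = 0
upsideDown = byDim 0 0 1

-- `(t , j)` is the dart that leaves the lattice point `t` in the direction `e₆ j`.
rotate₁ reverse₁ : Step 6 6
rotate₁    = still next₆
reverse₁ j = e₆ j , next₆ (next₆ (next₆ j))

triangularTables : TilingTables
triangularTables = record
  { q       = 6
  ; base    = 0F
  ; rotate  = rotate₁
  ; reverse = reverse₁
  ; #types  = byDim 1 3 2
  ; type    = byDim (λ _ → 0F)
                (Vec.lookup (0F ∷ 1F ∷ 2F ∷ 0F ∷ 1F ∷ 2F ∷ []))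
                (Vec.lookup (0F ∷ 1F ∷ 0F ∷ 1F ∷ 0F ∷ 1F ∷ []))
  ; rep     = byDim (λ _ → 0F) (Vec.lookup (0F ∷ 1F ∷ 2F ∷ [])) (Vec.lookup (0F ∷ 1F ∷ []))
  ; dist    = byDim
                (Vec.lookup (0 ∷ 5 ∷ 4 ∷ 3 ∷ 2 ∷ 1 ∷ []))
                (Vec.lookup (0 ∷ 0 ∷ 0 ∷ 1 ∷ 1 ∷ 1 ∷ []))
                (Vec.lookup (0 ∷ 0 ∷ 1 ∷ 1 ∷ 2 ∷ 2 ∷ []))
  ; period  = 5
  ; toBase  = λ j → List.replicate (6 ∸ toℕ j) vertex
  ; east    = edge ∷ vertex ∷ vertex ∷ vertex ∷ []
  ; north   = vertex ∷ vertex ∷ edge ∷ vertex ∷ []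
  }

triangular : Tiling
triangular = mkTiling triangularTables

-- In the tilings (3,6;4,4) and (4,4;3,6) the kinds 0, …, 5 are the darts with a
-- hexagon on their left, respectively those that leave a vertex of valence 6,
-- and j + 6 is the kind of the reverses of the darts of kind j.
both : (Fin 6 → Fin 6) → Fin 12 → Fin 12
both f j = [ (λ i → f i ↑ˡ 6) , (λ i → 6 ↑ʳ f i) ]′ (splitAt 6 j)

swap : Fin 12 → Fin 12
swap j = [ (λ i → 6 ↑ʳ i) , (λ i → i ↑ˡ 6) ]′ (splitAt 6 j)

-- The lattice point `t` is the centre of the hexagon at the edge, respectively its end of valence
-- 6. The tilings are dual to each other, which interchanges the two branches.
rotate₂ rotate₃ : Step 12 12
rotate₂ j = [ (λ i → e₆ i , 6 ↑ʳ next₆ (next₆ i)) , (λ i → 0̂ , next₆ i ↑ˡ 6) ]′ (splitAt 6 j)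
rotate₃ j = [ (λ i → 0̂ , next₆ i ↑ˡ 6) , (λ i → e₆ i , 6 ↑ʳ next₆ (next₆ i)) ]′ (splitAt 6 j)

-- By duality the tables serve both tilings. `around₃` names the three cells of degree 4 per lattice
-- point, vertices of one tiling and faces of the other; `around₆` names the cell of degree 6 and
-- the two of degree 3.
around₃ : Fin 12 → Fin 3
around₃ = Vec.lookup (0F ∷ 1F ∷ 2F ∷ 0F ∷ 1F ∷ 2F ∷ 1F ∷ 2F ∷ 0F ∷ 1F ∷ 2F ∷ 0F ∷ [])

around₆ : Fin 12 → Fin 3
around₆ = Vec.lookup (0F ∷ 0F ∷ 0F ∷ 0F ∷ 0F ∷ 0F ∷ 1F ∷ 2F ∷ 1F ∷ 2F ∷ 1F ∷ 2F ∷ [])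

dist₃ dist₆ dist₂ : Fin 12 → ℕ
dist₃ = Vec.lookup (0 ∷ 0 ∷ 0 ∷ 2 ∷ 2 ∷ 2 ∷ 1 ∷ 1 ∷ 3 ∷ 3 ∷ 3 ∷ 1 ∷ [])
dist₆ = Vec.lookup (0 ∷ 5 ∷ 4 ∷ 3 ∷ 2 ∷ 1 ∷ 0 ∷ 0 ∷ 2 ∷ 2 ∷ 1 ∷ 1 ∷ [])
dist₂ = Vec.lookup (0 ∷ 0 ∷ 0 ∷ 0 ∷ 0 ∷ 0 ∷ 1 ∷ 1 ∷ 1 ∷ 1 ∷ 1 ∷ 1 ∷ [])

rep₃ rep₆ : Fin 3 → Fin 12
rep₃ = Vec.lookup (0F ∷ 1F ∷ 2F ∷ [])
rep₆ = Vec.lookup (0F ∷ 6F ∷ 7F ∷ [])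

unswapped : Fin 12 → Fin 6
unswapped j = [ id , id ]′ (splitAt 6 j)

toBaseBy : Dim → Fin 12 → List Dim
toBaseBy i j = [ (λ k → List.replicate (6 ∸ toℕ k) i) , (λ k → edge ∷ List.replicate (6 ∸ toℕ k) i) ]′ (splitAt 6 j)

kagomeTables : TilingTables
kagomeTables = record
  { q       = 12
  ; base    = 0F
  ; rotate  = rotate₂
  ; reverse = still swap
  ; #types  = byDim 3 6 3
  ; type    = byDim around₃ unswapped around₆
  ; rep     = byDim rep₃ (_↑ˡ 6) rep₆
  ; dist    = byDim dist₃ dist₂ dist₆
  ; period  = 11
  ; toBase  = toBaseBy face
  ; east    = vertex ∷ vertex ∷ face ∷ face ∷ face ∷ []
  ; north   = face ∷ face ∷ vertex ∷ vertex ∷ face ∷ []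
  }

kagome : Tiling
kagome = mkTiling kagomeTables

rhombilleTables : TilingTables
rhombilleTables = record
  { q       = 12
  ; base    = 0F
  ; rotate  = rotate₃
  ; reverse = still swap
  ; #types  = byDim 3 6 3
  ; type    = byDim around₆ unswapped around₃
  ; rep     = byDim rep₆ (_↑ˡ 6) rep₃
  ; dist    = byDim dist₆ dist₂ dist₃
  ; period  = 11
  ; toBase  = toBaseBy vertex
  ; east    = edge ∷ vertex ∷ edge ∷ vertex ∷ vertex ∷ vertex ∷ vertex ∷ []
  ; north   = vertex ∷ vertex ∷ edge ∷ vertex ∷ edge ∷ vertex ∷ vertex ∷ []
  }

rhombille : Tiling
rhombille = mkTiling rhombilleTables

squareTables : TilingTables
squareTables = record
  { q       = 4
  ; base    = 0F
  ; rotate  = still next₄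
  ; reverse = λ j → e₄ j , next₄ (next₄ j)
  ; #types  = byDim 1 2 1
  ; type    = byDim (λ _ → 0F) (Vec.lookup (0F ∷ 1F ∷ 0F ∷ 1F ∷ [])) (λ _ → 0F)
  ; rep     = byDim (λ _ → 0F) (Vec.lookup (0F ∷ 1F ∷ [])) (λ _ → 0F)
  ; dist    = byDim (Vec.lookup (0 ∷ 3 ∷ 2 ∷ 1 ∷ [])) (Vec.lookup (0 ∷ 0 ∷ 1 ∷ 1 ∷ [])) (Vec.lookup (0 ∷ 1 ∷ 2 ∷ 3 ∷ []))
  ; period  = 3
  ; toBase  = λ j → List.replicate (4 ∸ toℕ j) vertex
  ; east    = edge ∷ vertex ∷ vertex ∷ []
  ; north   = vertex ∷ edge ∷ vertex ∷ []
  }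

square : Tiling
square = mkTiling squareTables

-- Symmetries of the four tilings

next₆³ next₆⁵ mirror₆ : Fin 6 → Fin 6
next₆³ = next₆ ∘ next₆ ∘ next₆
next₆⁵ = next₆ ∘ next₆ ∘ next₆³
mirror₆ = Vec.lookup (0F ∷ 5F ∷ 4F ∷ 3F ∷ 2F ∷ 1F ∷ [])

-- The sector between two shortest vectors is named after the first of them.
mirrorSector : Fin 6 → Fin 6
mirrorSector = next₆⁵ ∘ mirror₆

inversion₁ rotation₁ rotation₁⁻ reflection₁ : Symmetry triangular
inversion₁  = mkSymmetry triangular -1ℤ 0ℤ 0ℤ -1ℤ (λ _ → still next₆³) 1 never
rotation₁   = mkSymmetry triangular 1ℤ -1ℤ 1ℤ 0ℤ (λ _ → still next₆) 1 never
rotation₁⁻  = mkSymmetry triangular 0ℤ 1ℤ -1ℤ 1ℤ (λ _ → still next₆⁵) 1 never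
reflection₁ = mkSymmetry triangular 1ℤ -1ℤ 0ℤ -1ℤ
  (byDim (still mirror₆) (still mirror₆) (reverse₁ ∘ mirror₆)) 5 upsideDown

inversion₂ rotation₂ rotation₂⁻ reflection₂ : Symmetry kagome
inversion₂  = mkSymmetry kagome -1ℤ 0ℤ 0ℤ -1ℤ (λ _ → still (both next₆³)) 1 never
rotation₂   = mkSymmetry kagome 1ℤ -1ℤ 1ℤ 0ℤ (λ _ → still (both next₆)) 1 never
rotation₂⁻  = mkSymmetry kagome 0ℤ 1ℤ -1ℤ 1ℤ (λ _ → still (both next₆⁵)) 1 never
reflection₂ = mkSymmetry kagome 1ℤ -1ℤ 0ℤ -1ℤ
  -- A reflection moves the hexagon from the left of a dart to the right, hence `swap`; the dart
  -- that stands for the face is the reverse and has the hexagon on its left again.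
  (byDim (still (swap ∘ both mirrorSector)) (still (swap ∘ both mirrorSector)) (still (both mirrorSector))) 11 upsideDown

inversion₃ rotation₃ rotation₃⁻ reflection₃ : Symmetry rhombille
inversion₃  = mkSymmetry rhombille -1ℤ 0ℤ 0ℤ -1ℤ (λ _ → still (both next₆³)) 1 never
rotation₃   = mkSymmetry rhombille 1ℤ -1ℤ 1ℤ 0ℤ (λ _ → still (both next₆)) 1 never
rotation₃⁻  = mkSymmetry rhombille 0ℤ 1ℤ -1ℤ 1ℤ (λ _ → still (both next₆⁵)) 1 never
reflection₃ = mkSymmetry rhombille 1ℤ -1ℤ 0ℤ -1ℤ
  (byDim (still (both mirrorSector)) (still (both mirrorSector)) (still (swap ∘ both mirrorSector))) 11 upsideDown

inversion₄ rotation₄ rotation₄⁻ : Symmetry square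
inversion₄ = mkSymmetry square -1ℤ 0ℤ 0ℤ -1ℤ (λ _ → still (next₄ ∘ next₄)) 1 never
rotation₄  = mkSymmetry square 0ℤ -1ℤ 1ℤ 0ℤ (λ _ → still next₄) 1 never
rotation₄⁻ = mkSymmetry square 0ℤ 1ℤ -1ℤ 0ℤ (λ _ → still (next₄ ∘ next₄ ∘ next₄)) 1 never

-- Classes of edges and the words that separate them

pick : {A : Set} → A → A → Fin 2 → A
pick x y 0F = x
pick x y 1F = y

private
  Moves : ℕ → Set
  Moves r = List (Maybe (Fin r))

  doubled : {r : ℕ} → (Fin 6 → Moves r) → Fin 12 → Moves r
  doubled f j = [ f , (λ i → nothing ∷ f i) ]′ (splitAt 6 j)

  turns : ∀ n → Fin n → Moves 1
  turns n j = List.replicate (n ∸ toℕ j) (just 0F)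

  halfTurn : Fin 6 → Moves 1
  halfTurn = Vec.lookup ([] ∷ [] ∷ [] ∷ half ∷ half ∷ half ∷ [])
    where
    half : Moves 1
    half = just 0F ∷ []

  -- The last argument follows each reflection.
  reflections : Moves 2 → Fin 6 → Moves 2
  reflections w = Vec.lookup ([] ∷ [] ∷ (half ∷ mirror ∷ w) ∷ (half ∷ []) ∷ (half ∷ []) ∷ (mirror ∷ w) ∷ [])
    where
    half mirror : Maybe (Fin 2)
    half = just 0F
    mirror = just 1F

  direction : Fin 6 → Fin 3
  direction = Vec.lookup (0F ∷ 1F ∷ 2F ∷ 0F ∷ 1F ∷ 2F ∷ [])

  horizontal : Fin 6 → Fin 2
  horizontal = Vec.lookup (0F ∷ 1F ∷ 1F ∷ 0F ∷ 1F ∷ 1F ∷ [])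

  -- The sectors 1 and 4 are centred on the perpendicular to `e₆ 0F`. A side of a hexagon in such a
  -- sector is parallel to `e₆ 0F`, and across a dart of valence 6 that points into it the strip of
  -- faces runs in this direction.
  horizontalSector : Fin 6 → Fin 2
  horizontalSector = Vec.lookup (1F ∷ 0F ∷ 1F ∷ 1F ∷ 0F ∷ 1F ∷ [])

triangular-1 : EdgeClasses triangular 1
triangular-1 = mkEdgeClasses 1 (λ _ → rotation₁) (λ _ → rotation₁⁻)
  (λ _ → mkInverse rotation₁ rotation₁⁻) (λ _ → mkInverse rotation₁⁻ rotation₁)
  (λ _ → 0F) (λ _ → 0F) (turns 6)

triangular-2 : EdgeClasses triangular 2
triangular-2 = mkEdgeClasses 2 (pick inversion₁ reflection₁) (pick inversion₁ reflection₁) self self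
  horizontal (pick 0F 1F) (reflections [])
  where
  self : ∀ s → Inverse (pick inversion₁ reflection₁ s) (pick inversion₁ reflection₁ s)
  self 0F = mkInverse inversion₁ inversion₁
  self 1F = mkInverse reflection₁ reflection₁

triangular-3 : EdgeClasses triangular 3
triangular-3 = mkEdgeClasses 3 (λ _ → inversion₁) (λ _ → inversion₁)
  (λ _ → mkInverse inversion₁ inversion₁) (λ _ → mkInverse inversion₁ inversion₁)
  direction (_↑ˡ 3) halfTurn

-- The word goes straight on: traverse the edge, then take the dart opposite to the one pointing
-- back, three turns away.
triangular-separation : Separation triangular-2
triangular-separation = mkSeparation triangular-2 (edge ∷ vertex ∷ vertex ∷ vertex ∷ [])

kagome-1 : EdgeClasses kagome 1
kagome-1 = mkEdgeClasses 1 (λ _ → rotation₂) (λ _ → rotation₂⁻)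
  (λ _ → mkInverse rotation₂ rotation₂⁻) (λ _ → mkInverse rotation₂⁻ rotation₂)
  (λ _ → 0F) (λ _ → 0F) (doubled (turns 6))

kagome-2 : EdgeClasses kagome 2
kagome-2 = mkEdgeClasses 2 (pick inversion₂ reflection₂) (pick inversion₂ reflection₂) self self
  (horizontalSector ∘ unswapped) (pick 1F 0F) (doubled (reflections (nothing ∷ [])))
  where
  self : ∀ s → Inverse (pick inversion₂ reflection₂ s) (pick inversion₂ reflection₂ s)
  self 0F = mkInverse inversion₂ inversion₂
  self 1F = mkInverse reflection₂ reflection₂

kagome-3 : EdgeClasses kagome 3
kagome-3 = mkEdgeClasses 3 (λ _ → inversion₂) (λ _ → inversion₂)
  (λ _ → mkInverse inversion₂ inversion₂) (λ _ → mkInverse inversion₂ inversion₂)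
  (direction ∘ unswapped) (_↑ˡ 9) (doubled halfTurn)

-- Going straight on across a vertex of valence 4 puts hexagon and triangle alternately on the left,
-- so only two edges together make a lattice vector.
kagome-separation : Separation kagome-2
kagome-separation = mkSeparation kagome-2 (edge ∷ vertex ∷ vertex ∷ edge ∷ vertex ∷ vertex ∷ [])

rhombille-1 : EdgeClasses rhombille 1
rhombille-1 = mkEdgeClasses 1 (λ _ → rotation₃) (λ _ → rotation₃⁻)
  (λ _ → mkInverse rotation₃ rotation₃⁻) (λ _ → mkInverse rotation₃⁻ rotation₃)
  (λ _ → 0F) (λ _ → 0F) (doubled (turns 6))

rhombille-2 : EdgeClasses rhombille 2
rhombille-2 = mkEdgeClasses 2 (pick inversion₃ reflection₃) (pick inversion₃ reflection₃) self self
  (horizontalSector ∘ unswapped) (pick 1F 0F) (doubled (reflections []))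
  where
  self : ∀ s → Inverse (pick inversion₃ reflection₃ s) (pick inversion₃ reflection₃ s)
  self 0F = mkInverse inversion₃ inversion₃
  self 1F = mkInverse reflection₃ reflection₃

rhombille-3 : EdgeClasses rhombille 3
rhombille-3 = mkEdgeClasses 3 (λ _ → inversion₃) (λ _ → inversion₃)
  (λ _ → mkInverse inversion₃ inversion₃) (λ _ → mkInverse inversion₃ inversion₃)
  (direction ∘ unswapped) (_↑ˡ 9) (doubled halfTurn)

-- The word crosses to the opposite side of a quadrilateral and enters the next one there; the strip
-- repeats after two faces.
rhombille-separation : Separation rhombille-2
rhombille-separation = mkSeparation rhombille-2 (face ∷ face ∷ edge ∷ face ∷ face ∷ edge ∷ [])

square-1 : EdgeClasses square 1
square-1 = mkEdgeClasses 1 (λ _ → rotation₄) (λ _ → rotation₄⁻)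
  (λ _ → mkInverse rotation₄ rotation₄⁻) (λ _ → mkInverse rotation₄⁻ rotation₄)
  (λ _ → 0F) (λ _ → 0F) (turns 4)

square-2 : EdgeClasses square 2
square-2 = mkEdgeClasses 2 {r = 0} (λ _ → inversion₄) (λ _ → inversion₄)
  (λ _ → mkInverse inversion₄ inversion₄) (λ _ → mkInverse inversion₄ inversion₄)
  (Vec.lookup (0F ∷ 1F ∷ 0F ∷ 1F ∷ [])) (_↑ˡ 2) (Vec.lookup ([] ∷ [] ∷ (just 0F ∷ []) ∷ (just 0F ∷ []) ∷ []))

-- Developments of the maps of a given edge-symbol

module Orders (X : CellularEmbedding) where
  open Cells X

  order : ∀ i {d s} → degree i (cell i d) ≡ s → fold d (turn i) s ≡ d
  order i {d} refl = turn-degree i d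

  free : ∀ i {d s} → degree i (cell i d) ≡ s → ∀ k → 0 < k → k < s → fold d (turn i) k ≢ d
  free i {d} refl = turn-free i d

  -- `α` conjugates the turn about the left face into `α` after `σ`, so orders of faces carry over
  -- to turns about the face on the right.
  ασ-fold : ∀ d k → fold d (λ d → α (σ ⟨$⟩ʳ d)) k ≡ α (fold (α d) (turn face) k)
  ασ-fold d k = trans (sym (α-involutive _)) (cong α
    (fold-hom α (λ d → trans (α-involutive _) (cong (σ ⟨$⟩ʳ_) (sym (α-involutive d)))) d k))

  -- The turn about the face on the right of a dart.
  ρ : Dart → Dart
  ρ d = σ ⟨$⟩ˡ (α d)

  ρ-ασ : ∀ d → ρ (α (σ ⟨$⟩ʳ d)) ≡ d
  ρ-ασ d = trans (cong (σ ⟨$⟩ˡ_) (α-involutive _)) (inverseˡ σ)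

  σ-ρ : ∀ d → σ ⟨$⟩ʳ ρ d ≡ α d
  σ-ρ d = inverseʳ σ

  ρ-fold : ∀ d k → fold (fold d (λ d → α (σ ⟨$⟩ʳ d)) k) ρ k ≡ d
  ρ-fold d zero    = refl
  ρ-fold d (suc k) = trans (sym (fold-suc ρ _ k)) (trans (cong (λ d → fold d ρ k) (ρ-ασ _)) (ρ-fold d k))

  ρ-order : ∀ d k → fold (α d) (turn face) k ≡ α d → fold d ρ k ≡ d
  ρ-order d k closed = trans (cong (λ d → fold d ρ k) (sym around)) (ρ-fold d k)
    where
    around : fold d (λ d → α (σ ⟨$⟩ʳ d)) k ≡ d
    around = trans (ασ-fold d k) (trans (cong α closed) (α-involutive d))

  ρ-free : ∀ d k → fold (α d) (turn face) k ≢ α d → fold d ρ k ≢ d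
  ρ-free d k open′ closed = open′ (trans (sym (α-involutive _)) (cong α (trans (sym (ασ-fold d k))
    (trans (cong (λ d → fold d (λ d → α (σ ⟨$⟩ʳ d)) k) (sym closed)) (back d k)))))
    where
    ασ-ρ : ∀ d → α (σ ⟨$⟩ʳ ρ d) ≡ d
    ασ-ρ d = trans (cong α (σ-ρ d)) (α-involutive d)
    back : ∀ d k → fold (fold d ρ k) (λ d → α (σ ⟨$⟩ʳ d)) k ≡ d
    back d zero    = refl
    back d (suc k) = trans (sym (fold-suc (λ d → α (σ ⟨$⟩ʳ d)) _ k))
      (trans (cong (λ d → fold d (λ d → α (σ ⟨$⟩ʳ d)) k) (ασ-ρ _)) (back d k))

  σρσρ : ∀ d → σ ⟨$⟩ʳ ρ (σ ⟨$⟩ʳ ρ d) ≡ d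
  σρσρ d = trans (σ-ρ _) (trans (cong α (σ-ρ d)) (α-involutive d))

  σρ-free : ∀ d → σ ⟨$⟩ʳ ρ d ≢ d
  σρ-free d eq = α-fixfree d (trans (sym (σ-ρ d)) eq)

triangular-development : (K : Map) → HasEdgeSymbol K ⟨ 3 , 3 ∣ 6 , 6 ⟩ → Development triangular (Map.embedding K)
triangular-development K symbol = record
  { p      = H.p
  ; p-σ    = λ { (t , j) → trans (cong (λ t → H.p (t , next₆ j)) (⊕-identityʳ t)) (H.p-R t j) }
  ; p-α    = λ { (t , j) → trans (H.p-R (t ⊕ e₆ j) (next₆ (next₆ j))) (trans (cong (σ ⟨$⟩ʳ_) (H.p-Q t j)) (σ-ρ _)) }
  ; p-kind = HexKernel.p-kind action H.p H.p-R H.p-Q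
  }
  where
  open Cells (Map.embedding K)
  open Orders (Map.embedding K)

  valence : ∀ d → degree vertex (cell vertex d) ≡ 6
  valence d = [ proj₁ , proj₁ ]′ (proj₂ (symbol d))

  size : ∀ d → degree face (cell face d) ≡ 3
  size d = [ proj₁ , proj₁ ]′ (proj₁ (symbol d))

  action : HexAction Dart
  action = record
    { R       = σ ⟨$⟩ʳ_
    ; Q       = ρ
    ; R⁶      = λ d → order vertex (valence d)
    ; Q³      = λ d → ρ-order d 3 (order face (size (α d)))
    ; RQ²     = σρσρ
    ; R²-free = λ d → free vertex (valence d) 2 z<s (s<s (s<s z<s))
    ; R³-free = λ d → free vertex (valence d) 3 z<s (s<s (s<s (s<s z<s)))
    ; Q-free  = λ d → ρ-free d 1 (free face (size (α d)) 1 z<s (s<s z<s))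
    ; RQ-free = σρ-free
    }

  module H = HexDevelopment action nonempty

square-development : (K : Map) → HasEdgeSymbol K ⟨ 4 , 4 ∣ 4 , 4 ⟩ → Development square (Map.embedding K)
square-development K symbol = record
  { p      = H.p
  ; p-σ    = λ { (t , j) → trans (cong (λ t → H.p (t , next₄ j)) (⊕-identityʳ t)) (H.p-R t j) }
  ; p-α    = λ { (t , j) → trans (H.p-R (t ⊕ e₄ j) (next₄ j)) (trans (cong (σ ⟨$⟩ʳ_) (H.p-Q t j)) (σ-ρ _)) }
  ; p-kind = SquareKernel.p-kind action H.p H.p-R H.p-Q
  }
  where
  open Cells (Map.embedding K)
  open Orders (Map.embedding K)

  valence : ∀ d → degree vertex (cell vertex d) ≡ 4
  valence d = [ proj₁ , proj₁ ]′ (proj₂ (symbol d))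

  size : ∀ d → degree face (cell face d) ≡ 4
  size d = [ proj₁ , proj₁ ]′ (proj₁ (symbol d))

  action : SquareAction Dart
  action = record
    { R       = σ ⟨$⟩ʳ_
    ; Q       = ρ
    ; R⁴      = λ d → order vertex (valence d)
    ; Q⁴      = λ d → ρ-order d 4 (order face (size (α d)))
    ; RQ²     = σρσρ
    ; R²-free = λ d → free vertex (valence d) 2 z<s (s<s (s<s z<s))
    ; Q²-free = λ d → ρ-free d 2 (free face (size (α d)) 2 z<s (s<s (s<s z<s)))
    ; RQ-free = σρ-free
    }

  module H = SquareDevelopment action nonempty

-- The darts of the two remaining tilings fall into those with U and their
-- reverses, and the symmetries of {3,6} act on the former.
module TwoKinds (X : CellularEmbedding) (U : CellularEmbedding.Dart X → Set)
  (U-irrelevant : ∀ {d} (u v : U d) → u ≡ v) (U-α : ∀ {d} → U d → ¬ U (CellularEmbedding.α X d))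
  (action : HexAction (∃ U)) (d₀ : ∃ U) where
  open CellularEmbedding X

  private module H = HexDevelopment action d₀
  open HexAction action using (R; Q)

  dart : ℤ² → Fin 6 → ∃ U
  dart t i = H.p (t , i)

  dart-R : ∀ t i → dart (t ⊕ 0̂) (next₆ i) ≡ R (dart t i)
  dart-R t i = trans (cong (λ t → H.p (t , next₆ i)) (⊕-identityʳ t)) (H.p-R t i)

  dart-Q : ∀ t i → dart (t ⊕ e₆ i) (next₆ (next₆ i)) ≡ Q (dart t i)
  dart-Q = H.p-Q

  p : ℤ² × Fin 12 → Dart
  p (t , j) = [ (λ i → proj₁ (dart t i)) , (λ i → α (proj₁ (dart t i))) ]′ (splitAt 6 j)

  p-first : ∀ t i → p (t , i ↑ˡ 6) ≡ proj₁ (dart t i)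
  p-first t i = cong [ (λ i → proj₁ (dart t i)) , (λ i → α (proj₁ (dart t i))) ]′ (Fin.splitAt-↑ˡ 6 i 6)

  p-second : ∀ t i → p (t , 6 ↑ʳ i) ≡ α (proj₁ (dart t i))
  p-second t i = cong [ (λ i → proj₁ (dart t i)) , (λ i → α (proj₁ (dart t i))) ]′ (Fin.splitAt-↑ʳ 6 6 i)

  p-swap : ∀ t j → p (t ⊕ 0̂ , swap j) ≡ α (p (t , j))
  p-swap t j = trans (cong (λ t → p (t , swap j)) (⊕-identityʳ t)) swapped
    where
    swapped : p (t , swap j) ≡ α (p (t , j))
    swapped with splitAt 6 j
    ... | inj₁ i = p-second t i
    ... | inj₂ i = trans (p-first t i) (sym (α-involutive _))

  private
    ∃-≡ : {x y : ∃ U} → proj₁ x ≡ proj₁ y → x ≡ y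
    ∃-≡ {d , u} {.d , v} refl = cong (d ,_) (U-irrelevant u v)

    dart-kind : ∀ {t t′ i i′} → proj₁ (dart t i) ≡ proj₁ (dart t′ i′) → i ≡ i′
    dart-kind eq = HexKernel.p-kind action H.p H.p-R H.p-Q (_ , _) (_ , _) (∃-≡ eq)

    α-injective : ∀ {d d′} → α d ≡ α d′ → d ≡ d′
    α-injective eq = trans (sym (α-involutive _)) (trans (cong α eq) (α-involutive _))

    mixed : ∀ {t t′ i i′} → proj₁ (dart t i) ≢ α (proj₁ (dart t′ i′))
    mixed {t} {t′} {i} {i′} eq = U-α (proj₂ (dart t′ i′)) (subst U eq (proj₂ (dart t i)))

  p-kind : ∀ x y → p x ≡ p y → proj₂ x ≡ proj₂ y
  p-kind (t , j) (t′ , j′) eq = trans (sym (Fin.join-splitAt 6 6 j)) (trans (cong (join 6 6) split) (Fin.join-splitAt 6 6 j′))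
    where
    split : splitAt 6 j ≡ splitAt 6 j′
    split with splitAt 6 j | splitAt 6 j′
    ... | inj₁ i | inj₁ i′ = cong inj₁ (dart-kind eq)
    ... | inj₂ i | inj₂ i′ = cong inj₂ (dart-kind (α-injective eq))
    ... | inj₁ i | inj₂ i′ = contradiction eq mixed
    ... | inj₂ i | inj₁ i′ = contradiction (sym eq) mixed

kagome-development : (K : Map) → HasEdgeSymbol K ⟨ 3 , 6 ∣ 4 , 4 ⟩ → Development kagome (Map.embedding K)
kagome-development K symbol = record
  { p      = 𝒦.p
  ; p-σ    = λ { (t , j) → p-rotate t j }
  ; p-α    = λ { (t , j) → 𝒦.p-swap t j }
  ; p-kind = 𝒦.p-kind
  }
  where
  open Cells (Map.embedding K)
  open Orders (Map.embedding K)

  size : Dart → ℕ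
  size d = degree face (cell face d)

  valence : ∀ d → degree vertex (cell vertex d) ≡ 4
  valence d = [ proj₁ , proj₁ ]′ (proj₂ (symbol d))

  Hex : Dart → Set
  Hex d = size d ≡ 6

  hex⇒tri : ∀ {d} → Hex d → size (α d) ≡ 3
  hex⇒tri {d} h with proj₁ (symbol d)
  ... | inj₁ (three , _) = contradiction (trans (sym h) three) λ ()
  ... | inj₂ (_ , three) = three

  tri⇒hex : ∀ {d} → size d ≡ 3 → Hex (α d)
  tri⇒hex {d} t with proj₁ (symbol d)
  ... | inj₁ (_ , six) = six
  ... | inj₂ (six , _) = contradiction (trans (sym t) six) λ ()

  along-face : ∀ d → size (turn face d) ≡ size d
  along-face d = cong (degree face) (cell-turn face d)

  σ-tri : ∀ {d} → Hex d → size (σ ⟨$⟩ʳ d) ≡ 3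
  σ-tri {d} h = trans (cong (λ d → size (σ ⟨$⟩ʳ d)) (sym (α-involutive d))) (trans (along-face (α d)) (hex⇒tri h))

  Q : Dart → Dart
  Q d = α (σ ⟨$⟩ʳ d)

  Q-hex : ∀ {d} → Hex d → Hex (Q d)
  Q-hex h = tri⇒hex (σ-tri h)

  action : HexAction (∃ Hex)
  action = record
    -- On the darts with a hexagon on the left, `R` turns about the hexagon and `Q` about the
    -- triangle on the right. Their product is `σ` applied twice, the half-turn about a vertex,
    -- which plays the edge of {3,6}.
    { R       = λ { (d , h) → turn face d , trans (along-face d) h }
    ; Q       = λ { (d , h) → Q d , Q-hex h }
    ; R⁶      = λ { (d , h) → ∃-≡ (order face h) }
    ; Q³      = λ { (d , h) → ∃-≡ (trans (ασ-fold d 3) (trans (cong α (order face (hex⇒tri h))) (α-involutive d))) }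
    ; RQ²     = λ { (d , h) → ∃-≡ (trans (RQ _) (trans (cong (λ d → σ ⟨$⟩ʳ (σ ⟨$⟩ʳ d)) (RQ d)) (order vertex (valence d)))) }
    ; R²-free = λ { (d , h) eq → free face h 2 z<s (s<s (s<s z<s)) (cong proj₁ eq) }
    ; R³-free = λ { (d , h) eq → free face h 3 z<s (s<s (s<s (s<s z<s))) (cong proj₁ eq) }
    ; Q-free  = λ { (d , h) eq → free face (hex⇒tri h) 1 z<s (s<s z<s)
                    (trans (sym (α-involutive _)) (cong α (trans (sym (ασ-fold d 1)) (cong proj₁ eq)))) }
    ; RQ-free = λ { (d , h) eq → free vertex (valence d) 2 z<s (s<s (s<s z<s)) (trans (sym (RQ d)) (cong proj₁ eq)) }
    }
    where
    ∃-≡ : {x y : ∃ Hex} → proj₁ x ≡ proj₁ y → x ≡ y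
    ∃-≡ {d , u} {.d , v} refl = cong (d ,_) (ℕ.≡-irrelevant u v)
    RQ : ∀ d → turn face (Q d) ≡ σ ⟨$⟩ʳ (σ ⟨$⟩ʳ d)
    RQ d = cong (σ ⟨$⟩ʳ_) (α-involutive _)

  start : ∃ Hex
  start with proj₁ (symbol nonempty)
  ... | inj₁ (_ , six) = α nonempty , six
  ... | inj₂ (six , _) = nonempty , six

  module 𝒦 = TwoKinds (Map.embedding K) Hex ℕ.≡-irrelevant
    (λ h h′ → contradiction (trans (sym h′) (hex⇒tri h)) λ ()) action start

  p-rotate : ∀ t j → 𝒦.p (t ⊕ proj₁ (rotate₂ j) , proj₂ (rotate₂ j)) ≡ σ ⟨$⟩ʳ 𝒦.p (t , j)
  p-rotate t j with splitAt 6 j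
  ... | inj₁ i = trans (𝒦.p-second (t ⊕ e₆ i) (next₆ (next₆ i))) (trans (cong (α ∘ proj₁) (𝒦.dart-Q t i)) (α-involutive _))
  ... | inj₂ i = trans (𝒦.p-first (t ⊕ 0̂) (next₆ i)) (cong proj₁ (𝒦.dart-R t i))

rhombille-development : (K : Map) → HasEdgeSymbol K ⟨ 4 , 4 ∣ 3 , 6 ⟩ → Development rhombille (Map.embedding K)
rhombille-development K symbol = record
  { p      = 𝒦.p
  ; p-σ    = λ { (t , j) → p-rotate t j }
  ; p-α    = λ { (t , j) → 𝒦.p-swap t j }
  ; p-kind = 𝒦.p-kind
  }
  where
  open Cells (Map.embedding K)
  open Orders (Map.embedding K)

  valence : Dart → ℕ
  valence d = degree vertex (cell vertex d)

  size : ∀ d → degree face (cell face d) ≡ 4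
  size d = [ proj₁ , proj₁ ]′ (proj₁ (symbol d))

  Six : Dart → Set
  Six d = valence d ≡ 6

  six⇒three : ∀ {d} → Six d → valence (α d) ≡ 3
  six⇒three {d} h with proj₂ (symbol d)
  ... | inj₁ (three , _) = contradiction (trans (sym h) three) λ ()
  ... | inj₂ (_ , three) = three

  three⇒six : ∀ {d} → valence d ≡ 3 → Six (α d)
  three⇒six {d} t with proj₂ (symbol d)
  ... | inj₁ (_ , six) = six
  ... | inj₂ (six , _) = contradiction (trans (sym t) six) λ ()

  around : ∀ d → valence (σ ⟨$⟩ʳ d) ≡ valence d
  around d = cong (degree vertex) (cell-turn vertex d)

  Q : Dart → Dart
  Q d = α (turn face d)

  Q-six : ∀ {d} → Six d → Six (Q d)
  Q-six {d} h = three⇒six (trans (around (α d)) (six⇒three h))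

  Q-fold : ∀ d k → fold d Q k ≡ α (fold (α d) (turn vertex) k)
  Q-fold d k = trans (sym (α-involutive _)) (cong α (fold-hom α (λ d → α-involutive _) d k))

  action : HexAction (∃ Six)
  action = record
    -- `R` turns about the end of valence 6 and `Q` about the end of valence 3. Their product is two
    -- steps along the face, the half-turn about a quadrilateral, which plays the edge of {3,6}.
    { R       = λ { (d , h) → σ ⟨$⟩ʳ d , trans (around d) h }
    ; Q       = λ { (d , h) → Q d , Q-six h }
    ; R⁶      = λ { (d , h) → ∃-≡ (order vertex h) }
    ; Q³      = λ { (d , h) → ∃-≡ (trans (Q-fold d 3) (trans (cong α (order vertex (six⇒three h))) (α-involutive d))) }
    ; RQ²     = λ { (d , h) → ∃-≡ (order face (size d)) }
    ; R²-free = λ { (d , h) eq → free vertex h 2 z<s (s<s (s<s z<s)) (cong proj₁ eq) }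
    ; R³-free = λ { (d , h) eq → free vertex h 3 z<s (s<s (s<s (s<s z<s))) (cong proj₁ eq) }
    ; Q-free  = λ { (d , h) eq → free vertex (six⇒three h) 1 z<s (s<s z<s)
                    (trans (sym (α-involutive _)) (cong α (trans (sym (Q-fold d 1)) (cong proj₁ eq)))) }
    ; RQ-free = λ { (d , h) eq → free face (size d) 2 z<s (s<s (s<s z<s)) (cong proj₁ eq) }
    }
    where
    ∃-≡ : {x y : ∃ Six} → proj₁ x ≡ proj₁ y → x ≡ y
    ∃-≡ {d , u} {.d , v} refl = cong (d ,_) (ℕ.≡-irrelevant u v)

  start : ∃ Six
  start with proj₂ (symbol nonempty)
  ... | inj₁ (_ , six) = α nonempty , six
  ... | inj₂ (six , _) = nonempty , six

  module 𝒦 = TwoKinds (Map.embedding K) Six ℕ.≡-irrelevant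
    (λ h h′ → contradiction (trans (sym h′) (six⇒three h)) λ ()) action start

  p-rotate : ∀ t j → 𝒦.p (t ⊕ proj₁ (rotate₃ j) , proj₂ (rotate₃ j)) ≡ σ ⟨$⟩ʳ 𝒦.p (t , j)
  p-rotate t j with splitAt 6 j
  ... | inj₁ i = trans (𝒦.p-first (t ⊕ 0̂) (next₆ i)) (cong proj₁ (𝒦.dart-R t i))
  ... | inj₂ i = trans (𝒦.p-second (t ⊕ e₆ i) (next₆ (next₆ i))) (trans (cong (α ∘ proj₁) (𝒦.dart-Q t i)) (α-involutive _))

-- Covers with a prescribed number of edge orbits

CoverWithOrbits : Map → ℕ → Set
CoverWithOrbits K k = ∃ λ (M : Map) → Covering M K × Toroidal M × EdgeOrbital M k

-- Negation preserves every lattice, so these symmetries descend to `K` whatever its periods are.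
Central : {𝒯 : Tiling} → Symmetry 𝒯 → Set
Central S = ∀ u → Symmetry.linear S u ≡ ⊖ u

-- This shape preserves nℤ × 2nℤ: the second coordinate stays a multiple of 2n, and what it adds to
-- the first is a multiple of n.
UpperTriangular : {𝒯 : Tiling} → Symmetry 𝒯 → Set
UpperTriangular S = Symmetry.c S ≡ 0ℤ

module Covers {𝒯 : Tiling} (K : Map) (𝒟 : Development 𝒯 (Map.embedding K)) where

  open DevelopmentProperties 𝒟 using (Period)

  module _ {k : ℕ} (𝒞 : EdgeClasses 𝒯 k)
    (central  : ∀ s → Central (EdgeClasses.generator 𝒞 s))
    (central⁻ : ∀ s → Central (EdgeClasses.inverse 𝒞 s)) where
    open EdgeClasses 𝒞

    orbit-bound : ∀ {m} → EdgeOrbital K m → m ≤ k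
    orbit-bound = EdgeOrbits.orbits-≤ 𝒞 K 𝒟 
      (λ s → descends (generator s) (central s)) (λ s → descends (inverse s) (central⁻ s))
      where
      descends : (S : Symmetry 𝒯) → Central S → ∀ u → Period u → Period (Symmetry.linear S u)
      descends S central u pu = subst Period (sym (central u)) (Periods.period-⊖ 𝒟 u pu)

  module Multiples (n-1 : ℕ) (periods : ∀ a b → Period (a ℤ.* + suc n-1 , b ℤ.* + suc n-1)) where

    n : ℕ
    n = suc n-1

    periodic : ∀ u → Torus.Lattice 𝒯 n n u → Period u
    periodic u (divides a eq₁ , divides b eq₂) = subst Period (sym (cong₂ _,_ eq₁ eq₂)) (periods a b)

    periodic₂ : ∀ u → Torus.Lattice 𝒯 n (2 * n) u → Period u
    periodic₂ u (divides a eq₁ , divides b eq₂) =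
      subst Period (sym (cong₂ _,_ eq₁ (trans eq₂ double))) (periods a (b ℤ.* + 2))
      where
      double : b ℤ.* + (2 * n) ≡ b ℤ.* + 2 ℤ.* + n
      double = trans (cong (b ℤ.*_) (ℤ.pos-* 2 n)) (sym (ℤ.*-assoc b (+ 2) (+ n)))

    module M₁ = TorusCover 𝒯 K 𝒟 n n periodic
    module M₂ = TorusCover 𝒯 K 𝒟 n (2 * n) periodic₂

    one-orbit : EdgeClasses 𝒯 1 → CoverWithOrbits K 1
    one-orbit 𝒞 = M₁.map , M₁.covering , M₁.toroidal ,
      EdgeOrbits.orbital 𝒞 M₁.map M₁.𝒳.development (λ s → descends (generator s)) (λ s → descends (inverse s))
        (λ _ _ _ → unique _ _)
      where
      open EdgeClasses 𝒞
      descends : (S : Symmetry 𝒯) → ∀ u → DevelopmentProperties.Period M₁.𝒳.development u →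
                 DevelopmentProperties.Period M₁.𝒳.development (Symmetry.linear S u)
      descends S u pu = let d₁ , d₂ = M₁.𝒳.period⇒lattice u pu in
        M₁.𝒳.lattice⇒period (linear u)
          ( ∣m∣n⇒∣m+n (∣n⇒∣m*n a d₁) (∣n⇒∣m*n b d₂) , ∣m∣n⇒∣m+n (∣n⇒∣m*n c d₁) (∣n⇒∣m*n d d₂) )
        where open Symmetry S
      unique : (c c′ : Fin 1) → c ≡ c′
      unique zero zero = refl

    two-orbits : (𝒞 : EdgeClasses 𝒯 2) → Separation 𝒞 →
                 (∀ s → UpperTriangular (EdgeClasses.generator 𝒞 s)) →
                 (∀ s → UpperTriangular (EdgeClasses.inverse 𝒞 s)) → CoverWithOrbits K 2
    two-orbits 𝒞 𝒮 upper upper⁻ = M₂.map , M₂.covering , M₂.toroidal ,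
      EdgeOrbits.orbital 𝒞 M₂.map M₂.𝒳.development (λ s → descends (generator s) (upper s)) (λ s → descends (inverse s) (upper⁻ s))
        (Separated.separate 𝒮 K 𝒟 n periodic₂)
      where
      open EdgeClasses 𝒞
      descends : (S : Symmetry 𝒯) → UpperTriangular S → ∀ u → DevelopmentProperties.Period M₂.𝒳.development u →
                 DevelopmentProperties.Period M₂.𝒳.development (Symmetry.linear S u)
      descends S upper u pu = let d₁ , d₂ = M₂.𝒳.period⇒lattice u pu in
        M₂.𝒳.lattice⇒period (linear u)
          ( ∣m∣n⇒∣m+n (∣n⇒∣m*n a d₁) (∣n⇒∣m*n b (∣-trans n∣2n d₂))
          , ∣m∣n⇒∣m+n (subst (λ c → + (2 * n) ∣ℤ (c ℤ.* proj₁ u)) (sym upper) (divides 0ℤ refl)) (∣n⇒∣m*n d d₂) )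
        where
        open Symmetry S
        n∣2n : + n ∣ℤ + (2 * n)
        n∣2n = divides (+ 2) (ℤ.pos-* 2 n)

identity-cover : ∀ K {m k} → Toroidal K → EdgeOrbital K m → k ≡ m → CoverWithOrbits K k
identity-cover K torus orbits refl = K , covering-id K , torus , orbits

record HexagonalTiling : Set where
  field
    𝒯                  : Tiling
    one                : EdgeClasses 𝒯 1
    two                : EdgeClasses 𝒯 2
    three              : EdgeClasses 𝒯 3
    separation-two     : Separation two
    upper              : ∀ s → UpperTriangular (EdgeClasses.generator two s)
    upper⁻             : ∀ s → UpperTriangular (EdgeClasses.inverse two s)
    central            : ∀ s → Central (EdgeClasses.generator three s)
    central⁻           : ∀ s → Central (EdgeClasses.inverse three s)

hexagonal-covers : (ℋ : HexagonalTiling) (K : Map) → Development (HexagonalTiling.𝒯 ℋ) (Map.embedding K) → Toroidal K →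
                   ∀ {m} → EdgeOrbital K m → ∀ k → 1 ≤ k → k ≤ m → CoverWithOrbits K k
hexagonal-covers ℋ K 𝒟 torus {m} orbits = λ
  { 1 _ _                         → with-period (λ n periods → C.Multiples.one-orbit n periods one)
  ; 2 _ _                         → with-period (λ n periods → C.Multiples.two-orbits n periods two separation-two upper upper⁻)
  ; k@(suc (suc (suc _))) _ k≤m → identity-cover K torus orbits
      (ℕ.≤-antisym k≤m (ℕ.≤-trans (C.orbit-bound three central central⁻ orbits) (s≤s (s≤s (s≤s z≤n))))) }
  where
  open HexagonalTiling ℋ
  module C = Covers K 𝒟
  with-period : ∀ {A : Set} → (∀ n-1 → (∀ a b → DevelopmentProperties.Period 𝒟 (a ℤ.* + suc n-1 , b ℤ.* + suc n-1)) → A) → A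
  with-period f with Periods.common-period 𝒟
  ... | suc n-1 , _ , periods = f n-1 periods

inversion-central : ∀ u → (-1ℤ ℤ.* proj₁ u ℤ.+ 0ℤ ℤ.* proj₂ u , 0ℤ ℤ.* proj₁ u ℤ.+ -1ℤ ℤ.* proj₂ u) ≡ ⊖ u
inversion-central u = cong₂ _,_ (eq₁ (proj₁ u) (proj₂ u)) (eq₂ (proj₁ u) (proj₂ u))
  where
  eq₁ : ∀ x y → -1ℤ ℤ.* x ℤ.+ 0ℤ ℤ.* y ≡ ℤ.- x
  eq₁ = solve-∀
  eq₂ : ∀ x y → 0ℤ ℤ.* x ℤ.+ -1ℤ ℤ.* y ≡ ℤ.- y
  eq₂ = solve-∀

square-covers : (K : Map) → Development square (Map.embedding K) → Toroidal K →
                ∀ {m} → EdgeOrbital K m → ∀ k → 1 ≤ k → k ≤ m → CoverWithOrbits K k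
square-covers K 𝒟 torus {m} orbits = λ
  { 1 _ _                   → cover
  ; k@(suc (suc _)) _ k≤m → identity-cover K torus orbits
      (ℕ.≤-antisym k≤m (ℕ.≤-trans (C.orbit-bound square-2 (λ _ → inversion-central) (λ _ → inversion-central) orbits) (s≤s (s≤s z≤n)))) }
  where
  module C = Covers K 𝒟
  cover : CoverWithOrbits K 1
  cover with Periods.common-period 𝒟
  ... | suc n-1 , _ , periods = C.Multiples.one-orbit n-1 periods square-1

triangular-hexagonal kagome-hexagonal rhombille-hexagonal : HexagonalTiling
triangular-hexagonal = record
  { one = triangular-1 ; two = triangular-2 ; three = triangular-3 ; separation-two = triangular-separation
  ; upper = λ { 0F → refl ; 1F → refl } ; upper⁻ = λ { 0F → refl ; 1F → refl }
  ; central = λ _ → inversion-central ; central⁻ = λ _ → inversion-central }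
kagome-hexagonal = record
  { one = kagome-1 ; two = kagome-2 ; three = kagome-3 ; separation-two = kagome-separation
  ; upper = λ { 0F → refl ; 1F → refl } ; upper⁻ = λ { 0F → refl ; 1F → refl }
  ; central = λ _ → inversion-central ; central⁻ = λ _ → inversion-central }
rhombille-hexagonal = record
  { one = rhombille-1 ; two = rhombille-2 ; three = rhombille-3 ; separation-two = rhombille-separation
  ; upper = λ { 0F → refl ; 1F → refl } ; upper⁻ = λ { 0F → refl ; 1F → refl }
  ; central = λ _ → inversion-central ; central⁻ = λ _ → inversion-central }

theorem1p7 : ((s : EdgeSymbol) →
    s ∈ ⟨ 3 , 3 ∣ 6 , 6 ⟩ ∷ ⟨ 3 , 6 ∣ 4 , 4 ⟩ ∷ ⟨ 4 , 4 ∣ 3 , 6 ⟩ ∷ [] →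
    (K₁ : Map) → Toroidal K₁ → HasEdgeSymbol K₁ s →
    (m₁ : ℕ) → EdgeOrbital K₁ m₁ →
    (k₁ : ℕ) → 1 ≤ k₁ → k₁ ≤ m₁ →
    ∃ λ (M : Map) → Covering M K₁ × Toroidal M × EdgeOrbital M k₁)
    ×
    ((K₂ : Map) → Toroidal K₂ → HasEdgeSymbol K₂ ⟨ 4 , 4 ∣ 4 , 4 ⟩ →
    (m₂ : ℕ) → EdgeOrbital K₂ m₂ →
    (k₂ : ℕ) → 1 ≤ k₂ → k₂ ≤ m₂ →
    ∃ λ (M : Map) → Covering M K₂ × Toroidal M × EdgeOrbital M k₂)
theorem1p7 =
  (λ { _ (here refl)                 K torus symbol m orbits → hexagonal-covers triangular-hexagonal K (triangular-development K symbol) torus orbits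
     ; _ (there (here refl))         K torus symbol m orbits → hexagonal-covers kagome-hexagonal K (kagome-development K symbol) torus orbits
     ; _ (there (there (here refl))) K torus symbol m orbits → hexagonal-covers rhombille-hexagonal K (rhombille-development K symbol) torus orbits }) ,
  (λ K torus symbol m orbits → square-covers K (square-development K symbol) torus orbits)
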